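{- Let $\varepsilon>0$. Then there exist infinitely many primes $p$ such that $s(p-1)\le p^{5/9+\varepsilon}$. Equivalently, there exist infinitely many primes of the form $p=am^2+1$ with $a,m\in\mathbb{N}$ and $a\le p^{5/9+\varepsilon}$.
   Context: For a natural number $n$, $s(n)$ denotes the unique square-free natural number $a$ with $\mathbb{Q}(\sqrt n)=\mathbb{Q}(\sqrt a)$; equivalently $s(n)=n/m^2$ where $m^2$ is the largest square dividing $n$. -}

module Defs where

open import Data.Nat using (ℕ; zero; suc; _*_; _/_)
open import Data.Nat.Divisibility using (_∣?_)
open import Relation.Nullary using (yes; no)

-- lsq n k : the largest j ≤ k such that (suc j)² divides n (j = 0 always works).
lsq : ℕ → ℕ → ℕ
lsq n zero = zero
lsq n (suc k) with (suc (suc k) * suc (suc k)) ∣? n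
... | yes _ = suc k
... | no _  = lsq n k

-- largest m ≥ 1 with m² ∣ n (for n ≥ 1; the search range m ≤ n suffices)
largestSqRoot : ℕ → ℕ
largestSqRoot n = suc (lsq n n)

s : ℕ → ℕ
s n = n / (suc (lsq n n) * suc (lsq n n))

module Submission where

-- We look for primes p ≡ 1 modulo (abc)², where a, b, c run over primes of sizes T^t, T^(t+1), T^(2t) and p < x = T^(18t+54),
-- so that (abc)² is x^(4/9) up to a small power of T.  As in the Bombieri–Vinogradov theorem, Buchstab's identity writes the
-- indicator of primes as short sums (type I, equidistributed because the summand has vanishing sums over a period) plus
-- bilinear forms (type II).  Write e_ℓ(u) = ℓ(ℓ-1)[u ≡ 1 mod ℓ²] and d_ℓ(u) = e_ℓ(u) - [ℓ ∤ u].  Telescoping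
-- e_a e_b e_c - [u coprime to abc] leaves terms containing some d_ℓ with ℓ prime and averaged, whose sum over a period vanishes.
-- After Cauchy's inequality over the longer variable, majorised by an iterated average, the terms ℓ ≠ ℓ′ are negligible; this
-- replaces the large sieve, and neither characters nor L-functions occur because no modulus has a small conductor.
-- If the shorter variable is at most T^(8t) one averages over c, otherwise over b.  Chebyshev's bound supplies the main term.

-- Averaging over primes of size T^r against a total modulus Q = T^q handles a block with variables
-- N = T^n ≤ N′ if, with R = T^r, the product (N′ + QR²)(N + Q) is at most about T^r x. Up to
-- bounded powers of T this means q ≤ r + n, q + r + n ≤ 18t and 2q + r ≤ 18t. For q near 8t the
-- primes c (r = 2t) cover 6t ≤ n ≤ 8t and the primes b (r = t) cover 7t ≤ n ≤ 9t, while n runs from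
-- a third to a half of 18t; this dictates the proportions 1 : 1 : 2, and the extra factor T in b
-- only keeps it apart from a. A single prime of size T^(4t) would violate the last condition.
-- Errors are allowed up to x/T³ per triple and block, so constants and powers of the logarithm only
-- have to stay below T, and additive constants such as 54 cost an exponent that tends to zero as t
-- grows. All of it takes place in ℤ: norms are kept squared, the conditions m n < x and roughness
-- become comparisons of integer labels, and ε = a/b is cleared by taking 9b-th powers.

open import Data.Nat using (ℕ; zero; suc)
open import Relation.Binary.PropositionalEquality using (_≡_; refl; sym; trans; cong; cong₂; subst; subst₂; module ≡-Reasoning)
open import Data.Empty using (⊥; ⊥-elim)
open import Data.Sum using (_⊎_; inj₁; inj₂)
open import Data.Product using (_×_; _,_; ∃-syntax; proj₁; proj₂)
open import Relation.Nullary using (¬_; Dec; yes; no)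
import Data.Nat as ℕ
import Data.Nat.Properties as ℕₚ
import Data.Nat.Divisibility as ℕᵈ
import Data.Nat.DivMod as ℕᵐ
import Data.Nat.Tactic.RingSolver as ℕˢ
import Data.Integer as ℤ
import Data.Integer.Properties as ℤₚ

-- Finite integer sums and a weighted Cauchy inequality

module Sums where

  open import Data.Integer using (ℤ; +_; -[1+_]; -≤+; -_; _+_; _-_; _*_; _≤_; _<_; ∣_∣; 0ℤ; +≤+; nonNegative)
  open import Data.Integer.Properties using (≤-refl; ≤-trans; ≤-reflexive; +-mono-≤; +-monoʳ-≤; +-monoˡ-≤; *-monoˡ-≤-nonNeg; *-monoʳ-≤-nonNeg; +-identityʳ; +-identityˡ; *-zeroʳ; *-zeroˡ; *-distribˡ-+; *-comm; +-assoc; +-comm; ∣i+j∣≤∣i∣+∣j∣; abs-*; 0≤i⇒+∣i∣≡i; pos-*; _≤?_; ≰⇒>; <⇒≱; suc-*)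
  open import Data.Integer.Tactic.RingSolver using (solve-∀)

  ≤-by : ∀ {i j} d → 0ℤ ≤ d → j ≡ i + d → i ≤ j
  ≤-by {i} d 0≤d refl = subst (_≤ i + d) (+-identityʳ i) (+-monoʳ-≤ i 0≤d)

  0≤+ : ∀ {n} → 0ℤ ≤ + n
  0≤+ = +≤+ ℕ.z≤n

  *-monoˡ : ∀ {c i j} → 0ℤ ≤ c → i ≤ j → c * i ≤ c * j
  *-monoˡ {c} 0≤c = *-monoˡ-≤-nonNeg c {{nonNegative 0≤c}}

  *-monoʳ : ∀ {c i j} → 0ℤ ≤ c → i ≤ j → i * c ≤ j * c
  *-monoʳ {c} 0≤c = *-monoʳ-≤-nonNeg c {{nonNegative 0≤c}}

  *-mono : ∀ {i j k l} → 0ℤ ≤ i → 0ℤ ≤ l → i ≤ j → k ≤ l → i * k ≤ j * l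
  *-mono 0≤i 0≤l i≤j k≤l = ≤-trans (*-monoˡ 0≤i k≤l) (*-monoʳ 0≤l i≤j)

  0≤* : ∀ {i j} → 0ℤ ≤ i → 0ℤ ≤ j → 0ℤ ≤ i * j
  0≤* {i} {j} 0≤i 0≤j = subst (_≤ i * j) (*-zeroʳ i) (*-monoˡ {i} 0≤i 0≤j)

  0≤+-+ : ∀ {i j} → 0ℤ ≤ i → 0ℤ ≤ j → 0ℤ ≤ i + j
  0≤+-+ = +-mono-≤

  0≤i² : ∀ i → 0ℤ ≤ i * i
  0≤i² (+ n) = 0≤* {+ n} {+ n} 0≤+ 0≤+
  0≤i² -[1+ n ] = +≤+ ℕ.z≤n

  ∥_∥ : ℤ → ℤ
  ∥ i ∥ = + ∣ i ∣

  ∥∥-+ : ∀ i j → ∥ i + j ∥ ≤ ∥ i ∥ + ∥ j ∥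
  ∥∥-+ i j = +≤+ (∣i+j∣≤∣i∣+∣j∣ i j)

  ∥∥-* : ∀ i j → ∥ i * j ∥ ≡ ∥ i ∥ * ∥ j ∥
  ∥∥-* i j = trans (cong +_ (abs-* i j)) (pos-* ∣ i ∣ ∣ j ∣)

  ∥∥-nonNeg : ∀ {i} → 0ℤ ≤ i → ∥ i ∥ ≡ i
  ∥∥-nonNeg = 0≤i⇒+∣i∣≡i

  i≤∥i∥ : ∀ i → i ≤ ∥ i ∥
  i≤∥i∥ (+ n) = ≤-refl
  i≤∥i∥ -[1+ n ] = -≤+

  ∥∥-neg : ∀ i → ∥ - i ∥ ≡ ∥ i ∥
  ∥∥-neg i = cong +_ (ℤₚ.∣-i∣≡∣i∣ i)

  ∥∥-- : ∀ i j → ∥ i - j ∥ ≤ ∥ i ∥ + ∥ j ∥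
  ∥∥-- i j = subst (λ z → ∥ i - j ∥ ≤ ∥ i ∥ + z) (∥∥-neg j) (∥∥-+ i (- j))

  ∥∥-sq : ∀ i → ∥ i ∥ * ∥ i ∥ ≡ i * i
  ∥∥-sq i = trans (sym (∥∥-* i i)) (∥∥-nonNeg (0≤i² i))

  -- Square roots are never formed: estimates of Cauchy type stay squared throughout, and this is
  -- how they are finally turned into bounds.
  sq-≤⇒≤ : ∀ {u v} → 0ℤ ≤ v → u * u ≤ v * v → u ≤ v
  sq-≤⇒≤ {u} {v} 0≤v u²≤v² with u ≤? v
  ... | yes u≤v = u≤v
  ... | no  u≰v = ⊥-elim (<⇒≱ (ℤₚ.≤-<-trans (*-monoˡ 0≤v (ℤₚ.<⇒≤ v<u))
                     (ℤₚ.*-monoʳ-<-pos u {{ℤ.positive (ℤₚ.≤-<-trans 0≤v v<u)}} v<u)) u²≤v²)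
    where v<u = ≰⇒> u≰v

  sq-≤⇒∥∥≤ : ∀ {u v} → 0ℤ ≤ v → u * u ≤ v * v → ∥ u ∥ ≤ v
  sq-≤⇒∥∥≤ {u} 0≤v h = sq-≤⇒≤ 0≤v (subst (_≤ _) (sym (∥∥-sq u)) h)

  ∑ : ℕ → (ℕ → ℤ) → ℤ
  ∑ zero f = 0ℤ
  ∑ (suc n) f = ∑ n f + f n

  ∑-cong< : ∀ n {f g} → (∀ i → i ℕ.< n → f i ≡ g i) → ∑ n f ≡ ∑ n g
  ∑-cong< zero h = refl
  ∑-cong< (suc n) h = cong₂ _+_ (∑-cong< n (λ i i<n → h i (ℕₚ.m<n⇒m<1+n i<n))) (h n ℕₚ.≤-refl)

  ∑-cong : ∀ n {f g} → (∀ i → f i ≡ g i) → ∑ n f ≡ ∑ n g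
  ∑-cong n h = ∑-cong< n (λ i _ → h i)

  ∑-zero : ∀ n → ∑ n (λ _ → 0ℤ) ≡ 0ℤ
  ∑-zero zero = refl
  ∑-zero (suc n) = trans (+-identityʳ _) (∑-zero n)

  ∑-zero< : ∀ n {f} → (∀ i → i ℕ.< n → f i ≡ 0ℤ) → ∑ n f ≡ 0ℤ
  ∑-zero< n h = trans (∑-cong< n h) (∑-zero n)

  ∑-+ : ∀ n f g → ∑ n (λ i → f i + g i) ≡ ∑ n f + ∑ n g
  ∑-+ zero f g = refl
  ∑-+ (suc n) f g rewrite ∑-+ n f g = lem (∑ n f) (∑ n g) (f n) (g n)
    where
    lem : ∀ a b c d → (a + b) + (c + d) ≡ (a + c) + (b + d)
    lem = solve-∀

  ∑-*ˡ : ∀ n c f → ∑ n (λ i → c * f i) ≡ c * ∑ n f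
  ∑-*ˡ zero c f = sym (*-zeroʳ c)
  ∑-*ˡ (suc n) c f rewrite ∑-*ˡ n c f = sym (*-distribˡ-+ c (∑ n f) (f n))

  ∑-*ʳ : ∀ n c f → ∑ n (λ i → f i * c) ≡ ∑ n f * c
  ∑-*ʳ n c f = trans (∑-cong n (λ i → *-comm (f i) c)) (trans (∑-*ˡ n c f) (*-comm c (∑ n f)))

  ∑-neg : ∀ n f → ∑ n (λ i → - f i) ≡ - ∑ n f
  ∑-neg zero f = refl
  ∑-neg (suc n) f rewrite ∑-neg n f = lem (∑ n f) (f n)
    where
    lem : ∀ a b → - a + - b ≡ - (a + b)
    lem = solve-∀

  ∑-- : ∀ n f g → ∑ n (λ i → f i - g i) ≡ ∑ n f - ∑ n g
  ∑-- n f g = trans (∑-+ n f (λ i → - g i)) (cong (_+_ (∑ n f)) (∑-neg n g))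

  ∑-swap : ∀ m n (f : ℕ → ℕ → ℤ) → ∑ m (λ i → ∑ n (f i)) ≡ ∑ n (λ j → ∑ m (λ i → f i j))
  ∑-swap zero n f = sym (∑-zero n)
  ∑-swap (suc m) n f = trans (cong (_+ ∑ n (f m)) (∑-swap m n f)) (sym (∑-+ n (λ j → ∑ m (λ i → f i j)) (f m)))

  ∑-split : ∀ m n f → ∑ (m ℕ.+ n) f ≡ ∑ m f + ∑ n (λ i → f (m ℕ.+ i))
  ∑-split m zero f rewrite ℕₚ.+-identityʳ m = sym (+-identityʳ _)
  ∑-split m (suc n) f rewrite ℕₚ.+-suc m n | ∑-split m n f = +-assoc (∑ m f) _ _

  ∑-blocks : ∀ b a f → ∑ (b ℕ.* a) f ≡ ∑ b (λ j → ∑ a (λ i → f (j ℕ.* a ℕ.+ i)))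
  ∑-blocks zero a f = refl
  ∑-blocks (suc b) a f rewrite ℕₚ.+-comm a (b ℕ.* a) | ∑-split (b ℕ.* a) a f | ∑-blocks b a f = refl

  ∑-mono< : ∀ n {f g} → (∀ i → i ℕ.< n → f i ≤ g i) → ∑ n f ≤ ∑ n g
  ∑-mono< zero h = ≤-refl
  ∑-mono< (suc n) h = +-mono-≤ (∑-mono< n (λ i i<n → h i (ℕₚ.m<n⇒m<1+n i<n))) (h n ℕₚ.≤-refl)

  ∑-mono : ∀ n {f g} → (∀ i → f i ≤ g i) → ∑ n f ≤ ∑ n g
  ∑-mono n h = ∑-mono< n (λ i _ → h i)

  ∑-nonNeg : ∀ n {f} → (∀ i → 0ℤ ≤ f i) → 0ℤ ≤ ∑ n f
  ∑-nonNeg n {f} h = subst (_≤ ∑ n f) (∑-zero n) (∑-mono n h)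

  ∑-const : ∀ n c → ∑ n (λ _ → c) ≡ + n * c
  ∑-const zero c = sym (*-zeroˡ c)
  ∑-const (suc n) c = trans (cong (_+ c) (∑-const n c)) (trans (+-comm (+ n * c) c) (sym (suc-* (+ n) c)))

  ∑-≤-const : ∀ n {f} c → (∀ i → f i ≤ c) → ∑ n f ≤ + n * c
  ∑-≤-const n {f} c h = subst (∑ n f ≤_) (∑-const n c) (∑-mono n h)

  ∑-∥∥ : ∀ n f → ∥ ∑ n f ∥ ≤ ∑ n (λ i → ∥ f i ∥)
  ∑-∥∥ zero f = ≤-refl
  ∑-∥∥ (suc n) f = ≤-trans (∥∥-+ (∑ n f) (f n)) (+-monoˡ-≤ ∥ f n ∥ (∑-∥∥ n f))

  ∑-grow : ∀ {m n} f → (∀ i → 0ℤ ≤ f i) → m ℕ.≤ n → ∑ m f ≤ ∑ n f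
  ∑-grow {m} {n} f h m≤n = subst (λ k → ∑ m f ≤ ∑ k f) (ℕₚ.m+[n∸m]≡n m≤n)
    (≤-by (∑ (n ℕ.∸ m) (λ i → f (m ℕ.+ i))) (∑-nonNeg (n ℕ.∸ m) (λ i → h (m ℕ.+ i))) (∑-split m (n ℕ.∸ m) f))

  ∑-term : ∀ n f {j} → (∀ i → 0ℤ ≤ f i) → j ℕ.< n → f j ≤ ∑ n f
  ∑-term n f {j} h j<n = ≤-trans (≤-by (∑ j f) (∑-nonNeg j h) (+-comm (∑ j f) (f j))) (∑-grow f h j<n)

  ∑-extend : ∀ {m n} f → m ℕ.≤ n → (∀ i → m ℕ.≤ i → f i ≡ 0ℤ) → ∑ n f ≡ ∑ m f
  ∑-extend {m} {n} f m≤n h = trans (cong (λ k → ∑ k f) (sym (ℕₚ.m+[n∸m]≡n m≤n)))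
    (trans (∑-split m (n ℕ.∸ m) f) (trans (cong (_+_ (∑ m f)) (∑-zero< (n ℕ.∸ m) (λ i _ → h (m ℕ.+ i) (ℕₚ.m≤m+n m i)))) (+-identityʳ _)))

  ∑-only : ∀ n f {j} → j ℕ.< n → (∀ i → i ℕ.< n → ¬ (i ≡ j) → f i ≡ 0ℤ) → ∑ n f ≡ f j
  ∑-only (suc n) f {j} j<n h with j ℕ.≟ n
  ... | yes refl = trans (cong (_+ f n) (∑-zero< n (λ i i<n → h i (ℕₚ.m<n⇒m<1+n i<n) (ℕₚ.<⇒≢ i<n)))) (+-identityˡ _)
  ... | no  j≢n  = trans (cong₂ _+_ (∑-only n f (ℕₚ.≤∧≢⇒< (ℕₚ.≤-pred j<n) j≢n) (λ i i<n → h i (ℕₚ.m<n⇒m<1+n i<n)))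
                                     (h n ℕₚ.≤-refl (λ n≡j → j≢n (sym n≡j)))) (+-identityʳ _)

  ∑-pos⇒∃ : ∀ n f → 0ℤ < ∑ n f → ∃[ i ] (i ℕ.< n × 0ℤ < f i)
  ∑-pos⇒∃ zero f 0<0 = ⊥-elim (ℤₚ.<-irrefl refl 0<0)
  ∑-pos⇒∃ (suc n) f 0<s with f n ≤? 0ℤ
  ... | no  fn≰0 = n , ℕₚ.≤-refl , ≰⇒> fn≰0
  ... | yes fn≤0 with ∑-pos⇒∃ n f (ℤₚ.<-≤-trans 0<s (subst (λ z → ∑ n f + f n ≤ z) (+-identityʳ _) (+-monoʳ-≤ (∑ n f) fn≤0)))
  ... | i , i<n , 0<fi = i , ℕₚ.m<n⇒m<1+n i<n , 0<fi

  ∑-product : ∀ m n f g → ∑ m f * ∑ n g ≡ ∑ m (λ i → ∑ n (λ j → f i * g j))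
  ∑-product m n f g = trans (sym (∑-*ʳ m (∑ n g) f)) (∑-cong m (λ i → sym (∑-*ˡ n (f i) g)))

  -- The cross term is controlled by (2XY)² ≤ 4B²·pr·p′r′ ≤ (B(pr′ + p′r))², where the last defect
  -- is B²(pr′ - p′r)². Pairs of nonnegative weights replace squares so that no roots appear, and
  -- the common factor B lets the same inequality add up operator bounds over blocks.
  cauchy₂ : ∀ B X Y {p r p′ r′} → 0ℤ ≤ B → 0ℤ ≤ p → 0ℤ ≤ r → 0ℤ ≤ p′ → 0ℤ ≤ r′ →
    X * X ≤ B * (p * r) → Y * Y ≤ B * (p′ * r′) → (X + Y) * (X + Y) ≤ B * ((p + p′) * (r + r′))
  cauchy₂ B X Y {p} {r} {p′} {r′} 0≤B 0≤p 0≤r 0≤p′ 0≤r′ hX hY =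
    subst₂ _≤_ (sym (expand X Y)) (sym (expand′ B p r p′ r′)) (+-mono-≤ (+-mono-≤ hX hY) cross)
    where
    expand : ∀ X Y → (X + Y) * (X + Y) ≡ (X * X + Y * Y) + + 2 * (X * Y)
    expand = solve-∀
    expand′ : ∀ B p r p′ r′ → B * ((p + p′) * (r + r′)) ≡ (B * (p * r) + B * (p′ * r′)) + B * (p * r′ + p′ * r)
    expand′ = solve-∀
    e₁ : ∀ X Y → (+ 2 * (X * Y)) * (+ 2 * (X * Y)) ≡ + 4 * ((X * X) * (Y * Y))
    e₁ = solve-∀
    e₂ : ∀ B p r p′ r′ → (B * (p * r′ + p′ * r)) * (B * (p * r′ + p′ * r))
         ≡ + 4 * ((B * (p * r)) * (B * (p′ * r′))) + (B * B) * ((p * r′ - p′ * r) * (p * r′ - p′ * r))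
    e₂ = solve-∀
    cross : + 2 * (X * Y) ≤ B * (p * r′ + p′ * r)
    cross = sq-≤⇒≤ (0≤* 0≤B (0≤+-+ (0≤* 0≤p 0≤r′) (0≤* 0≤p′ 0≤r)))
      (≤-trans (≤-reflexive (e₁ X Y))
      (≤-trans (*-monoˡ {c = + 4} 0≤+ (*-mono (0≤i² X) (0≤* 0≤B (0≤* 0≤p′ 0≤r′)) hX hY))
        (≤-by _ (0≤* (0≤i² B) (0≤i² (p * r′ - p′ * r))) (e₂ B p r p′ r′))))

  cauchy : ∀ n {B} (X p r : ℕ → ℤ) → 0ℤ ≤ B → (∀ i → 0ℤ ≤ p i) → (∀ i → 0ℤ ≤ r i) →
    (∀ i → X i * X i ≤ B * (p i * r i)) → ∑ n X * ∑ n X ≤ B * (∑ n p * ∑ n r)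
  cauchy zero {B} X p r 0≤B 0≤p 0≤r h = ≤-reflexive (sym (*-zeroʳ B))
  cauchy (suc n) X p r 0≤B 0≤p 0≤r h =
    cauchy₂ _ (∑ n X) (X n) 0≤B (∑-nonNeg n 0≤p) (∑-nonNeg n 0≤r) (0≤p n) (0≤r n) (cauchy n X p r 0≤B 0≤p 0≤r h) (h n)

-- Indicators of congruences and the functions `e`, `O`, `d` of a prime

module Congruence where

  open import Data.Nat.Coprimality using (Coprime; coprime-divisor)
  open import Data.Nat.Primality using (Prime; euclidsLemma; prime⇒irreducible; prime⇒nonZero)
  open import Data.Integer using (ℤ; +_; -_; _+_; _-_; _*_; _≤_; ∣_∣; 0ℤ; 1ℤ; +≤+)
  open import Data.Integer.Properties using (≤-refl; ≤-trans; ≤-reflexive; +-monoʳ-≤; +-monoˡ-≤; +-identityʳ; +-identityˡ; *-zeroʳ; *-zeroˡ; *-identityˡ; *-identityʳ; *-comm; +-comm; abs-*; pos-+; pos-*; ∣m⊝n∣≤m⊔n; m-n≡m⊖n; i-j≡0⇒i≡j; +-injective; ∣i∣≡0⇒i≡0; ≤-antisym)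
  open import Data.Integer.Divisibility.Signed using (_∣_; _∣?_; divides; ∣ᵤ⇒∣; ∣⇒∣ᵤ; ∣m∣n⇒∣m+n; ∣m∣n⇒∣m-n; ∣m⇒∣-m; ∣m+n∣n⇒∣m; ∣n⇒∣m*n; ∣m⇒∣m*n; ∣-trans)
  open import Data.Integer.DivMod using (_%ℕ_; _/ℕ_; n%ℕd<d; a≡a%ℕn+[a/ℕn]*n)
  open import Data.Integer.Tactic.RingSolver using (solve-∀)
  open Sums

  ind : ∀ {P : Set} → Dec P → ℤ
  ind (yes _) = 1ℤ
  ind (no _)  = 0ℤ

  ind-yes : ∀ {P : Set} (p : Dec P) → P → ind p ≡ 1ℤ
  ind-yes (yes _) x = refl
  ind-yes (no ¬x) x = ⊥-elim (¬x x)

  ind-no : ∀ {P : Set} (p : Dec P) → ¬ P → ind p ≡ 0ℤ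
  ind-no (yes x) ¬x = ⊥-elim (¬x x)
  ind-no (no _)  ¬x = refl

  ind-cong : ∀ {P Q : Set} (p : Dec P) (q : Dec Q) → (P → Q) → (Q → P) → ind p ≡ ind q
  ind-cong (yes x) q P→Q Q→P = sym (ind-yes q (P→Q x))
  ind-cong (no ¬x) q P→Q Q→P = sym (ind-no q (λ y → ¬x (Q→P y)))

  ind-* : ∀ {P Q R : Set} (p : Dec P) (q : Dec Q) (r : Dec R) → (P → Q → R) → (R → P) → (R → Q) → ind p * ind q ≡ ind r
  ind-* (yes x) (yes y) r f g h = sym (ind-yes r (f x y))
  ind-* (yes x) (no ¬y) r f g h = sym (ind-no r (λ z → ¬y (h z)))
  ind-* (no ¬x) q r f g h = trans (*-zeroˡ (ind q)) (sym (ind-no r (λ z → ¬x (g z))))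

  0≤ind : ∀ {P : Set} (p : Dec P) → 0ℤ ≤ ind p
  0≤ind (yes _) = 0≤+
  0≤ind (no _)  = 0≤+

  ind≤1 : ∀ {P : Set} (p : Dec P) → ind p ≤ 1ℤ
  ind≤1 (yes _) = ≤-refl
  ind≤1 (no _)  = 0≤+

  ind≢0 : ∀ {P : Set} (p : Dec P) → ¬ (ind p ≡ 0ℤ) → P
  ind≢0 (yes x) h = x
  ind≢0 (no _)  h = ⊥-elim (h refl)

  ∑-ind≤1 : ∀ n {P : ℕ → Set} (P? : ∀ i → Dec (P i)) →
    (∀ i j → i ℕ.< n → j ℕ.< n → P i → P j → i ≡ j) → ∑ n (λ i → ind (P? i)) ≤ 1ℤ
  ∑-ind≤1 zero P? h = 0≤+
  ∑-ind≤1 (suc n) P? h with P? n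
  ... | yes x = ≤-reflexive (trans (cong (_+ 1ℤ) (∑-zero< n (λ i i<n → ind-no (P? i) (λ y → ℕₚ.<⇒≢ i<n (h i n (ℕₚ.m<n⇒m<1+n i<n) ℕₚ.≤-refl y x))))) (+-identityˡ 1ℤ))
  ... | no _  = subst (_≤ 1ℤ) (sym (+-identityʳ _)) (∑-ind≤1 n P? (λ i j i<n j<n → h i j (ℕₚ.m<n⇒m<1+n i<n) (ℕₚ.m<n⇒m<1+n j<n)))

  [_∣_] : ℕ → ℤ → ℤ
  [ q ∣ u ] = ind (+ q ∣? u)

  [∣]-+ : ∀ q u v → + q ∣ v → [ q ∣ u + v ] ≡ [ q ∣ u ]
  [∣]-+ q u v q∣v = ind-cong (+ q ∣? u + v) (+ q ∣? u) (λ h → ∣m+n∣n⇒∣m h q∣v) (λ h → ∣m∣n⇒∣m+n h q∣v)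

  [∣]-neg : ∀ q u → [ q ∣ - u ] ≡ [ q ∣ u ]
  [∣]-neg q u = ind-cong (+ q ∣? - u) (+ q ∣? u) (λ h → subst (+ q ∣_) (ℤₚ.neg-involutive u) (∣m⇒∣-m h)) ∣m⇒∣-m

  coprime-∣* : ∀ {a b n} → Coprime a b → a ℕᵈ.∣ n → b ℕᵈ.∣ n → a ℕ.* b ℕᵈ.∣ n
  coprime-∣* {a} {b} c (ℕᵈ.divides k refl) b∣n = subst (ℕᵈ._∣ k ℕ.* a) (ℕₚ.*-comm b a)
    (ℕᵈ.*-monoˡ-∣ a (coprime-divisor (λ (d∣b , d∣a) → c (d∣a , d∣b)) (subst (b ℕᵈ.∣_) (ℕₚ.*-comm k a) b∣n)))

  coprime-* : ∀ {a b c} → Coprime a b → Coprime a c → Coprime a (b ℕ.* c)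
  coprime-* {b = b} ab ac {d} (d∣a , d∣bc) =
    ac (d∣a , coprime-divisor {n = b} (λ (e∣d , e∣b) → ab (ℕᵈ.∣-trans e∣d d∣a , e∣b)) d∣bc)

  coprime-sym : ∀ {a b} → Coprime a b → Coprime b a
  coprime-sym c (x , y) = c (y , x)

  prime∤⇒coprime : ∀ {p a} → Prime p → ¬ (p ℕᵈ.∣ a) → Coprime a p
  prime∤⇒coprime pr p∤a (d∣a , d∣p) with prime⇒irreducible pr d∣p
  ... | inj₁ d≡1  = d≡1
  ... | inj₂ refl = ⊥-elim (p∤a d∣a)

  [∣]-crt : ∀ {a b} → Coprime a b → ∀ u → [ a ∣ u ] * [ b ∣ u ] ≡ [ a ℕ.* b ∣ u ]
  [∣]-crt {a} {b} c u = ind-* (+ a ∣? u) (+ b ∣? u) (+ (a ℕ.* b) ∣? u)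
    (λ x y → ∣ᵤ⇒∣ (coprime-∣* c (∣⇒∣ᵤ x) (∣⇒∣ᵤ y)))
    (λ z → ∣-trans (∣ᵤ⇒∣ (ℕᵈ.m∣m*n b)) z) (λ z → ∣-trans (∣ᵤ⇒∣ (ℕᵈ.n∣m*n a)) z)

  residue-unique : ∀ {q i j} → i ℕ.< q → j ℕ.< q → + q ∣ + i - + j → i ≡ j
  residue-unique {q} {i} {j} i<q j<q h with ∣ + i - + j ∣ in eq
  ... | zero  = +-injective (i-j≡0⇒i≡j (+ i) (+ j) (∣i∣≡0⇒i≡0 eq))
  ... | suc k = ⊥-elim (ℕₚ.<⇒≱ bound (ℕᵈ.∣⇒≤ (subst (q ℕᵈ.∣_) eq (∣⇒∣ᵤ h))))
    where
    bound : suc k ℕ.< q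
    bound = subst (ℕ._< q) eq (ℕₚ.≤-<-trans (subst (λ z → ∣ z ∣ ℕ.≤ i ℕ.⊔ j) (sym (m-n≡m⊖n i j)) (∣m⊝n∣≤m⊔n i j)) (ℕₚ.⊔-lub i<q j<q))

  ∑-residues : ∀ q .{{_ : ℕ.NonZero q}} v → ∑ q (λ i → [ q ∣ v - + i ]) ≡ 1ℤ
  ∑-residues q v = trans (∑-only q (λ i → [ q ∣ v - + i ]) r<q others) (ind-yes (+ q ∣? v - + r) hit)
    where
    r = v %ℕ q
    r<q = n%ℕd<d v q
    eq : ∀ a b → a + b - a ≡ b
    eq = solve-∀
    hit : + q ∣ v - + r
    hit = divides (v /ℕ q) (trans (cong (_- + r) (a≡a%ℕn+[a/ℕn]*n v q)) (eq (+ r) (v /ℕ q * + q)))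
    diff : ∀ a b c → (a - b) - (a - c) ≡ c - b
    diff = solve-∀
    others : ∀ i → i ℕ.< q → ¬ (i ≡ r) → [ q ∣ v - + i ] ≡ 0ℤ
    others i i<q i≢r = ind-no (+ q ∣? v - + i) λ h →
      i≢r (sym (residue-unique r<q i<q (subst (+ q ∣_) (diff v (+ i) (+ r)) (∣m∣n⇒∣m-n h hit))))

  ∑-window : ∀ q .{{_ : ℕ.NonZero q}} N f → (∀ i → 0ℤ ≤ f i) → (∀ s → ∑ q (λ i → f (s ℕ.+ i)) ≤ 1ℤ) →
    ∑ N f * + q ≤ + N + + q
  ∑-window q N f 0≤f h =
    ≤-trans (*-monoʳ {+ q} 0≤+ (≤-trans (∑-grow f 0≤f N≤) (subst (_≤ + suc (N ℕᵐ./ q) * 1ℤ) (sym (∑-blocks (suc (N ℕᵐ./ q)) q f))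
              (∑-≤-const (suc (N ℕᵐ./ q)) 1ℤ (λ j → h (j ℕ.* q))))))
      (subst (_≤ + N + + q) (trans (pos-* (suc (N ℕᵐ./ q)) q) (cong (_* + q) (sym (*-identityʳ (+ suc (N ℕᵐ./ q))))))
        (subst (+ (q ℕ.+ N ℕᵐ./ q ℕ.* q) ≤_) (pos-+ N q) (+≤+ (subst (q ℕ.+ N ℕᵐ./ q ℕ.* q ℕ.≤_) (ℕₚ.+-comm q N) (ℕₚ.+-monoʳ-≤ q (ℕᵐ.m/n*n≤m N q))))))
    where
    N≤ : N ℕ.≤ suc (N ℕᵐ./ q) ℕ.* q
    N≤ = subst (ℕ._≤ q ℕ.+ N ℕᵐ./ q ℕ.* q) (sym (ℕᵐ.m≡m%n+[m/n]*n N q)) (ℕₚ.+-monoˡ-≤ _ (ℕₚ.<⇒≤ (ℕᵐ.m%n<n N q)))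

  -- If m v ≡ 1 and q ∣ m w, then w ≡ v (m w) ≡ 0: no coprimality of m is needed.
  inverse-unique : ∀ q m n {i j} → i ℕ.< q → j ℕ.< q →
    + q ∣ m * (n + + i) - 1ℤ → + q ∣ m * (n + + j) - 1ℤ → i ≡ j
  inverse-unique q m n {i} {j} i<q j<q hᵢ hⱼ = residue-unique i<q j<q
    (subst (+ q ∣_) (eq m n (+ i) (+ j)) (∣m∣n⇒∣m-n (∣n⇒∣m*n (n + + i) (∣m∣n⇒∣m-n hᵢ hⱼ)) (∣m⇒∣m*n (+ i - + j) hᵢ)))
    where
    eq : ∀ m n i j → (n + i) * (m * (n + i) - 1ℤ - (m * (n + j) - 1ℤ)) - (m * (n + i) - 1ℤ) * (i - j) ≡ i - j
    eq = solve-∀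

  E : ℕ → ℤ → ℤ
  E q u = [ q ∣ u - 1ℤ ]

  0≤E : ∀ q u → 0ℤ ≤ E q u
  0≤E q u = 0≤ind (+ q ∣? u - 1ℤ)

  E≤1 : ∀ q u → E q u ≤ 1ℤ
  E≤1 q u = ind≤1 (+ q ∣? u - 1ℤ)

  ∑-E : ∀ q .{{_ : ℕ.NonZero q}} N m n → ∑ N (λ i → E q (m * (n + + i))) * + q ≤ + N + + q
  ∑-E q N m n = ∑-window q N _ (λ i → 0≤E q (m * (n + + i)))
    (λ s → ∑-ind≤1 q (λ i → + q ∣? m * (n + + (s ℕ.+ i)) - 1ℤ)
      (λ i j i<q j<q hᵢ hⱼ → inverse-unique q m (n + + s) i<q j<q (subst (+ q ∣_) (eq s i) hᵢ) (subst (+ q ∣_) (eq s j) hⱼ)))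
    where
    re : ∀ m n a b → m * (n + (a + b)) - 1ℤ ≡ m * (n + a + b) - 1ℤ
    re = solve-∀
    eq : ∀ s i → m * (n + + (s ℕ.+ i)) - 1ℤ ≡ m * (n + + s + + i) - 1ℤ
    eq s i = trans (cong (λ z → m * (n + z) - 1ℤ) (pos-+ s i)) (re m n (+ s) (+ i))

  -- Expanding f in indicators of residues reduces the claim to counting, for each residue i, the j
  -- with b + aj ≡ i. Coprimality makes each count at most one, and the counts total q.
  ∑-affine : ∀ q .{{_ : ℕ.NonZero q}} (f : ℤ → ℤ) → (∀ u v → + q ∣ u - v → f u ≡ f v) →
    ∀ a b → Coprime ∣ a ∣ q → ∑ q (λ j → f (b + a * + j)) ≡ ∑ q (λ i → f (+ i))
  ∑-affine q f per a b cop = begin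
    ∑ q (λ j → f (b + a * + j)) ≡⟨ ∑-cong q (λ j → expand (b + a * + j)) ⟩
    ∑ q (λ j → ∑ q (λ i → [ q ∣ b + a * + j - + i ] * f (+ i))) ≡⟨ ∑-swap q q _ ⟩
    ∑ q (λ i → ∑ q (λ j → [ q ∣ b + a * + j - + i ] * f (+ i))) ≡⟨ ∑-cong q (λ i → ∑-*ʳ q (f (+ i)) _) ⟩
    ∑ q (λ i → hits i * f (+ i)) ≡⟨ ∑-cong< q (λ i i<q → trans (cong (_* f (+ i)) (hits≡1 i i<q)) (*-identityˡ _)) ⟩
    ∑ q (λ i → f (+ i)) ∎
    where
    open ≡-Reasoning
    hits : ℕ → ℤ
    hits i = ∑ q (λ j → [ q ∣ b + a * + j - + i ])
    expand : ∀ v → f v ≡ ∑ q (λ i → [ q ∣ v - + i ] * f (+ i))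
    expand v = begin
      f v ≡⟨ sym (*-identityˡ (f v)) ⟩
      1ℤ * f v ≡⟨ cong (_* f v) (sym (∑-residues q v)) ⟩
      ∑ q (λ i → [ q ∣ v - + i ]) * f v ≡⟨ sym (∑-*ʳ q (f v) _) ⟩
      ∑ q (λ i → [ q ∣ v - + i ] * f v) ≡⟨ ∑-cong q (λ i → step i) ⟩
      ∑ q (λ i → [ q ∣ v - + i ] * f (+ i)) ∎
      where
      step : ∀ i → [ q ∣ v - + i ] * f v ≡ [ q ∣ v - + i ] * f (+ i)
      step i with + q ∣? v - + i
      ... | yes h = cong (1ℤ *_) (per v (+ i) h)
      ... | no  _ = trans (*-zeroˡ (f v)) (sym (*-zeroˡ (f (+ i))))
    diff : ∀ a b i j k → (b + a * j - i) - (b + a * k - i) ≡ a * (j - k)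
    diff = solve-∀
    hits≤1 : ∀ i → hits i ≤ 1ℤ
    hits≤1 i = ∑-ind≤1 q (λ j → + q ∣? b + a * + j - + i) λ j k j<q k<q hⱼ hₖ →
      residue-unique j<q k<q (∣ᵤ⇒∣ (coprime-divisor (coprime-sym cop)
        (subst (q ℕᵈ.∣_) (abs-* a (+ j - + k)) (∣⇒∣ᵤ (subst (+ q ∣_) (diff a b (+ i) (+ j) (+ k)) (∣m∣n⇒∣m-n hⱼ hₖ))))))
    total : ∑ q hits ≡ ∑ q (λ _ → 1ℤ)
    total = trans (sym (∑-swap q q (λ j i → [ q ∣ b + a * + j - + i ]))) (∑-cong q (λ j → ∑-residues q (b + a * + j)))
    -- the deficits 1 - hits i are nonnegative and sum to zero
    hits≡1 : ∀ i → i ℕ.< q → hits i ≡ 1ℤ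
    hits≡1 i i<q = ≤-antisym (hits≤1 i) (ℤₚ.i-j≤0⇒i≤j
      (subst (1ℤ - hits i ≤_) (trans (∑-- q (λ _ → 1ℤ) hits) (ℤₚ.i≡j⇒i-j≡0 (sym total)))
        (∑-term q (λ k → 1ℤ - hits k) (λ k → ℤₚ.i≤j⇒0≤j-i (hits≤1 k)) i<q)))

  O : ℕ → ℤ → ℤ
  O ℓ u = 1ℤ - [ ℓ ∣ u ]

  -- Euler's φ(ℓ²) for prime ℓ, the number of residues modulo ℓ² prime to ℓ. It gives the spike at 1
  -- the same mass over a period as `O ℓ`.
  weight : ℕ → ℕ
  weight ℓ = ℓ ℕ.* (ℓ ℕ.∸ 1)

  e : ℕ → ℤ → ℤ
  e ℓ u = + weight ℓ * E (ℓ ℕ.* ℓ) u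

  d : ℕ → ℤ → ℤ
  d ℓ u = e ℓ u - O ℓ u

  0≤O : ∀ ℓ u → 0ℤ ≤ O ℓ u
  0≤O ℓ u = ℤₚ.i≤j⇒0≤j-i (ind≤1 (+ ℓ ∣? u))

  O≤1 : ∀ ℓ u → O ℓ u ≤ 1ℤ
  O≤1 ℓ u = ≤-by [ ℓ ∣ u ] (0≤ind (+ ℓ ∣? u)) (lem [ ℓ ∣ u ])
    where
    lem : ∀ a → 1ℤ ≡ 1ℤ - a + a
    lem = solve-∀

  [∣]-cong : ∀ q u v → + q ∣ u - v → [ q ∣ u ] ≡ [ q ∣ v ]
  [∣]-cong q u v h = trans (cong [ q ∣_] (lem u v)) ([∣]-+ q v (u - v) h)
    where
    lem : ∀ u v → u ≡ v + (u - v)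
    lem = solve-∀

  E-cong : ∀ q u v → + q ∣ u - v → E q u ≡ E q v
  E-cong q u v h = [∣]-cong q (u - 1ℤ) (v - 1ℤ) (subst (+ q ∣_) (lem u v) h)
    where
    lem : ∀ u v → u - v ≡ u - 1ℤ - (v - 1ℤ)
    lem = solve-∀

  O-cong : ∀ ℓ u v → + ℓ ∣ u - v → O ℓ u ≡ O ℓ v
  O-cong ℓ u v h = cong (_-_ 1ℤ) ([∣]-cong ℓ u v h)

  d-cong : ∀ ℓ u v → + (ℓ ℕ.* ℓ) ∣ u - v → d ℓ u ≡ d ℓ v
  d-cong ℓ u v h = cong₂ _-_ (cong (+ weight ℓ *_) (E-cong (ℓ ℕ.* ℓ) u v h)) (O-cong ℓ u v (∣-trans (∣ᵤ⇒∣ (ℕᵈ.m∣m*n ℓ)) h))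

  -- In a bilinear form the factor `O ℓ` at mn thereby splits into a factor in m and one in n, and
  -- disappears into the coefficients.
  O-* : ∀ {ℓ} → Prime ℓ → ∀ u v → O ℓ (u * v) ≡ O ℓ u * O ℓ v
  O-* {ℓ} pr u v with + ℓ ∣? u | + ℓ ∣? v
  ... | yes x | w = trans (cong (_-_ 1ℤ) (ind-yes (+ ℓ ∣? u * v) (∣m⇒∣m*n v x))) (sym (*-zeroˡ (1ℤ - ind w)))
  ... | no ¬x | yes y = cong (_-_ 1ℤ) (ind-yes (+ ℓ ∣? u * v) (∣n⇒∣m*n u y))
  ... | no ¬x | no ¬y = cong (_-_ 1ℤ) (ind-no (+ ℓ ∣? u * v) λ z →
          Data.Sum.[ (λ h → ¬x (∣ᵤ⇒∣ h)) , (λ h → ¬y (∣ᵤ⇒∣ h)) ] (euclidsLemma ∣ u ∣ ∣ v ∣ pr (subst (ℓ ℕᵈ.∣_) (abs-* u v) (∣⇒∣ᵤ z))))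

  E-∣ : ∀ {ℓ} → Prime ℓ → ∀ q u → ℓ ℕᵈ.∣ q → + ℓ ∣ u → E q u ≡ 0ℤ
  E-∣ {ℓ} pr q u ℓ∣q ℓ∣u = ind-no (+ q ∣? u - 1ℤ) λ h →
    1≢p (ℕᵈ.∣1⇒≡1 (∣⇒∣ᵤ (subst (+ ℓ ∣_) (lem u) (∣m∣n⇒∣m-n ℓ∣u (∣-trans (∣ᵤ⇒∣ ℓ∣q) h)))))
    where
    lem : ∀ u → u - (u - 1ℤ) ≡ 1ℤ
    lem = solve-∀
    1≢p : ¬ (ℓ ≡ 1)
    1≢p refl = Data.Nat.Primality.¬prime[1] pr

  ∑-O : ∀ ℓ .{{_ : ℕ.NonZero ℓ}} → ∑ (ℓ ℕ.* ℓ) (λ i → O ℓ (+ i)) ≡ + weight ℓ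
  ∑-O ℓ@(suc k) = begin
    ∑ (ℓ ℕ.* ℓ) (λ i → O ℓ (+ i)) ≡⟨ ∑-- (ℓ ℕ.* ℓ) (λ _ → 1ℤ) (λ i → [ ℓ ∣ + i ]) ⟩
    ∑ (ℓ ℕ.* ℓ) (λ _ → 1ℤ) - ∑ (ℓ ℕ.* ℓ) (λ i → [ ℓ ∣ + i ]) ≡⟨ cong₂ _-_ (∑-const (ℓ ℕ.* ℓ) 1ℤ) (∑-blocks ℓ ℓ (λ i → [ ℓ ∣ + i ])) ⟩
    + (ℓ ℕ.* ℓ) * 1ℤ - ∑ ℓ (λ j → ∑ ℓ (λ i → [ ℓ ∣ + (j ℕ.* ℓ ℕ.+ i) ])) ≡⟨ cong₂ _-_ (trans (*-identityʳ _) (pos-* ℓ ℓ)) (trans (∑-cong ℓ one) (∑-const ℓ 1ℤ)) ⟩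
    + ℓ * + ℓ - + ℓ * 1ℤ ≡⟨ lem (+ k) ⟩
    + ℓ * + k ≡⟨ sym (pos-* ℓ k) ⟩
    + weight ℓ ∎
    where
    open ≡-Reasoning
    lem : ∀ k → (1ℤ + k) * (1ℤ + k) - (1ℤ + k) * 1ℤ ≡ (1ℤ + k) * k
    lem = solve-∀
    neg : ∀ a b → a + b ≡ - (0ℤ - b) + a
    neg = solve-∀
    one : ∀ j → ∑ ℓ (λ i → [ ℓ ∣ + (j ℕ.* ℓ ℕ.+ i) ]) ≡ 1ℤ
    one j = trans (∑-cong ℓ (λ i → trans (cong [ ℓ ∣_] (trans (pos-+ (j ℕ.* ℓ) i) (neg (+ (j ℕ.* ℓ)) (+ i))))
      (trans ([∣]-+ ℓ (- (0ℤ - + i)) (+ (j ℕ.* ℓ)) (∣ᵤ⇒∣ (ℕᵈ.n∣m*n j))) ([∣]-neg ℓ (0ℤ - + i))))) (∑-residues ℓ 0ℤ)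

  ∑-Eone : ∀ q .{{_ : ℕ.NonZero q}} → ∑ q (λ i → E q (+ i)) ≡ 1ℤ
  ∑-Eone q = trans (∑-cong q (λ i → trans (cong [ q ∣_] (lem (+ i))) ([∣]-neg q (1ℤ - + i)))) (∑-residues q 1ℤ)
    where
    lem : ∀ a → a - 1ℤ ≡ - (1ℤ - a)
    lem = solve-∀

  ∑-d : ∀ ℓ .{{_ : ℕ.NonZero ℓ}} → ∑ (ℓ ℕ.* ℓ) (λ i → d ℓ (+ i)) ≡ 0ℤ
  ∑-d ℓ@(suc _) = trans (∑-- (ℓ ℕ.* ℓ) (λ i → e ℓ (+ i)) (λ i → O ℓ (+ i)))
    (trans (cong₂ _-_ (trans (∑-*ˡ (ℓ ℕ.* ℓ) (+ weight ℓ) _) (trans (cong (+ weight ℓ *_) (∑-Eone (ℓ ℕ.* ℓ))) (*-identityʳ (+ weight ℓ)))) (∑-O ℓ))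
      (ℤₚ.+-inverseʳ (+ weight ℓ)))

  d-∣ : ∀ {ℓ} → Prime ℓ → ∀ u → + ℓ ∣ u → d ℓ u ≡ 0ℤ
  d-∣ {ℓ} pr u h = cong₂ _-_ (trans (cong (+ weight ℓ *_) (E-∣ pr (ℓ ℕ.* ℓ) u (ℕᵈ.m∣m*n ℓ) h)) (*-zeroʳ (+ weight ℓ))) (cong (_-_ 1ℤ) (ind-yes (+ ℓ ∣? u) h))

  -- If ℓ divides m, every value is a multiple of ℓ, where both parts of `d ℓ` are zero. Otherwise
  -- ms is invertible modulo ℓ² and the argument runs through all residues, over which `d ℓ` sums to
  -- zero.
  ∑-d-fibre : ∀ {ℓ} → Prime ℓ → ∀ m n s → Coprime s ℓ → ∑ (ℓ ℕ.* ℓ) (λ j → d ℓ (m * (n + + s * + j))) ≡ 0ℤ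
  ∑-d-fibre {ℓ} pr m n s cop with ℓ ℕᵈ.∣? ∣ m ∣
  ... | yes ℓ∣m = ∑-zero< (ℓ ℕ.* ℓ) (λ j _ → d-∣ pr (m * (n + + s * + j)) (∣m⇒∣m*n {m = m} (n + + s * + j) (∣ᵤ⇒∣ ℓ∣m)))
  ... | no  ℓ∤m = trans (∑-cong (ℓ ℕ.* ℓ) (λ j → cong (d ℓ) (lem m n (+ s) (+ j))))
      (trans (∑-affine (ℓ ℕ.* ℓ) (d ℓ) (d-cong ℓ) (m * + s) (m * n) (coprime-* cop₁ cop₁)) (∑-d ℓ))
    where
    instance
      nz = prime⇒nonZero pr
      nz² = ℕₚ.m*n≢0 ℓ ℓ
    lem : ∀ m n s j → m * (n + s * j) ≡ m * n + m * s * j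
    lem = solve-∀
    cop₁ : Coprime ∣ m * + s ∣ ℓ
    cop₁ = subst (λ z → Coprime z ℓ) (sym (abs-* m (+ s))) (coprime-sym (coprime-* (coprime-sym (prime∤⇒coprime pr ℓ∤m)) (coprime-sym cop)))

-- Iterated averages and functions whose sums over a period vanish

module Averaging where

  open import Data.Integer using (ℤ; +_; -_; _+_; _-_; _*_; _≤_; 0ℤ; 1ℤ)
  open import Data.Integer.Properties using (≤-trans; ≤-reflexive; +-identityʳ; +-identityˡ; *-zeroʳ; *-identityˡ; *-assoc; +-comm; +-assoc; pos-+; pos-*)
  open import Data.Integer.Tactic.RingSolver using (solve-∀)
  open Sums

  avg : ℕ → (ℤ → ℤ) → ℤ → ℤ
  avg Y f n = ∑ Y (λ u → f (n + + u))

  avg^ : ℕ → ℕ → (ℤ → ℤ) → ℤ → ℤ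
  avg^ zero Y f = f
  avg^ (suc k) Y f = avg Y (avg^ k Y f)

  avg^-cong : ∀ k Y {f g} → (∀ n → f n ≡ g n) → ∀ n → avg^ k Y f n ≡ avg^ k Y g n
  avg^-cong zero Y h n = h n
  avg^-cong (suc k) Y h n = ∑-cong Y (λ u → avg^-cong k Y h (n + + u))

  avg^-∑ : ∀ k Y R (f : ℕ → ℤ → ℤ) n → avg^ k Y (λ n → ∑ R (λ ℓ → f ℓ n)) n ≡ ∑ R (λ ℓ → avg^ k Y (f ℓ) n)
  avg^-∑ zero Y R f n = refl
  avg^-∑ (suc k) Y R f n = trans (∑-cong Y (λ u → avg^-∑ k Y R f (n + + u))) (∑-swap Y R _)

  avg^-* : ∀ k Y c f n → avg^ k Y (λ n → c * f n) n ≡ c * avg^ k Y f n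
  avg^-* zero Y c f n = refl
  avg^-* (suc k) Y c f n = trans (∑-cong Y (λ u → avg^-* k Y c f (n + + u))) (∑-*ˡ Y c _)

  avg^-nonNeg : ∀ k Y {f} → (∀ n → 0ℤ ≤ f n) → ∀ n → 0ℤ ≤ avg^ k Y f n
  avg^-nonNeg zero Y h n = h n
  avg^-nonNeg (suc k) Y h n = ∑-nonNeg Y (λ u → avg^-nonNeg k Y h (n + + u))

  avg^-upper : ∀ k Y {f} c → (∀ n → f n ≤ c) → ∀ n → avg^ k Y f n ≤ + (Y ℕ.^ k) * c
  avg^-upper zero Y {f} c h n = subst (f n ≤_) (sym (*-identityˡ c)) (h n)
  avg^-upper (suc k) Y {f} c h n = subst (avg Y (avg^ k Y f) n ≤_)
    (trans (sym (*-assoc (+ Y) (+ (Y ℕ.^ k)) c)) (cong (_* c) (sym (pos-* Y (Y ℕ.^ k)))))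
    (∑-≤-const Y _ (λ u → avg^-upper k Y c h (n + + u)))

  avg-lower : ∀ Y v L F → (∀ n → 0ℤ ≤ F n) → v ℕ.+ L ℕ.≤ Y → ∑ L (λ n → F (+ n)) ≤ avg Y F (- + v)
  avg-lower Y v L F 0≤F v+L≤Y = ≤-trans
    (≤-by (∑ v (λ u → F (- + v + + u))) (∑-nonNeg v (λ u → 0≤F _))
      (trans (∑-split v L _) (trans (+-comm (∑ v (λ u → F (- + v + + u))) _)
        (cong (_+ ∑ v (λ u → F (- + v + + u))) (∑-cong L (λ i → cong F (trans (cong (_+_ (- + v)) (pos-+ v i)) (lem (+ v) (+ i)))))))))
    (∑-grow (λ u → F (- + v + + u)) (λ u → 0≤F _) v+L≤Y)
    where
    lem : ∀ v i → - v + (v + i) ≡ i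
    lem = solve-∀

  -- Restrict each of the k outer shifts to values below V. As kV ≤ v, the base point is then still
  -- some -v′ with 0 ≤ v′ ≤ v, and the innermost average, of length Y ≥ v + L, covers 0, ..., L - 1.
  -- Each of the V^k choices sees the full sum, and the discarded terms are nonnegative.
  avg^-lower : ∀ k Y V L F → (∀ n → 0ℤ ≤ F n) → V ℕ.≤ Y → ∀ v → k ℕ.* V ℕ.≤ v → v ℕ.+ L ℕ.≤ Y →
    + (V ℕ.^ k) * ∑ L (λ n → F (+ n)) ≤ avg^ k Y (avg Y F) (- + v)
  avg^-lower zero Y V L F 0≤F V≤Y v kV≤v v+L≤Y = subst (_≤ avg Y F (- + v)) (sym (*-identityˡ _)) (avg-lower Y v L F 0≤F v+L≤Y)
  avg^-lower (suc k) Y V L F 0≤F V≤Y v kV≤v v+L≤Y =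
    ≤-trans (subst (_≤ ∑ V (λ u → G (- + v + + u))) (trans (∑-const V _) (trans (sym (*-assoc (+ V) (+ (V ℕ.^ k)) S)) (cong (_* S) (sym (pos-* V (V ℕ.^ k))))))
              (∑-mono< V step))
      (∑-grow (λ u → G (- + v + + u)) (λ u → avg^-nonNeg k Y (λ n → ∑-nonNeg Y (λ w → 0≤F _)) _) V≤Y)
    where
    G = avg^ k Y (avg Y F)
    S = ∑ L (λ n → F (+ n))
    lem : ∀ a u → - a ≡ - (u + a) + u
    lem = solve-∀
    step : ∀ u → u ℕ.< V → + (V ℕ.^ k) * S ≤ G (- + v + + u)
    step u u<V = subst (λ z → + (V ℕ.^ k) * S ≤ G z)
      (trans (lem (+ (v ℕ.∸ u)) (+ u)) (cong (λ z → - z + + u) (trans (sym (pos-+ u (v ℕ.∸ u))) (cong +_ (ℕₚ.m+[n∸m]≡n u≤v)))))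
      (avg^-lower k Y V L F 0≤F V≤Y (v ℕ.∸ u)
        (ℕₚ.≤-trans (ℕₚ.≤-reflexive (sym (ℕₚ.m+n∸m≡n V (k ℕ.* V)))) (ℕₚ.∸-mono kV≤v (ℕₚ.<⇒≤ u<V)))
        (ℕₚ.≤-trans (ℕₚ.+-monoˡ-≤ L (ℕₚ.m∸n≤m v u)) v+L≤Y))
      where
      u≤v : u ℕ.≤ v
      u≤v = ℕₚ.≤-trans (ℕₚ.<⇒≤ u<V) (ℕₚ.≤-trans (ℕₚ.m≤m+n V (k ℕ.* V)) kV≤v)

  VanishesOver : ℕ → (ℤ → ℤ) → Set
  VanishesOver M f = ∀ n → ∑ M (λ u → f (n + + u)) ≡ 0ℤ

  -- Cut a period of length ab into residue classes modulo a: on each class f is constant, while h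
  -- runs along a progression of b terms with step a, where its sum is zero.
  vanishes-* : ∀ a b f h → (∀ n → f (n + + a) ≡ f n) → (∀ n → ∑ b (λ j → h (n + + a * + j)) ≡ 0ℤ) →
    VanishesOver (b ℕ.* a) (λ n → f n * h n)
  vanishes-* a b f h per van n = begin
    ∑ (b ℕ.* a) (λ u → f (n + + u) * h (n + + u)) ≡⟨ ∑-blocks b a _ ⟩
    ∑ b (λ j → ∑ a (λ i → f (n + + (j ℕ.* a ℕ.+ i)) * h (n + + (j ℕ.* a ℕ.+ i)))) ≡⟨ ∑-cong b (λ j → ∑-cong a (λ i → term j i)) ⟩
    ∑ b (λ j → ∑ a (λ i → f (n + + i) * h (n + + i + + a * + j))) ≡⟨ ∑-swap b a _ ⟩
    ∑ a (λ i → ∑ b (λ j → f (n + + i) * h (n + + i + + a * + j))) ≡⟨ ∑-zero< a (λ i _ → trans (∑-*ˡ b (f (n + + i)) _) (trans (cong (f (n + + i) *_) (van (n + + i))) (*-zeroʳ (f (n + + i))))) ⟩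
    0ℤ ∎
    where
    open ≡-Reasoning
    shift : ∀ a i j n → n + (j * a + i) ≡ n + i + a * j
    shift = solve-∀
    next : ∀ a v j → v + a * (1ℤ + j) ≡ v + a * j + a
    next = solve-∀
    pos : ∀ j i → n + + (j ℕ.* a ℕ.+ i) ≡ n + + i + + a * + j
    pos j i = trans (cong (_+_ n) (trans (pos-+ (j ℕ.* a) i) (cong (_+ + i) (pos-* j a)))) (shift (+ a) (+ i) (+ j) n)
    perʲ : ∀ j v → f (v + + a * + j) ≡ f v
    perʲ zero v = cong f (trans (cong (_+_ v) (*-zeroʳ (+ a))) (+-identityʳ v))
    perʲ (suc j) v = trans (cong f (next (+ a) v (+ j))) (trans (per (v + + a * + j)) (perʲ j v))
    term : ∀ j i → f (n + + (j ℕ.* a ℕ.+ i)) * h (n + + (j ℕ.* a ℕ.+ i)) ≡ f (n + + i) * h (n + + i + + a * + j)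
    term j i = cong₂ _*_ (trans (cong f (pos j i)) (perʲ j (n + + i))) (cong h (pos j i))

  module _ (M : ℕ) .{{_ : ℕ.NonZero M}} where

    vanishes-tail : ∀ f → VanishesOver M f → ∀ Y n → ∑ Y (λ u → f (n + + u)) ≡ ∑ (Y ℕᵐ.% M) (λ u → f (n + + (Y ℕᵐ./ M ℕ.* M) + + u))
    vanishes-tail f van Y n = begin
      ∑ Y g ≡⟨ cong (λ z → ∑ z g) (trans (ℕᵐ.m≡m%n+[m/n]*n Y M) (ℕₚ.+-comm r (q ℕ.* M))) ⟩
      ∑ (q ℕ.* M ℕ.+ r) g ≡⟨ ∑-split (q ℕ.* M) r g ⟩
      ∑ (q ℕ.* M) g + ∑ r (λ u → g (q ℕ.* M ℕ.+ u)) ≡⟨ cong₂ _+_ (trans (∑-blocks q M g) (∑-zero< q (λ j _ → trans (∑-cong M (λ i → cong f (shift j i))) (van (n + + (j ℕ.* M))))))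
                                                         (∑-cong r (λ u → cong f (shift q u))) ⟩
      0ℤ + ∑ r (λ u → f (n + + (q ℕ.* M) + + u)) ≡⟨ +-identityˡ _ ⟩
      ∑ r (λ u → f (n + + (q ℕ.* M) + + u)) ∎
      where
      open ≡-Reasoning
      q = Y ℕᵐ./ M
      r = Y ℕᵐ.% M
      g : ℕ → ℤ
      g u = f (n + + u)
      shift : ∀ j i → n + + (j ℕ.* M ℕ.+ i) ≡ n + + (j ℕ.* M) + + i
      shift j i = trans (cong (_+_ n) (pos-+ (j ℕ.* M) i)) (sym (+-assoc n _ _))

    -- Whole periods drop out, and the incomplete last one is majorised by a full period of g. The
    -- majorant may vary because the functions in question have high, narrow spikes whose mass over
    -- a period is far below height times length.
    vanishes-partial : ∀ f → VanishesOver M f → ∀ (g : ℤ → ℤ) → (∀ n → ∥ f n ∥ ≤ g n) → (∀ n → 0ℤ ≤ g n) →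
      ∀ Y n → ∥ ∑ Y (λ u → f (n + + u)) ∥ ≤ ∑ M (λ u → g (n + + (Y ℕᵐ./ M ℕ.* M) + + u))
    vanishes-partial f van g f≤g 0≤g Y n = subst (λ z → ∥ z ∥ ≤ ∑ M (λ u → g (n + + (Y ℕᵐ./ M ℕ.* M) + + u))) (sym (vanishes-tail f van Y n))
      (≤-trans (∑-∥∥ (Y ℕᵐ.% M) _) (≤-trans (∑-mono (Y ℕᵐ.% M) (λ u → f≤g (n + + (Y ℕᵐ./ M ℕ.* M) + + u))) (∑-grow _ (λ u → 0≤g (n + + (Y ℕᵐ./ M ℕ.* M) + + u)) (ℕₚ.<⇒≤ (ℕᵐ.m%n<n Y M)))))

    vanishes-avg : ∀ Y f → VanishesOver M f → VanishesOver M (avg Y f)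
    vanishes-avg Y f van n = trans (∑-swap M Y _) (∑-zero< Y (λ u _ → trans (∑-cong M (λ v → cong f (lem n (+ v) (+ u)))) (van (n + + u))))
      where
      lem : ∀ n v u → n + v + u ≡ n + u + v
      lem = solve-∀

    -- each averaging of a function with vanishing period sums costs a factor M, not Y
    vanishes-avg^ : ∀ k Y f c → 0ℤ ≤ c → VanishesOver M f → (∀ n → ∥ f n ∥ ≤ c) →
      VanishesOver M (avg^ k Y f) × (∀ n → ∥ avg^ k Y f n ∥ ≤ + (M ℕ.^ k) * c)
    vanishes-avg^ zero Y f c 0≤c van f≤c = van , λ n → subst (∥ f n ∥ ≤_) (sym (*-identityˡ c)) (f≤c n)
    vanishes-avg^ (suc k) Y f c 0≤c van f≤c with vanishes-avg^ k Y f c 0≤c van f≤c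
    ... | van′ , bound = vanishes-avg Y (avg^ k Y f) van′ , λ n →
      subst (∥ avg Y (avg^ k Y f) n ∥ ≤_) (trans (∑-const M _) (trans (sym (*-assoc (+ M) (+ (M ℕ.^ k)) c)) (cong (_* c) (sym (pos-* M (M ℕ.^ k))))))
        (vanishes-partial (avg^ k Y f) van′ (λ _ → + (M ℕ.^ k) * c) bound (λ _ → 0≤* {+ (M ℕ.^ k)} {c} 0≤+ 0≤c) Y n)

-- Norms of bilinear forms, and restricting a form by an inequality between labels

module Bilinear where

  open import Data.Integer using (ℤ; +_; _+_; _*_; _≤_; 0ℤ; 1ℤ)
  open import Data.Integer.Properties using (≤-refl; ≤-trans; ≤-reflexive; +-identityˡ; *-zeroʳ; *-zeroˡ; *-identityˡ; *-identityʳ; *-comm; *-assoc; pos-*)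
  open import Data.Integer.Tactic.RingSolver using (solve-∀)
  open Sums
  open Congruence

  ‖_‖² : (ℕ → ℤ) → ℕ → ℤ
  ‖ α ‖² K = ∑ K (λ m → α m * α m)

  0≤‖‖² : ∀ α K → 0ℤ ≤ ‖ α ‖² K
  0≤‖‖² α K = ∑-nonNeg K (λ m → 0≤i² (α m))

  form : ℕ → ℕ → (ℕ → ℕ → ℤ) → (ℕ → ℤ) → (ℕ → ℤ) → ℤ
  form K L C α β = ∑ K (λ m → ∑ L (λ n → α m * β n * C m n))

  -- B bounds the square of the operator norm of the matrix C with respect to Euclidean norms.
  record NormBound (K L : ℕ) (C : ℕ → ℕ → ℤ) (B : ℤ) : Set where
    constructor mk
    field at : ∀ α β → form K L C α β * form K L C α β ≤ B * (‖ α ‖² K * ‖ β ‖² L)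
  open NormBound

  form-cong : ∀ K L {C C′ : ℕ → ℕ → ℤ} α β → (∀ m n → C m n ≡ C′ m n) → form K L C α β ≡ form K L C′ α β
  form-cong K L α β h = ∑-cong K (λ m → ∑-cong L (λ n → cong (α m * β n *_) (h m n)))

  form-+ : ∀ K L (C C′ : ℕ → ℕ → ℤ) α β → form K L (λ m n → C m n + C′ m n) α β ≡ form K L C α β + form K L C′ α β
  form-+ K L C C′ α β = trans (∑-cong K (λ m → trans (∑-cong L (λ n → lem (α m * β n) (C m n) (C′ m n))) (∑-+ L _ _))) (∑-+ K _ _)
    where
    lem : ∀ a b c → a * (b + c) ≡ a * b + a * c
    lem = solve-∀

  normBound-transpose : ∀ {K L C B} → NormBound K L C B → NormBound L K (λ n m → C m n) B
  at (normBound-transpose {K} {L} {C} {B} h) α β = subst₂ _≤_ (cong₂ _*_ eq eq) (cong (B *_) (*-comm (‖ β ‖² K) (‖ α ‖² L))) (at h β α)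
    where
    eq : form K L C β α ≡ form L K (λ n m → C m n) α β
    eq = trans (∑-swap K L _) (∑-cong L (λ n → ∑-cong K (λ m → cong (_* C m n) (*-comm (β m) (α n)))))

  normBound-cong : ∀ {K L C C′ B} → (∀ m n → C m n ≡ C′ m n) → NormBound K L C B → NormBound K L C′ B
  at (normBound-cong {K} {L} {B = B} eq h) α β = subst (λ z → z * z ≤ B * (‖ α ‖² K * ‖ β ‖² L)) (form-cong K L α β eq) (at h α β)

  scale-idem : ∀ {P : Set} (p : Dec P) a → ind p * a * (ind p * a) ≡ ind p * (a * a)
  scale-idem (yes _) a = lem a
    where
    lem : ∀ a → 1ℤ * a * (1ℤ * a) ≡ 1ℤ * (a * a)
    lem = solve-∀
  scale-idem (no _) a = refl

  fibre-sum : ∀ Z c a → ∑ Z (λ v → ind (c ℕ.≟ v) * a) ≡ ∑ Z (λ v → ind (c ℕ.≟ v)) * a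
  fibre-sum Z c a = ∑-*ʳ Z a (λ v → ind (c ℕ.≟ v))

  ∑-fibres≤ : ∀ Z K (γ : ℕ → ℕ) α → ∑ Z (λ v → ‖ (λ m → ind (γ m ℕ.≟ v) * α m) ‖² K) ≤ ‖ α ‖² K
  ∑-fibres≤ Z K γ α = ≤-trans (≤-reflexive (trans (∑-swap Z K _) (∑-cong K (λ m → trans (∑-cong Z (λ v → scale-idem (γ m ℕ.≟ v) (α m))) (fibre-sum Z (γ m) (α m * α m))))))
    (∑-mono K (λ m → subst (∑ Z (λ v → ind (γ m ℕ.≟ v)) * (α m * α m) ≤_) (*-identityˡ _)
      (*-monoʳ (0≤i² (α m)) (∑-ind≤1 Z (λ v → γ m ℕ.≟ v) (λ i j _ _ x y → trans (sym x) y)))))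

  -- Cutting α and β by label turns the form into a sum of forms in pieces with equal labels. By
  -- Cauchy over the labels, and since the square norms of the pieces add up to at most the original
  -- ones, the bound B survives however many labels there are.
  normBound-diagonal : ∀ {K L C B} Z (γ δ : ℕ → ℕ) → (∀ m → γ m ℕ.< Z) → 0ℤ ≤ B → NormBound K L C B →
    NormBound K L (λ m n → ind (γ m ℕ.≟ δ n) * C m n) B
  at (normBound-diagonal {K} {L} {C} {B} Z γ δ γ<Z 0≤B h) α β = ≤-trans (≤-reflexive (cong₂ _*_ eq eq))
    (≤-trans (cauchy Z {B} (λ v → form K L C (αᵛ v) (βᵛ v)) (λ v → ‖ αᵛ v ‖² K) (λ v → ‖ βᵛ v ‖² L) 0≤B (λ v → 0≤‖‖² (αᵛ v) K) (λ v → 0≤‖‖² (βᵛ v) L) (λ v → at h (αᵛ v) (βᵛ v)))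
      (*-monoˡ 0≤B (*-mono (∑-nonNeg Z (λ v → 0≤‖‖² (αᵛ v) K)) (0≤‖‖² β L) (∑-fibres≤ Z K γ α) (∑-fibres≤ Z L δ β))))
    where
    αᵛ βᵛ : ℕ → ℕ → ℤ
    αᵛ v m = ind (γ m ℕ.≟ v) * α m
    βᵛ v n = ind (δ n ℕ.≟ v) * β n
    lem : ∀ a b c d e → (a * b) * (c * d) * e ≡ (a * c) * (b * d * e)
    lem = solve-∀
    lem′ : ∀ a b c → a * (b * c) ≡ b * (a * c)
    lem′ = solve-∀
    agree : ∀ m n → ∑ Z (λ v → ind (γ m ℕ.≟ v) * ind (δ n ℕ.≟ v)) ≡ ind (γ m ℕ.≟ δ n)
    agree m n = trans (∑-only Z _ (γ<Z m) (λ v _ v≢ → trans (cong (_* ind (δ n ℕ.≟ v)) (ind-no (γ m ℕ.≟ v) (λ x → v≢ (sym x)))) (*-zeroˡ (ind (δ n ℕ.≟ v)))))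
      (trans (cong (_* ind (δ n ℕ.≟ γ m)) (ind-yes (γ m ℕ.≟ γ m) refl)) (trans (*-identityˡ _) (ind-cong (δ n ℕ.≟ γ m) (γ m ℕ.≟ δ n) sym sym)))
    eq : form K L (λ m n → ind (γ m ℕ.≟ δ n) * C m n) α β ≡ ∑ Z (λ v → form K L C (αᵛ v) (βᵛ v))
    eq = sym (trans (∑-swap Z K _) (∑-cong K (λ m → trans (∑-swap Z L _) (∑-cong L (λ n →
      trans (∑-cong Z (λ v → lem (ind (γ m ℕ.≟ v)) (α m) (ind (δ n ℕ.≟ v)) (β n) (C m n)))
      (trans (∑-*ʳ Z _ _) (trans (cong (_* (α m * β n * C m n)) (agree m n)) (lem′ (ind (γ m ℕ.≟ δ n)) (α m * β n) (C m n)))))))))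

  normBound-scale : ∀ {K L C B} (a b : ℕ → ℤ) → (∀ m → a m * a m ≤ 1ℤ) → (∀ n → b n * b n ≤ 1ℤ) → 0ℤ ≤ B →
    NormBound K L C B → NormBound K L (λ m n → a m * b n * C m n) B
  at (normBound-scale {K} {L} {C} {B} a b a≤1 b≤1 0≤B h) α β = ≤-trans (≤-reflexive (cong₂ _*_ eq eq))
    (≤-trans (at h (λ m → a m * α m) (λ n → b n * β n)) (*-monoˡ 0≤B (*-mono (0≤‖‖² (λ m → a m * α m) K) (0≤‖‖² β L) (smaller K a α a≤1) (smaller L b β b≤1))))
    where
    lem : ∀ a b c d e → c * d * (a * b * e) ≡ (a * c) * (b * d) * e
    lem = solve-∀
    sq : ∀ a b → (a * b) * (a * b) ≡ (a * a) * (b * b)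
    sq = solve-∀
    eq : form K L (λ m n → a m * b n * C m n) α β ≡ form K L C (λ m → a m * α m) (λ n → b n * β n)
    eq = ∑-cong K (λ m → ∑-cong L (λ n → lem (a m) (b n) (α m) (β n) (C m n)))
    smaller : ∀ N (a α : ℕ → ℤ) → (∀ m → a m * a m ≤ 1ℤ) → ‖ (λ m → a m * α m) ‖² N ≤ ‖ α ‖² N
    smaller N a α a≤1 = ∑-mono N (λ m → subst₂ _≤_ (sym (sq (a m) (α m))) (*-identityˡ _) (*-monoʳ (0≤i² (α m)) (a≤1 m)))

  -- Halving both labels: t < f iff ⌊t/2⌋ < ⌊f/2⌋, or ⌊t/2⌋ = ⌊f/2⌋ with t even and f odd.
  -- The second alternative is block diagonal, so each binary digit adds 1 to the square root of the bound.
  half : ℕ → ℕ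
  half t = t ℕᵐ./ 2

  even odd : ℕ → ℤ
  even t = ind (t ℕᵐ.% 2 ℕ.≟ 0)
  odd t  = ind (t ℕᵐ.% 2 ℕ.≟ 1)

  ind-< : ∀ t f → ind (t ℕ.<? f) ≡ ind (half t ℕ.<? half f) + even t * odd f * ind (half t ℕ.≟ half f)
  ind-< t f = cases
    where
    t≡ = ℕᵐ.m≡m%n+[m/n]*n t 2
    f≡ = ℕᵐ.m≡m%n+[m/n]*n f 2
    t%<2 = ℕᵐ.m%n<n t 2
    f%<2 = ℕᵐ.m%n<n f 2
    split< : half t ℕ.< half f → t ℕ.< f
    split< h = subst₂ ℕ._<_ (sym t≡) (sym f≡) (ℕₚ.<-≤-trans (ℕₚ.+-monoˡ-< (half t ℕ.* 2) t%<2) (ℕₚ.≤-trans (ℕₚ.*-monoˡ-≤ 2 h) (ℕₚ.m≤n+m _ (f ℕᵐ.% 2))))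
    split≡ : half t ≡ half f → t ℕ.< f → t ℕᵐ.% 2 ≡ 0 × f ℕᵐ.% 2 ≡ 1
    split≡ h t<f = digits t%<2 f%<2 (ℕₚ.+-cancelʳ-< (half f ℕ.* 2) _ _ (subst₂ ℕ._<_ (trans t≡ (cong (λ z → t ℕᵐ.% 2 ℕ.+ z ℕ.* 2) h)) f≡ t<f))
      where
      digits : ∀ {a b} → a ℕ.< 2 → b ℕ.< 2 → a ℕ.< b → a ≡ 0 × b ≡ 1
      digits {zero}  {suc zero} _ _ _ = refl , refl
      digits {suc zero} {suc zero} _ _ (ℕ.s≤s ())
      digits {suc (suc _)} (ℕ.s≤s (ℕ.s≤s ()))
      digits {_} {suc (suc _)} _ (ℕ.s≤s (ℕ.s≤s ()))
    join≡ : half t ≡ half f → t ℕᵐ.% 2 ≡ 0 → f ℕᵐ.% 2 ≡ 1 → t ℕ.< f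
    join≡ h a b = subst₂ ℕ._<_ (sym (trans t≡ (cong₂ (λ x y → x ℕ.+ y ℕ.* 2) a h))) (sym (trans f≡ (cong (ℕ._+ half f ℕ.* 2) b))) ℕₚ.≤-refl
    cases : ind (t ℕ.<? f) ≡ ind (half t ℕ.<? half f) + even t * odd f * ind (half t ℕ.≟ half f)
    cases with half t ℕ.<? half f | half t ℕ.≟ half f
    ... | yes x | yes y = ⊥-elim (ℕₚ.<⇒≢ x y)
    ... | yes x | no  _ = trans (ind-yes (t ℕ.<? f) (split< x)) (cong (_+_ 1ℤ) (sym (*-zeroʳ (even t * odd f))))
    ... | no ¬x | yes y = sym (trans (+-identityˡ _) (trans (*-identityʳ _) (ind-* (t ℕᵐ.% 2 ℕ.≟ 0) (f ℕᵐ.% 2 ℕ.≟ 1) (t ℕ.<? f) (join≡ y) (λ h → proj₁ (split≡ y h)) (λ h → proj₂ (split≡ y h)))))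
    ... | no ¬x | no ¬y = trans (ind-no (t ℕ.<? f) λ t<f → ¬x (ℕₚ.≤∧≢⇒< (ℕᵐ./-monoˡ-≤ 2 (ℕₚ.<⇒≤ t<f)) ¬y))
                            (cong (_+_ 0ℤ) (sym (*-zeroʳ (even t * odd f))))

  normBound-< : ∀ J {K L C B} (t f : ℕ → ℕ) → (∀ m → t m ℕ.< 2 ℕ.^ J) → (∀ n → f n ℕ.< 2 ℕ.^ J) → 0ℤ ≤ B →
    NormBound K L C B → NormBound K L (λ m n → ind (t m ℕ.<? f n) * C m n) (+ (J ℕ.* J) * B)
  at (normBound-< zero {K} {L} {C} {B} t f t< f< 0≤B h) α β = ≤-reflexive (trans (cong₂ _*_ zero-form zero-form) (sym (trans (cong (_* (‖ α ‖² K * ‖ β ‖² L)) (*-zeroˡ B)) (*-zeroˡ (‖ α ‖² K * ‖ β ‖² L)))))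
    where
    zero-form : form K L (λ m n → ind (t m ℕ.<? f n) * C m n) α β ≡ 0ℤ
    zero-form = ∑-zero< K (λ m _ → ∑-zero< L (λ n _ → trans (cong (λ z → α m * β n * (z * C m n)) (ind-no (t m ℕ.<? f n) λ h → ℕₚ.n≮0 (ℕₚ.<-≤-trans h (ℕₚ.≤-pred (f< n)))))
      (trans (cong (α m * β n *_) (*-zeroˡ (C m n))) (*-zeroʳ (α m * β n)))))
  at (normBound-< (suc J) {K} {L} {C} {B} t f t< f< 0≤B h) α β =
    ≤-trans (≤-reflexive (cong₂ _*_ eq eq)) (combine J (form K L C₁ α β) (form K L C₂ α β) N (0≤* (0≤‖‖² α K) (0≤‖‖² β L)) (at IH α β) (at diag α β))
    where
    N = ‖ α ‖² K * ‖ β ‖² L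
    C₁ C₂ : ℕ → ℕ → ℤ
    C₁ m n = ind (half (t m) ℕ.<? half (f n)) * C m n
    C₂ m n = ind (half (t m) ℕ.≟ half (f n)) * (even (t m) * odd (f n) * C m n)
    lem : ∀ a b c d → (a + b * c) * d ≡ a * d + c * (b * d)
    lem = solve-∀
    eq : form K L (λ m n → ind (t m ℕ.<? f n) * C m n) α β ≡ form K L C₁ α β + form K L C₂ α β
    eq = trans (form-cong K L α β (λ m n → trans (cong (_* C m n) (ind-< (t m) (f n))) (lem (ind (half (t m) ℕ.<? half (f n))) (even (t m) * odd (f n)) (ind (half (t m) ℕ.≟ half (f n))) (C m n)))) (form-+ K L C₁ C₂ α β)
    halve : ∀ {a} → a ℕ.< 2 ℕ.^ suc J → half a ℕ.< 2 ℕ.^ J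
    halve {a} a< = ℕᵐ.m<n*o⇒m/o<n (subst (a ℕ.<_) (ℕₚ.*-comm 2 (2 ℕ.^ J)) a<)
    IH : NormBound K L C₁ (+ (J ℕ.* J) * B)
    IH = normBound-< J (λ m → half (t m)) (λ n → half (f n)) (λ m → halve (t< m)) (λ n → halve (f< n)) 0≤B h
    ind²≤1 : ∀ {P : Set} (p : Dec P) → ind p * ind p ≤ 1ℤ
    ind²≤1 (yes _) = ≤-refl
    ind²≤1 (no _)  = 0≤+
    diag : NormBound K L C₂ B
    diag = normBound-diagonal (2 ℕ.^ J) (λ m → half (t m)) (λ n → half (f n)) (λ m → halve (t< m)) 0≤B
      (normBound-scale (λ m → even (t m)) (λ n → odd (f n)) (λ m → ind²≤1 (t m ℕᵐ.% 2 ℕ.≟ 0)) (λ n → ind²≤1 (f n ℕᵐ.% 2 ℕ.≟ 1)) 0≤B h)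
    combine : ∀ J X Y N → 0ℤ ≤ N → X * X ≤ + (J ℕ.* J) * B * N → Y * Y ≤ B * N → (X + Y) * (X + Y) ≤ + (suc J ℕ.* suc J) * B * N
    combine J X Y N 0≤N hX hY = subst ((X + Y) * (X + Y) ≤_) (trans (lem₃ (+ J) (B * N)) (trans (cong (_* (B * N)) (sym (pos-* (suc J) (suc J)))) (sym (*-assoc (+ (suc J ℕ.* suc J)) B N))))
      -- Weights J, J and 1, 1: the square roots of the two bounds add up to J + 1.
      (cauchy₂ (B * N) X Y {+ J} {+ J} {1ℤ} {1ℤ} (0≤* 0≤B 0≤N) 0≤+ 0≤+ 0≤+ 0≤+
        (subst (X * X ≤_) (trans (cong (λ z → z * B * N) (pos-* J J)) (lem₁ (+ J) B N)) hX)
        (subst (Y * Y ≤_) (sym (*-identityʳ (B * N))) hY))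
      where
      lem₁ : ∀ j b n → j * j * b * n ≡ b * n * (j * j)
      lem₁ = solve-∀
      lem₃ : ∀ j c → c * ((j + 1ℤ) * (j + 1ℤ)) ≡ ((1ℤ + j) * (1ℤ + j)) * c
      lem₃ = solve-∀

-- The averaged kernel: Schur's test on the diagonal, cancellation off it

module Kernel where

  open import Data.Nat.Coprimality using (Coprime)
  open import Data.Nat.Primality using (Prime; prime⇒irreducible; prime⇒nonZero; ¬prime[1])
  open import Data.Integer using (ℤ; +_; -_; _+_; _-_; _*_; _≤_; 0ℤ; 1ℤ; +≤+)
  open import Data.Integer.Properties using (≤-refl; ≤-trans; ≤-reflexive; +-mono-≤; +-monoʳ-≤; +-identityʳ; +-identityˡ; *-zeroʳ; *-identityˡ; *-identityʳ; *-comm; *-assoc; +-comm; pos-+; pos-*; *-cancelˡ-≤-pos)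
  open import Data.Integer.Divisibility.Signed using (_∣_; ∣ᵤ⇒∣; ∣n⇒∣m*n; ∣-trans; ∣m⇒∣m*n)
  open import Data.Integer.Tactic.RingSolver using (solve-∀)
  open Sums
  open Congruence
  open Averaging
  open Bilinear

  distinct-primes-coprime : ∀ {p q} → Prime p → Prime q → ¬ (p ≡ q) → Coprime p q
  distinct-primes-coprime pp pq p≢q = prime∤⇒coprime pq λ q∣p → case (prime⇒irreducible pp q∣p)
    where
    case : _ → _
    case (inj₁ refl) = ¬prime[1] pq
    case (inj₂ q≡p)  = p≢q (sym q≡p)

  ^-distribʳ-* : ∀ k a b → (a ℕ.* b) ℕ.^ k ≡ a ℕ.^ k ℕ.* b ℕ.^ k
  ^-distribʳ-* zero a b = refl
  ^-distribʳ-* (suc k) a b = trans (cong (a ℕ.* b ℕ.*_) (^-distribʳ-* k a b)) (lem a b (a ℕ.^ k) (b ℕ.^ k))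
    where
    lem : ∀ a b c d → a ℕ.* b ℕ.* (c ℕ.* d) ≡ a ℕ.* c ℕ.* (b ℕ.* d)
    lem = ℕˢ.solve-∀

  weight≤ : ∀ ℓ → weight ℓ ℕ.≤ ℓ ℕ.* ℓ
  weight≤ ℓ = ℕₚ.*-monoʳ-≤ ℓ (ℕₚ.m∸n≤m ℓ 1)

  module Family (G w R : ℕ) .{{_ : ℕ.NonZero G}} (w≤G : w ℕ.≤ G)
    {𝓛 : ℕ → Set} (𝓛? : ∀ ℓ → Dec (𝓛 ℓ)) (𝓛-prime : ∀ {ℓ} → 𝓛 ℓ → Prime ℓ) (𝓛-coprime : ∀ {ℓ} → 𝓛 ℓ → Coprime G ℓ) where

    χ : ℕ → ℤ
    χ ℓ = ind (𝓛? ℓ)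

    -- `+ w * E G u` stands for the factors `e` that are held fixed: G is the product of their
    -- squared primes and w that of their weights, both 1 when there are none.
    h : ℕ → ℤ → ℤ
    h ℓ u = + w * E G u * d ℓ u

    kernel : ℤ → ℤ
    kernel u = ∑ R (λ ℓ → χ ℓ * h ℓ u)

    Q : ℕ
    Q = G ℕ.* (R ℕ.* R)

    ∥d∥≤ : ∀ ℓ u → ∥ d ℓ u ∥ ≤ + weight ℓ * E (ℓ ℕ.* ℓ) u + 1ℤ
    ∥d∥≤ ℓ u = ≤-trans (∥∥-- (e ℓ u) (O ℓ u)) (+-mono-≤
      (≤-reflexive (∥∥-nonNeg (0≤* {+ weight ℓ} 0≤+ (0≤E (ℓ ℕ.* ℓ) u))))
      (subst (_≤ 1ℤ) (sym (∥∥-nonNeg (0≤O ℓ u))) (O≤1 ℓ u)))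

    -- Two spikes remain: those modulo G and ℓ², merged by the Chinese remainder theorem, and the
    -- one modulo G that is left by `O ℓ` ≤ 1. In each the height is at most the modulus, so N
    -- consecutive terms contribute at most N plus the modulus.
    h-bound : ∀ {ℓ} → 𝓛 ℓ → ∀ u → ∥ h ℓ u ∥ ≤ + (w ℕ.* weight ℓ) * E (G ℕ.* (ℓ ℕ.* ℓ)) u + + w * E G u
    h-bound {ℓ} l u = subst₂ _≤_ (sym (trans (∥∥-* (+ w * E G u) (d ℓ u)) (cong (_* ∥ d ℓ u ∥) (∥∥-nonNeg 0≤wE)))) eq
      (*-monoˡ 0≤wE (∥d∥≤ ℓ u))
      where
      0≤wE : 0ℤ ≤ + w * E G u
      0≤wE = 0≤* {+ w} 0≤+ (0≤E G u)
      lem : ∀ w a b c → w * a * (b * c + 1ℤ) ≡ w * b * (a * c) + w * a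
      lem = solve-∀
      eq : + w * E G u * (+ weight ℓ * E (ℓ ℕ.* ℓ) u + 1ℤ) ≡ + (w ℕ.* weight ℓ) * E (G ℕ.* (ℓ ℕ.* ℓ)) u + + w * E G u
      eq = trans (lem (+ w) (E G u) (+ weight ℓ) (E (ℓ ℕ.* ℓ) u))
        (cong₂ (λ a b → a * b + + w * E G u) (sym (pos-* w (weight ℓ))) ([∣]-crt (coprime-* (𝓛-coprime l) (𝓛-coprime l)) (u - 1ℤ)))

    scaled-count : ∀ c q .{{_ : ℕ.NonZero q}} N m n → c ℕ.≤ q → q ℕ.≤ Q → ∑ N (λ i → + c * E q (m * (n + + i))) ≤ + (N ℕ.+ Q)
    scaled-count c q N m n c≤q q≤Q = subst (_≤ + (N ℕ.+ Q)) (sym (∑-*ˡ N (+ c) _))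
      (≤-trans (*-monoʳ (∑-nonNeg N (λ i → 0≤E q (m * (n + + i)))) (+≤+ c≤q))
      (≤-trans (≤-reflexive (*-comm (+ q) (∑ N (λ i → E q (m * (n + + i)))))) (≤-trans (∑-E q N m n) (subst (_≤ + (N ℕ.+ Q)) (pos-+ N q) (+≤+ (ℕₚ.+-monoʳ-≤ N q≤Q))))))

    P : ℕ → ℕ
    P N = 2 ℕ.* (N ℕ.+ Q)

    row : ∀ {ℓ} → 𝓛 ℓ → ℓ ℕ.< R → ∀ N m n → ∑ N (λ i → ∥ h ℓ (m * (n + + i)) ∥) ≤ + P N
    row {ℓ} l ℓ<R N m n = ≤-trans (∑-mono N (λ i → h-bound l (m * (n + + i))))
      (subst₂ _≤_ (sym (∑-+ N _ _)) (trans (sym (pos-+ (N ℕ.+ Q) (N ℕ.+ Q))) (cong (λ z → + (N ℕ.+ Q ℕ.+ z)) (sym (ℕₚ.+-identityʳ (N ℕ.+ Q)))))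
        (+-mono-≤ (scaled-count (w ℕ.* weight ℓ) (G ℕ.* (ℓ ℕ.* ℓ)) N m n (ℕₚ.*-mono-≤ w≤G (weight≤ ℓ)) (ℕₚ.*-monoʳ-≤ G (ℕₚ.*-mono-≤ (ℕₚ.<⇒≤ ℓ<R) (ℕₚ.<⇒≤ ℓ<R))))
                  (scaled-count w G N m n w≤G (ℕₚ.m≤m*n G (R ℕ.* R)))))
      where
      instance
        nz = prime⇒nonZero (𝓛-prime l)
        nz² = ℕₚ.m*n≢0 ℓ ℓ
        nzG = ℕₚ.m*n≢0 G (ℓ ℕ.* ℓ)
        nzR = ℕ.>-nonZero (ℕₚ.≤-<-trans ℕ.z≤n ℓ<R)
        nzR² = ℕₚ.m*n≢0 R R

    row₁ : ∀ {ℓ} → 𝓛 ℓ → ℓ ℕ.< R → ∀ N n → ∑ N (λ m → ∥ h ℓ (+ m * n) ∥) ≤ + P N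
    row₁ {ℓ} l ℓ<R N n = subst (_≤ + P N) (∑-cong N (λ m → cong (λ z → ∥ h ℓ z ∥) (trans (cong (n *_) (+-identityˡ (+ m))) (*-comm n (+ m))))) (row l ℓ<R N n 0ℤ)

    h≤ : ∀ {ℓ} → 𝓛 ℓ → ℓ ℕ.< R → ∀ u → ∥ h ℓ u ∥ ≤ + P 1
    h≤ {ℓ} l ℓ<R u = subst (_≤ + P 1) (trans (+-identityˡ _) (cong (λ z → ∥ h ℓ z ∥) (*-identityʳ u))) (row l ℓ<R 1 u 1ℤ)

    module _ (K : ℕ) (α : ℕ → ℤ) where

      c : ℕ → ℤ → ℤ
      c ℓ n = ∑ K (λ m → α m * h ℓ (+ m * n))

      A : ℤ
      A = ‖ α ‖² K

      0≤A : 0ℤ ≤ A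
      0≤A = 0≤‖‖² α K

      sq* : ∀ a b → (a * b) * (a * b) ≡ 1ℤ * ((a * a) * (b * b))
      sq* = solve-∀

      c²≤ : ∀ {ℓ} → 𝓛 ℓ → ℓ ℕ.< R → ∀ n → c ℓ n * c ℓ n ≤ A * + (K ℕ.* (P 1 ℕ.* P 1))
      c²≤ {ℓ} l ℓ<R n = ≤-trans
        (cauchy K {1ℤ} (λ m → α m * h ℓ (+ m * n)) (λ m → α m * α m) (λ _ → + P 1 * + P 1) 0≤+ (λ m → 0≤i² (α m)) (λ _ → 0≤* {+ P 1} {+ P 1} 0≤+ 0≤+)
          (λ m → subst (_≤ 1ℤ * (α m * α m * (+ P 1 * + P 1))) (sym (sq* (α m) (h ℓ (+ m * n))))
            (*-monoˡ {1ℤ} 0≤+ (*-monoˡ (0≤i² (α m)) (subst (_≤ + P 1 * + P 1) (∥∥-sq (h ℓ (+ m * n))) (*-mono {∥ h ℓ (+ m * n) ∥} {+ P 1} 0≤+ 0≤+ (h≤ l ℓ<R _) (h≤ l ℓ<R _)))))))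
        (≤-reflexive (trans (*-identityˡ _) (cong (A *_) (trans (∑-const K _) (trans (cong (+ K *_) (sym (pos-* (P 1) (P 1)))) (sym (pos-* K _)))))))

      -- Schur's test, with (αh)² split as α²|h| times |h|: the sum of |h| over m is at most `P K`
      -- for each n, and averaging the other factor over n gives `P Y` for each m. Thus the spikes
      -- enter through their mass and not through their height.
      schur : ∀ {ℓ} → 𝓛 ℓ → ℓ ℕ.< R → ∀ Y n → avg Y (λ n → c ℓ n * c ℓ n) n ≤ A * + (P Y ℕ.* P K)
      schur {ℓ} l ℓ<R Y n = ≤-trans (∑-mono Y (λ u → pointwise (n + + u)))
        (≤-trans (≤-reflexive (∑-*ʳ Y (+ P K) _))
        (≤-trans (*-monoʳ {+ P K} 0≤+ total) (≤-reflexive (trans (*-assoc A (+ P Y) (+ P K)) (cong (A *_) (sym (pos-* (P Y) (P K))))))))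
        where
        sq∥ : ∀ a b → (a * b) * (a * b) ≡ (a * a) * (b * b)
        sq∥ = solve-∀
        split : ∀ a x → (a * x) * (a * x) ≡ 1ℤ * ((a * a * ∥ x ∥) * ∥ x ∥)
        split a x = trans (sq∥ a x) (trans (cong (a * a *_) (sym (∥∥-sq x))) (trans (sym (*-assoc (a * a) ∥ x ∥ ∥ x ∥)) (sym (*-identityˡ _))))
        weighted : ℤ → ℤ
        weighted n = ∑ K (λ m → α m * α m * ∥ h ℓ (+ m * n) ∥)
        pointwise : ∀ n → c ℓ n * c ℓ n ≤ weighted n * + P K
        pointwise n = ≤-trans
          (cauchy K {1ℤ} (λ m → α m * h ℓ (+ m * n)) (λ m → α m * α m * ∥ h ℓ (+ m * n) ∥) (λ m → ∥ h ℓ (+ m * n) ∥) 0≤+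
            (λ m → 0≤* (0≤i² (α m)) 0≤+) (λ _ → 0≤+) (λ m → ≤-reflexive (split (α m) (h ℓ (+ m * n)))))
          (≤-trans (≤-reflexive (*-identityˡ _)) (*-monoˡ (∑-nonNeg K (λ m → 0≤* (0≤i² (α m)) 0≤+)) (row₁ l ℓ<R K n)))
        total : ∑ Y (λ u → weighted (n + + u)) ≤ A * + P Y
        total = ≤-trans (≤-reflexive (∑-swap Y K _)) (≤-trans
          (∑-mono K (λ m → ≤-trans (≤-reflexive (∑-*ˡ Y (α m * α m) _)) (*-monoˡ (0≤i² (α m)) (row l ℓ<R Y (+ m) n))))
          (≤-reflexive (∑-*ʳ K (+ P Y) _)))

      c-periodic : ∀ {ℓ} n → c ℓ (n + + (G ℕ.* (ℓ ℕ.* ℓ))) ≡ c ℓ n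
      c-periodic {ℓ} n = ∑-cong K (λ m → cong (α m *_) (cong₂ _*_ (cong (+ w *_) (E-cong G (+ m * (n + + (G ℕ.* (ℓ ℕ.* ℓ)))) (+ m * n) (∣-trans (∣ᵤ⇒∣ (ℕᵈ.m∣m*n (ℓ ℕ.* ℓ))) (mult m))))
        (d-cong ℓ (+ m * (n + + (G ℕ.* (ℓ ℕ.* ℓ)))) (+ m * n) (∣-trans (∣ᵤ⇒∣ (ℕᵈ.n∣m*n G)) (mult m)))))
        where
        lem : ∀ m n a → m * (n + a) - m * n ≡ m * a
        lem = solve-∀
        mult : ∀ m → + (G ℕ.* (ℓ ℕ.* ℓ)) ∣ + m * (n + + (G ℕ.* (ℓ ℕ.* ℓ))) - + m * n
        mult m = subst (+ (G ℕ.* (ℓ ℕ.* ℓ)) ∣_) (sym (lem (+ m) n (+ (G ℕ.* (ℓ ℕ.* ℓ))))) (∣n⇒∣m*n (+ m) (∣ᵤ⇒∣ ℕᵈ.∣-refl))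

      -- Steps of length Gq do not change the argument modulo G, so `E G` is constant along them and
      -- only the vanishing sum of `d ℓ` is left.
      c-fibre : ∀ {ℓ} → 𝓛 ℓ → ∀ q → Coprime (G ℕ.* q) ℓ → ∀ n → ∑ (ℓ ℕ.* ℓ) (λ j → c ℓ (n + + (G ℕ.* q) * + j)) ≡ 0ℤ
      c-fibre {ℓ} l q cop n = trans (∑-swap (ℓ ℕ.* ℓ) K _) (∑-zero< K (λ m _ → trans (∑-*ˡ (ℓ ℕ.* ℓ) (α m) _)
        (trans (cong (α m *_) (trans (∑-cong (ℓ ℕ.* ℓ) (λ j → cong (λ z → + w * z * d ℓ (+ m * (n + + (G ℕ.* q) * + j))) (E-cong G (+ m * (n + + (G ℕ.* q) * + j)) (+ m * n) (mult m j))))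
          (trans (∑-*ˡ (ℓ ℕ.* ℓ) (+ w * E G (+ m * n)) _) (trans (cong (+ w * E G (+ m * n) *_) (∑-d-fibre (𝓛-prime l) (+ m) n (G ℕ.* q) cop)) (*-zeroʳ (+ w * E G (+ m * n)))))))
          (*-zeroʳ (α m)))))
        where
        lem : ∀ m n a j → m * (n + a * j) - m * n ≡ a * (m * j)
        lem = solve-∀
        mult : ∀ m j → + G ∣ + m * (n + + (G ℕ.* q) * + j) - + m * n
        mult m j = subst (+ G ∣_) (sym (lem (+ m) n (+ (G ℕ.* q)) (+ j))) (∣m⇒∣m*n {m = + (G ℕ.* q)} (+ m * + j) (∣ᵤ⇒∣ (ℕᵈ.m∣m*n q)))

      module _ (k Y : ℕ) where

        smooth : (ℤ → ℤ) → ℤ → ℤ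
        smooth f = avg^ k Y (avg Y f)

        M̄ : ℕ
        M̄ = G ℕ.* (R ℕ.* R) ℕ.* (R ℕ.* R)

        c̄ : ℤ
        c̄ = A * + (K ℕ.* (P 1 ℕ.* P 1))

        0≤c̄ : 0ℤ ≤ c̄
        0≤c̄ = 0≤* 0≤A 0≤+

        -- `c ℓ′` is periodic modulo Gℓ′², and `c ℓ` sums to zero along ℓ² steps of that length
        -- because ℓ is prime to Gℓ′². So the product vanishes over the period Gℓ²ℓ′², and each of
        -- the k + 1 averages multiplies its size by at most that period instead of by Y.
        off-diagonal : ∀ {ℓ ℓ′} → 𝓛 ℓ → 𝓛 ℓ′ → ℓ ℕ.< R → ℓ′ ℕ.< R → ¬ (ℓ ≡ ℓ′) → ∀ n →
          smooth (λ n → c ℓ′ n * c ℓ n) n ≤ + (M̄ ℕ.^ suc k) * c̄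
        off-diagonal {ℓ} {ℓ′} l l′ ℓ<R ℓ′<R ℓ≢ℓ′ n =
          ≤-trans (i≤∥i∥ _) (≤-trans (proj₂ (vanishes-avg^ M k Y (avg Y f) (+ (M ℕ.^ 1) * c̄) (0≤* {+ (M ℕ.^ 1)} 0≤+ 0≤c̄) (proj₁ once) (proj₂ once)) n)
            (≤-trans (≤-reflexive (trans (sym (*-assoc (+ (M ℕ.^ k)) (+ (M ℕ.^ 1)) c̄)) (cong (_* c̄) (trans (sym (pos-* (M ℕ.^ k) (M ℕ.^ 1))) (cong +_ exponent)))))
              (*-monoʳ 0≤c̄ (+≤+ (ℕₚ.^-monoˡ-≤ (suc k) M≤)))))
          where
          f : ℤ → ℤ
          f n = c ℓ′ n * c ℓ n
          M : ℕ
          M = (ℓ ℕ.* ℓ) ℕ.* (G ℕ.* (ℓ′ ℕ.* ℓ′))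
          instance
            nz = prime⇒nonZero (𝓛-prime l)
            nz′ = prime⇒nonZero (𝓛-prime l′)
            nz² = ℕₚ.m*n≢0 ℓ ℓ
            nz′² = ℕₚ.m*n≢0 ℓ′ ℓ′
            nzG = ℕₚ.m*n≢0 G (ℓ′ ℕ.* ℓ′)
            nzM = ℕₚ.m*n≢0 (ℓ ℕ.* ℓ) (G ℕ.* (ℓ′ ℕ.* ℓ′))
          exponent : M ℕ.^ k ℕ.* M ℕ.^ 1 ≡ M ℕ.^ suc k
          exponent = trans (cong (M ℕ.^ k ℕ.*_) (ℕₚ.*-identityʳ M)) (ℕₚ.*-comm (M ℕ.^ k) M)
          M≤ : M ℕ.≤ M̄
          M≤ = ℕₚ.≤-trans (ℕₚ.≤-reflexive (ℕₚ.*-comm (ℓ ℕ.* ℓ) _))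
            (ℕₚ.*-mono-≤ (ℕₚ.*-monoʳ-≤ G (ℕₚ.*-mono-≤ (ℕₚ.<⇒≤ ℓ′<R) (ℕₚ.<⇒≤ ℓ′<R))) (ℕₚ.*-mono-≤ (ℕₚ.<⇒≤ ℓ<R) (ℕₚ.<⇒≤ ℓ<R)))
          cop : Coprime ℓ′ ℓ
          cop = distinct-primes-coprime (𝓛-prime l′) (𝓛-prime l) (λ x → ℓ≢ℓ′ (sym x))
          cop² : Coprime (G ℕ.* (ℓ′ ℕ.* ℓ′)) ℓ
          cop² = coprime-sym (coprime-* (coprime-sym (𝓛-coprime l)) (coprime-* (coprime-sym cop) (coprime-sym cop)))
          van : VanishesOver M f
          van = vanishes-* (G ℕ.* (ℓ′ ℕ.* ℓ′)) (ℓ ℕ.* ℓ) (c ℓ′) (c ℓ) (c-periodic {ℓ′}) (c-fibre l (ℓ′ ℕ.* ℓ′) cop²)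
          f≤ : ∀ n → ∥ f n ∥ ≤ c̄
          f≤ n = sq-≤⇒∥∥≤ {f n} 0≤c̄ (≤-trans (≤-reflexive (trans (sq* (c ℓ′ n) (c ℓ n)) (*-identityˡ _)))
            (*-mono (0≤i² (c ℓ′ n)) 0≤c̄ (c²≤ l′ ℓ′<R n) (c²≤ l ℓ<R n)))
          once = vanishes-avg^ M 1 Y f c̄ 0≤c̄ van f≤

        F : ℤ → ℤ
        F n = ∑ R (λ ℓ → χ ℓ * c ℓ n)

        smooth-F² : ∀ n → smooth (λ n → F n * F n) n ≡ ∑ R (λ ℓ → ∑ R (λ ℓ′ → χ ℓ * χ ℓ′ * smooth (λ n → c ℓ′ n * c ℓ n) n))
        smooth-F² n = begin
          smooth (λ n → F n * F n) n ≡⟨ avg^-cong k Y (λ n → avg^-cong 1 Y expand n) n ⟩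
          smooth (λ n → ∑ R (λ ℓ → ∑ R (λ ℓ′ → χ ℓ * χ ℓ′ * (c ℓ′ n * c ℓ n)))) n ≡⟨ smooth-∑ (λ ℓ n → ∑ R (λ ℓ′ → χ ℓ * χ ℓ′ * (c ℓ′ n * c ℓ n))) n ⟩
          ∑ R (λ ℓ → smooth (λ n → ∑ R (λ ℓ′ → χ ℓ * χ ℓ′ * (c ℓ′ n * c ℓ n))) n) ≡⟨ ∑-cong R (λ ℓ → smooth-∑ (λ ℓ′ n → χ ℓ * χ ℓ′ * (c ℓ′ n * c ℓ n)) n) ⟩
          ∑ R (λ ℓ → ∑ R (λ ℓ′ → smooth (λ n → χ ℓ * χ ℓ′ * (c ℓ′ n * c ℓ n)) n)) ≡⟨ ∑-cong R (λ ℓ → ∑-cong R (λ ℓ′ → smooth-* (χ ℓ * χ ℓ′) (λ n → c ℓ′ n * c ℓ n) n)) ⟩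
          ∑ R (λ ℓ → ∑ R (λ ℓ′ → χ ℓ * χ ℓ′ * smooth (λ n → c ℓ′ n * c ℓ n) n)) ∎
          where
          open ≡-Reasoning
          lem : ∀ a b c d → (a * b) * (c * d) ≡ a * c * (d * b)
          lem = solve-∀
          expand : ∀ n → F n * F n ≡ ∑ R (λ ℓ → ∑ R (λ ℓ′ → χ ℓ * χ ℓ′ * (c ℓ′ n * c ℓ n)))
          expand n = trans (∑-product R R _ _) (∑-cong R (λ ℓ → ∑-cong R (λ ℓ′ → lem (χ ℓ) (c ℓ n) (χ ℓ′) (c ℓ′ n))))
          smooth-∑ : ∀ (f : ℕ → ℤ → ℤ) n → smooth (λ n → ∑ R (λ ℓ → f ℓ n)) n ≡ ∑ R (λ ℓ → smooth (f ℓ) n)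
          smooth-∑ f n = trans (avg^-cong k Y (λ n → avg^-∑ 1 Y R f n) n) (avg^-∑ k Y R (λ ℓ → avg Y (f ℓ)) n)
          smooth-* : ∀ a f n → smooth (λ n → a * f n) n ≡ a * smooth f n
          smooth-* a f n = trans (avg^-cong k Y (λ n → avg^-* 1 Y a f n) n) (avg^-* k Y a (avg Y f) n)

        Dg Od : ℤ
        Dg = + (Y ℕ.^ k) * (A * + (P Y ℕ.* P K))
        Od = + (M̄ ℕ.^ suc k) * c̄

        0≤Dg : 0ℤ ≤ Dg
        0≤Dg = 0≤* {+ (Y ℕ.^ k)} 0≤+ (0≤* 0≤A 0≤+)

        0≤Od : 0ℤ ≤ Od
        0≤Od = 0≤* {+ (M̄ ℕ.^ suc k)} 0≤+ 0≤c̄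

        smooth-F²-≤ : ∀ n → smooth (λ n → F n * F n) n ≤ + R * Dg + + R * (+ R * Od)
        smooth-F²-≤ n = ≤-trans (≤-reflexive (smooth-F² n)) (≤-trans (∑-mono< R (λ ℓ ℓ<R → ∑-mono< R (λ ℓ′ ℓ′<R → term ℓ ℓ′ ℓ<R ℓ′<R)))
          (≤-trans (∑-mono R (λ ℓ → ≤-reflexive (∑-+ R _ _))) (≤-trans (≤-reflexive (∑-+ R _ _)) (+-mono-≤ diag off))))
          where
          diag : ∑ R (λ ℓ → ∑ R (λ ℓ′ → ind (ℓ ℕ.≟ ℓ′) * Dg)) ≤ + R * Dg
          diag = ∑-≤-const R Dg (λ ℓ → ≤-trans (≤-reflexive (∑-*ʳ R Dg _)) (≤-trans (*-monoʳ 0≤Dg (∑-ind≤1 R (λ ℓ′ → ℓ ℕ.≟ ℓ′) (λ i j _ _ x y → trans (sym x) y))) (≤-reflexive (*-identityˡ Dg))))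
          off : ∑ R (λ ℓ → ∑ R (λ ℓ′ → Od)) ≤ + R * (+ R * Od)
          off = ≤-reflexive (trans (∑-cong R (λ _ → ∑-const R Od)) (∑-const R _))
          term : ∀ ℓ ℓ′ → ℓ ℕ.< R → ℓ′ ℕ.< R → χ ℓ * χ ℓ′ * smooth (λ n → c ℓ′ n * c ℓ n) n ≤ ind (ℓ ℕ.≟ ℓ′) * Dg + Od
          term ℓ ℓ′ ℓ<R ℓ′<R with 𝓛? ℓ | 𝓛? ℓ′ | ℓ ℕ.≟ ℓ′
          ... | no _ | q | r = 0≤+-+ (0≤* (0≤ind r) 0≤Dg) 0≤Od
          ... | yes _ | no _ | r = 0≤+-+ (0≤* (0≤ind r) 0≤Dg) 0≤Od
          ... | yes l | yes l′ | no ℓ≢ℓ′ = subst₂ _≤_ (sym (*-identityˡ _)) (sym (+-identityˡ Od)) (off-diagonal l l′ ℓ<R ℓ′<R ℓ≢ℓ′ n)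
          ... | yes l | yes _ | yes refl = subst₂ _≤_ (sym (*-identityˡ _)) (cong (_+ Od) (sym (*-identityˡ Dg)))
            (≤-trans (avg^-upper k Y _ (schur l ℓ<R Y) n) (≤-by Od 0≤Od refl))

    -- The factor (k + 1)^k is Y^k/V^k for Y = (k + 1)V, the price of majorising a sum of length at
    -- most V by averages of length Y. The diagonal pairs give the product with R, the off-diagonal
    -- ones the final 1.
    bound : ℕ → ℕ → ℕ → ℕ
    bound k Y K = suc k ℕ.^ k ℕ.* (R ℕ.* (P Y ℕ.* P K) ℕ.+ 1)

    -- the hypothesis makes the total off-diagonal contribution at most one unit
    normBound-kernel : ∀ k V .{{_ : ℕ.NonZero V}} K L → L ℕ.≤ V →
      R ℕ.* R ℕ.* ((G ℕ.* (R ℕ.* R) ℕ.* (R ℕ.* R)) ℕ.^ suc k ℕ.* (K ℕ.* (P 1 ℕ.* P 1))) ℕ.≤ (suc k ℕ.* V) ℕ.^ k →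
      NormBound K L (λ m n → kernel (+ m * + n)) (+ bound k (suc k ℕ.* V) K)
    NormBound.at (normBound-kernel k V K L L≤V hyp) α β = ≤-trans (≤-reflexive (cong₂ _*_ eq eq))
      (≤-trans (cauchy L {1ℤ} (λ n → β n * F′ (+ n)) (λ n → F′ (+ n) * F′ (+ n)) (λ n → β n * β n) 0≤+ (λ n → 0≤i² (F′ (+ n))) (λ n → 0≤i² (β n)) (λ n → ≤-reflexive (sq (β n) (F′ (+ n)))))
      (≤-trans (≤-reflexive (*-identityˡ _)) (≤-trans (*-monoʳ (0≤‖‖² β L) F²≤) (≤-reflexive (*-assoc (+ B) (A K α) (‖ β ‖² L))))))
      where
      Y = suc k ℕ.* V
      B = bound k Y K
      F′ = F K α k Y
      sq : ∀ a b → (a * b) * (a * b) ≡ 1ℤ * ((b * b) * (a * a))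
      sq = solve-∀
      comb : ∀ a b x y → a * b * (x * y) ≡ b * (x * (a * y))
      comb = solve-∀
      eq : form K L (λ m n → kernel (+ m * + n)) α β ≡ ∑ L (λ n → β n * F′ (+ n))
      eq = trans (∑-swap K L _) (∑-cong L (λ n → trans (∑-cong K (λ m → trans (sym (∑-*ˡ R (α m * β n) _)) (∑-cong R (λ ℓ → comb (α m) (β n) (χ ℓ) (h ℓ (+ m * + n))))))
        (trans (∑-swap K R _) (trans (∑-cong R (λ ℓ → trans (∑-*ˡ K (β n) _) (cong (β n *_) (∑-*ˡ K (χ ℓ) _)))) (∑-*ˡ R (β n) _)))))
      S = ∑ L (λ n → F′ (+ n) * F′ (+ n))
      V≤Y : V ℕ.≤ Y
      V≤Y = ℕₚ.m≤m+n V (k ℕ.* V)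
      instance
        nzVk = ℕₚ.m^n≢0 V k
      gather : ∀ a r s y pp x → r * (y * (a * pp)) + r * (r * (s * (a * x))) ≡ a * (r * (y * pp)) + a * (r * (r * (s * x)))
      gather = solve-∀
      cast : ∀ x → + R * (+ R * (+ ((G ℕ.* (R ℕ.* R) ℕ.* (R ℕ.* R)) ℕ.^ suc k) * + x)) ≡ + (R ℕ.* R ℕ.* ((G ℕ.* (R ℕ.* R) ℕ.* (R ℕ.* R)) ℕ.^ suc k ℕ.* x))
      cast x = trans (sym (*-assoc (+ R) (+ R) _)) (trans (cong₂ _*_ (sym (pos-* R R)) (sym (pos-* ((G ℕ.* (R ℕ.* R) ℕ.* (R ℕ.* R)) ℕ.^ suc k) x))) (sym (pos-* (R ℕ.* R) _)))
      upper : + (V ℕ.^ k) * S ≤ + (V ℕ.^ k) * (+ B * A K α)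
      -- The start at -kV fits exactly: kV for the k outer shifts, then L ≤ V more places within Y =
      -- (k + 1)V.
      upper = ≤-trans (avg^-lower k Y V L (λ n → F′ n * F′ n) (λ n → 0≤i² (F′ n)) V≤Y (k ℕ.* V) ℕₚ.≤-refl (ℕₚ.≤-trans (ℕₚ.+-monoʳ-≤ (k ℕ.* V) L≤V) (ℕₚ.≤-reflexive (ℕₚ.+-comm (k ℕ.* V) V))))
        (≤-trans (smooth-F²-≤ K α k Y (- + (k ℕ.* V)))
        (≤-trans (≤-reflexive (gather (A K α) (+ R) (+ ((G ℕ.* (R ℕ.* R) ℕ.* (R ℕ.* R)) ℕ.^ suc k)) (+ (Y ℕ.^ k)) (+ (P Y ℕ.* P K)) (+ (K ℕ.* (P 1 ℕ.* P 1)))))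
        (≤-trans (+-monoʳ-≤ (A K α * (+ R * (+ (Y ℕ.^ k) * + (P Y ℕ.* P K)))) (*-monoˡ (0≤A K α) (subst (_≤ + (Y ℕ.^ k)) (sym (cast (K ℕ.* (P 1 ℕ.* P 1)))) (+≤+ hyp))))
          (≤-reflexive final))))
        where
        alg : ∀ a r y pp → a * (r * (y * pp)) + a * y ≡ y * (r * pp + 1ℤ) * a
        alg = solve-∀
        final : A K α * (+ R * (+ (Y ℕ.^ k) * + (P Y ℕ.* P K))) + A K α * + (Y ℕ.^ k) ≡ + (V ℕ.^ k) * (+ B * A K α)
        final = trans (alg (A K α) (+ R) (+ (Y ℕ.^ k)) (+ (P Y ℕ.* P K)))
          (trans (cong (_* A K α) (trans (cong₂ _*_ (trans (cong +_ (trans (^-distribʳ-* k (suc k) V) (ℕₚ.*-comm (suc k ℕ.^ k) (V ℕ.^ k)))) (pos-* (V ℕ.^ k) (suc k ℕ.^ k)))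
              (trans (cong (_+ 1ℤ) (sym (pos-* R (P Y ℕ.* P K)))) (sym (pos-+ (R ℕ.* (P Y ℕ.* P K)) 1))))
            (trans (*-assoc (+ (V ℕ.^ k)) (+ (suc k ℕ.^ k)) _) (cong (+ (V ℕ.^ k) *_) (sym (pos-* (suc k ℕ.^ k) _))))))
            (*-assoc (+ (V ℕ.^ k)) (+ B) (A K α)))
      F²≤ : S ≤ + B * A K α
      F²≤ = *-cancelˡ-≤-pos S (+ B * A K α) (+ (V ℕ.^ k)) {{ℤ.positive (Data.Integer.+<+ (ℕ.>-nonZero⁻¹ (V ℕ.^ k)))}} upper

-- Rough numbers and Buchstab's identity with truncated coefficients

module Sieve where

  open import Data.Nat.Divisibility using (hasNonTrivialDivisor; hasNonTrivialDivisor-≤)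
  open import Data.Nat.Coprimality using (coprime-divisor; prime⇒coprime)
  open import Data.Nat.Primality using (Prime; prime?; prime⇒nonZero; prime⇒nonTrivial; _Rough_; 0-rough; 1-rough; 2-rough; rough-1; ∤⇒rough-suc; rough∧∣⇒prime; rough∧∣⇒rough; rough⇒≤)
  open import Data.Integer using (ℤ; +_; -_; _+_; _-_; _*_; _≤_; 0ℤ; 1ℤ)
  open import Data.Integer.Properties using (≤-refl; ≤-trans; ≤-reflexive; +-identityʳ; +-identityˡ; *-zeroʳ; *-zeroˡ; *-identityˡ; *-identityʳ; *-comm; *-assoc; _≟_)
  open import Data.Integer.Tactic.RingSolver using (solve-∀)
  open Sums
  open Congruence

  rough-≤ : ∀ {y y′ n} → y ℕ.≤ y′ → y′ Rough n → y Rough n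
  rough-≤ y≤y′ r b = r (hasNonTrivialDivisor-≤ b y≤y′)

  rough? : ∀ y n → Dec (y Rough n)
  rough? 0 n = yes 0-rough
  rough? 1 n = yes 1-rough
  rough? 2 n = yes 2-rough
  rough? (suc y@(suc (suc _))) n with rough? y n | y ℕᵈ.∣? n
  ... | no ¬r | _ = no λ r → ¬r (rough-≤ (ℕₚ.n≤1+n y) r)
  ... | yes r | yes h = no λ r′ → r′ (hasNonTrivialDivisor ℕₚ.≤-refl h)
  ... | yes r | no ¬h = yes (∤⇒rough-suc ¬h r)

  rough-prime* : ∀ {y n} → Prime y → y Rough n → y Rough (y ℕ.* n)
  rough-prime* {y} {n} p r (hasNonTrivialDivisor {e} e<y e∣yn) = r (hasNonTrivialDivisor {divisor = e} e<y (coprime-divisor (coprime-sym (prime⇒coprime p {{ℕ.nonTrivial⇒nonZero e}} e<y)) e∣yn))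

  rough-suc-¬prime : ∀ {y n} → ¬ Prime y → y Rough n → suc y Rough n
  rough-suc-¬prime {0} ¬p r = 1-rough
  rough-suc-¬prime {1} ¬p r = 2-rough
  rough-suc-¬prime {y@(suc (suc _))} {n} ¬p r = ∤⇒rough-suc (λ h → ¬p (rough∧∣⇒prime r h)) r

  prime-suc-rough∤ : ∀ {y n} → Prime y → suc y Rough n → ¬ (y ℕᵈ.∣ n)
  prime-suc-rough∤ {y} p r h = r (hasNonTrivialDivisor {divisor = y} {{prime⇒nonTrivial p}} ℕₚ.≤-refl h)

  -- the largest y ≤ Z such that n is y-rough: the least prime factor of n, capped at Z
  lp : ℕ → ℕ → ℕ
  lp zero n = zero
  lp (suc Z) n with rough? (suc Z) n
  ... | yes _ = suc Z
  ... | no  _ = lp Z n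

  lp≤ : ∀ Z n → lp Z n ℕ.≤ Z
  lp≤ zero n = ℕ.z≤n
  lp≤ (suc Z) n with rough? (suc Z) n
  ... | yes _ = ℕₚ.≤-refl
  ... | no  _ = ℕₚ.m≤n⇒m≤1+n (lp≤ Z n)

  lp-rough : ∀ Z n → lp Z n Rough n
  lp-rough zero n = 0-rough
  lp-rough (suc Z) n with rough? (suc Z) n
  ... | yes r = r
  ... | no  _ = lp-rough Z n

  rough⇒≤lp : ∀ Z n {y} → y ℕ.≤ Z → y Rough n → y ℕ.≤ lp Z n
  rough⇒≤lp zero n y≤Z r = y≤Z
  rough⇒≤lp (suc Z) n y≤Z r with rough? (suc Z) n
  ... | yes _ = y≤Z
  ... | no ¬r = rough⇒≤lp Z n (ℕₚ.≤-pred (ℕₚ.≤∧≢⇒< y≤Z λ { refl → ¬r r })) r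

  ρ : ℕ → ℕ → ℤ
  ρ y n = ind (rough? y n)

  -- This separates the variables: a condition on the pair (m, n) becomes an inequality between a
  -- label of m and a label of n, which `normBound-<` can impose on a bilinear form at logarithmic
  -- cost.
  ρ-lp : ∀ Z m n → ρ (lp Z m) n ≡ ind (lp Z m ℕ.<? suc (lp Z n))
  ρ-lp Z m n = ind-cong (rough? (lp Z m) n) (lp Z m ℕ.<? suc (lp Z n))
    (λ r → ℕ.s≤s (rough⇒≤lp Z n (lp≤ Z m) r)) (λ h → rough-≤ (ℕₚ.≤-pred h) (lp-rough Z n))

  -- Total, so that `gen` can mention it before y is known to be prime; the value at y = 0 is
  -- multiplied by zero there.
  quot : ℕ → ℕ → ℕ
  quot m zero = zero
  quot m (suc y) = m ℕᵐ./ suc y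

  quot-* : ∀ y .{{_ : ℕ.NonZero y}} d → quot (y ℕ.* d) y ≡ d
  quot-* (suc y) d = trans (cong (ℕᵐ._/ suc y) (ℕₚ.*-comm (suc y) d)) (ℕᵐ.m*n/n≡m d (suc y))

  *-quot : ∀ y .{{_ : ℕ.NonZero y}} m → y ℕᵈ.∣ m → m ≡ y ℕ.* quot m y
  *-quot (suc y) m h = trans (sym (ℕᵐ.m/n*n≡m h)) (ℕₚ.*-comm (m ℕᵐ./ suc y) (suc y))

  ∑-multiples : ∀ X y .{{_ : ℕ.NonZero y}} (f : ℕ → ℤ) →
    ∑ X (λ m → ind (y ℕᵈ.∣? m) * f m) ≡ ∑ X (λ d → ind (y ℕ.* d ℕ.<? X) * f (y ℕ.* d))
  ∑-multiples X y f = begin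
    ∑ X (λ m → ind (y ℕᵈ.∣? m) * f m) ≡⟨ ∑-cong< X expand ⟩
    ∑ X (λ m → ∑ X (λ d → ind (y ℕ.* d ℕ.≟ m) * f m)) ≡⟨ ∑-swap X X _ ⟩
    ∑ X (λ d → ∑ X (λ m → ind (y ℕ.* d ℕ.≟ m) * f m)) ≡⟨ ∑-cong X collapse ⟩
    ∑ X (λ d → ind (y ℕ.* d ℕ.<? X) * f (y ℕ.* d)) ∎
    where
    open ≡-Reasoning
    expand : ∀ m → m ℕ.< X → ind (y ℕᵈ.∣? m) * f m ≡ ∑ X (λ d → ind (y ℕ.* d ℕ.≟ m) * f m)
    expand m m<X = trans (cong (_* f m) count) (sym (∑-*ʳ X (f m) _))
      where
      count : ind (y ℕᵈ.∣? m) ≡ ∑ X (λ d → ind (y ℕ.* d ℕ.≟ m))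
      count with y ℕᵈ.∣? m
      ... | no ¬h = sym (∑-zero< X (λ d _ → ind-no (y ℕ.* d ℕ.≟ m) λ { refl → ¬h (ℕᵈ.m∣m*n d) }))
      ... | yes (ℕᵈ.divides q refl) = sym (trans (∑-only X _ {q} (ℕₚ.≤-<-trans (ℕₚ.m≤m*n q y) m<X)
          (λ d _ d≢q → ind-no (y ℕ.* d ℕ.≟ q ℕ.* y) λ eq → d≢q (ℕₚ.*-cancelˡ-≡ d q y (trans eq (ℕₚ.*-comm q y)))))
          (ind-yes (y ℕ.* q ℕ.≟ q ℕ.* y) (ℕₚ.*-comm y q)))
    collapse : ∀ d → ∑ X (λ m → ind (y ℕ.* d ℕ.≟ m) * f m) ≡ ind (y ℕ.* d ℕ.<? X) * f (y ℕ.* d)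
    collapse d with y ℕ.* d ℕ.<? X
    ... | yes lt = trans (∑-only X _ lt (λ m _ m≢ → trans (cong (_* f m) (ind-no (y ℕ.* d ℕ.≟ m) (λ x → m≢ (sym x)))) (*-zeroˡ (f m))))
                     (cong (_* f (y ℕ.* d)) (ind-yes (y ℕ.* d ℕ.≟ y ℕ.* d) refl))
    ... | no ¬lt = trans (∑-zero< X (λ m m<X → trans (cong (_* f m) (ind-no (y ℕ.* d ℕ.≟ m) λ { refl → ¬lt m<X })) (*-zeroˡ (f m)))) (sym (*-zeroˡ (f (y ℕ.* d))))

  module Buchstab (x : ℕ) (w : ℕ → ℤ) (w₀ : w 0 ≡ 0ℤ) where

    S : ℕ → ℕ → ℤ
    S d y = ∑ x (λ n → ind (d ℕ.* n ℕ.<? x) * (ρ y n * w (d ℕ.* n)))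

    S-¬prime : ∀ d y → ¬ Prime y → S d (suc y) ≡ S d y
    S-¬prime d y ¬p = ∑-cong x (λ n → cong (λ z → ind (d ℕ.* n ℕ.<? x) * (z * w (d ℕ.* n)))
      (ind-cong (rough? (suc y) n) (rough? y n) (rough-≤ (ℕₚ.n≤1+n y)) (rough-suc-¬prime ¬p)))

    S-zero : ∀ y → S 0 y ≡ 0ℤ
    S-zero y = ∑-zero< x (λ n _ → trans (cong (λ z → ind (0 ℕ.<? x) * (ρ y n * z)) w₀) (trans (cong (ind (0 ℕ.<? x) *_) (*-zeroʳ (ρ y n))) (*-zeroʳ (ind (0 ℕ.<? x)))))

    -- Among the y-rough n, those prime to y are the (y + 1)-rough ones, and the multiples of y are
    -- n = yn′ with n′ again y-rough, since roughness at level y permits further factors y. For d =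
    -- 0 every term contains `w 0`, which is zero.
    S-prime : ∀ d y → Prime y → S d y ≡ S d (suc y) + S (d ℕ.* y) y
    S-prime zero y p = trans (S-zero y) (sym (cong₂ _+_ (S-zero (suc y)) (S-zero y)))
    S-prime d@(suc _) y p = begin
      S d y ≡⟨ ∑-cong x pointwise ⟩
      ∑ x (λ n → T (suc y) n + ind (y ℕᵈ.∣? n) * T y n) ≡⟨ ∑-+ x _ _ ⟩
      S d (suc y) + ∑ x (λ n → ind (y ℕᵈ.∣? n) * T y n) ≡⟨ cong (_+_ (S d (suc y))) (trans (∑-multiples x y (T y)) (∑-cong x reindex)) ⟩
      S d (suc y) + S (d ℕ.* y) y ∎
      where
      open ≡-Reasoning
      instance nz = prime⇒nonZero p
      T : ℕ → ℕ → ℤ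
      T y n = ind (d ℕ.* n ℕ.<? x) * (ρ y n * w (d ℕ.* n))
      distr : ∀ a b c i r → a * (b * c) + i * (a * (r * c)) ≡ a * ((b + i * r) * c)
      distr = solve-∀
      ρ-split : ∀ n → ρ y n ≡ ρ (suc y) n + ind (y ℕᵈ.∣? n) * ρ y n
      ρ-split n with rough? y n | y ℕᵈ.∣? n
      ... | no ¬r | q = sym (trans (cong₂ _+_ (ind-no (rough? (suc y) n) (λ r → ¬r (rough-≤ (ℕₚ.n≤1+n y) r))) (*-zeroʳ (ind q))) refl)
      ... | yes r | yes h = sym (cong (_+ 1ℤ) (ind-no (rough? (suc y) n) (λ r → prime-suc-rough∤ p r h)))
      ... | yes r | no ¬h = sym (cong (_+ 0ℤ) (ind-yes (rough? (suc y) n) (∤⇒rough-suc ¬h r)))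
      pointwise : ∀ n → T y n ≡ T (suc y) n + ind (y ℕᵈ.∣? n) * T y n
      pointwise n = trans (cong (λ z → ind (d ℕ.* n ℕ.<? x) * (z * w (d ℕ.* n))) (ρ-split n))
        (sym (distr (ind (d ℕ.* n ℕ.<? x)) (ρ (suc y) n) (w (d ℕ.* n)) (ind (y ℕᵈ.∣? n)) (ρ y n)))
      reindex : ∀ n → ind (y ℕ.* n ℕ.<? x) * T y (y ℕ.* n) ≡ ind (d ℕ.* y ℕ.* n ℕ.<? x) * (ρ y n * w (d ℕ.* y ℕ.* n))
      reindex n = trans (sym (*-assoc (ind (y ℕ.* n ℕ.<? x)) (ind (d ℕ.* (y ℕ.* n) ℕ.<? x)) _)) (cong₂ _*_
        (ind-* (y ℕ.* n ℕ.<? x) (d ℕ.* (y ℕ.* n) ℕ.<? x) (d ℕ.* y ℕ.* n ℕ.<? x)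
          (λ _ h → subst (ℕ._< x) (sym assoc) h) (λ h → ℕₚ.≤-<-trans (ℕₚ.m≤n*m (y ℕ.* n) d) (subst (ℕ._< x) assoc h)) (λ h → subst (ℕ._< x) assoc h))
        (cong₂ _*_ (ind-cong (rough? y (y ℕ.* n)) (rough? y n) (λ r → rough∧∣⇒rough r (ℕᵈ.n∣m*n y)) (rough-prime* p)) (cong w (sym assoc))))
        where
        assoc = ℕₚ.*-assoc d y n

  gen : ℕ → (ℕ → ℤ) → ℕ → ℤ
  gen y λ′ m = ind (prime? y) * (ind (y ℕᵈ.∣? m) * λ′ (quot m y))

  gen-supp : ∀ y λ′ m → ¬ (gen y λ′ m ≡ 0ℤ) → Prime y × y ℕᵈ.∣ m × ¬ (λ′ (quot m y) ≡ 0ℤ)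
  gen-supp y λ′ m h with prime? y | y ℕᵈ.∣? m
  ... | no _  | q = ⊥-elim (h (*-zeroˡ (ind q * λ′ (quot m y))))
  ... | yes p | no _  = ⊥-elim (h refl)
  ... | yes p | yes q = p , q , λ eq → h (cong (λ z → 1ℤ * (1ℤ * z)) eq)

  ∥gen∥≤1 : ∀ y λ′ m → (∀ d → ∥ λ′ d ∥ ≤ 1ℤ) → ∥ gen y λ′ m ∥ ≤ 1ℤ
  ∥gen∥≤1 y λ′ m h with prime? y | y ℕᵈ.∣? m
  ... | no _  | q = subst (λ z → ∥ z ∥ ≤ 1ℤ) (sym (*-zeroˡ (ind q * λ′ (quot m y)))) 0≤+
  ... | yes p | no _  = 0≤+
  ... | yes p | yes q = subst (λ z → ∥ z ∥ ≤ 1ℤ) (sym (trans (*-identityˡ (1ℤ * λ′ (quot m y))) (*-identityˡ (λ′ (quot m y))))) (h (quot m y))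

  -- Coefficients obtained by iterating Buchstab's identity from y = z down to y = 0:
  -- a divisor is kept (coefficient lam) while it is < D, and passed on (coefficient c) as soon as it is ≥ D.
  module Coefficients (z D : ℕ) .{{_ : ℕ.NonZero z}} (1<D : 1 ℕ.< D) (z≤D² : z ℕ.≤ D ℕ.* D) where

    lam : ℕ → ℕ → ℤ
    lam zero d = ind (d ℕ.≟ 1)
    lam (suc k) d = lam k d - ind (d ℕ.<? D) * gen (z ℕ.∸ suc k) (lam k) d

    g : ℕ → ℕ → ℤ
    g k m = gen (z ℕ.∸ suc k) (lam k) m

    cⱼ : ℕ → ℕ → ℤ
    cⱼ k m = - (ind (D ℕ.≤? m) * g k m)

    suc-thr : ∀ k → k ℕ.< z → z ℕ.∸ k ≡ suc (z ℕ.∸ suc k)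
    suc-thr k k<z = ℕₚ.+-∸-assoc 1 k<z

    lam-supp : ∀ k → k ℕ.≤ z → ∀ d → ¬ (lam k d ≡ 0ℤ) → (z ℕ.∸ k) Rough d × d ℕ.< D × ¬ (d ≡ 0)
    lam-supp zero k≤z d h with ind≢0 (d ℕ.≟ 1) h
    ... | refl = rough-1 z , 1<D , λ ()
    lam-supp (suc k) k<z d h with lam k d ≟ 0ℤ
    ... | no λ≢0 = rough-≤ (ℕₚ.∸-monoʳ-≤ z (ℕₚ.n≤1+n k)) (proj₁ IH) , proj₂ IH
      where IH = lam-supp k (ℕₚ.<⇒≤ k<z) d λ≢0
    ... | yes λ≡0 with d ℕ.<? D | g k d ≟ 0ℤ
    ... | no _ | _ = ⊥-elim (h (cong₂ _-_ λ≡0 (*-zeroˡ (g k d))))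
    ... | yes _ | yes g≡0 = ⊥-elim (h (cong₂ (λ a b → a - 1ℤ * b) λ≡0 g≡0))
    ... | yes d<D | no g≢0 = subst (y Rough_) (sym d≡) (rough-prime* (proj₁ G) (rough-≤ (ℕₚ.∸-monoʳ-≤ z (ℕₚ.n≤1+n k)) (proj₁ IH))) , d<D ,
            λ d≡0 → proj₂ (proj₂ IH) (ℕₚ.m*n≡0⇒m≡0 (quot d y) y (trans (ℕₚ.*-comm (quot d y) y) (trans (sym d≡) d≡0)))
      where
      y = z ℕ.∸ suc k
      G = gen-supp y (lam k) d g≢0
      instance nz = prime⇒nonZero (proj₁ G)
      d≡ = *-quot y d (proj₁ (proj₂ G))
      IH = lam-supp k (ℕₚ.<⇒≤ k<z) (quot d y) (proj₂ (proj₂ G))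

    lam≡0 : ∀ k → k ℕ.< z → ∀ d → Prime (z ℕ.∸ suc k) → (z ℕ.∸ suc k) ℕᵈ.∣ d → lam k d ≡ 0ℤ
    lam≡0 k k<z d p y∣d with lam k d ≟ 0ℤ
    ... | yes eq = eq
    ... | no neq = ⊥-elim (prime-suc-rough∤ p (subst (_Rough d) (suc-thr k k<z) (proj₁ (lam-supp k (ℕₚ.<⇒≤ k<z) d neq))) y∣d)

    -- In the recursive step the two summands are never both nonzero: with y = z - (k + 1), the
    -- first lives on numbers all of whose prime factors exceed y, the second on multiples of y.
    ∥lam∥≤1 : ∀ k → k ℕ.≤ z → ∀ d → ∥ lam k d ∥ ≤ 1ℤ
    ∥lam∥≤1 zero k≤z d = subst (_≤ 1ℤ) (sym (∥∥-nonNeg (0≤ind (d ℕ.≟ 1)))) (ind≤1 (d ℕ.≟ 1))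
    ∥lam∥≤1 (suc k) k<z d with g k d ≟ 0ℤ
    ... | yes g≡0 = subst (λ v → ∥ v ∥ ≤ 1ℤ) (sym (trans (cong (λ v → lam k d - ind (d ℕ.<? D) * v) g≡0) (lem (lam k d) (ind (d ℕ.<? D))))) (∥lam∥≤1 k (ℕₚ.<⇒≤ k<z) d)
      where
      lem : ∀ a b → a - b * 0ℤ ≡ a
      lem = solve-∀
    ... | no g≢0 = subst (λ v → ∥ v ∥ ≤ 1ℤ) (sym (trans (cong (_- ind (d ℕ.<? D) * g k d) (lam≡0 k k<z d (proj₁ G) (proj₁ (proj₂ G)))) (+-identityˡ (- (ind (d ℕ.<? D) * g k d)))))
        (subst (_≤ 1ℤ) (sym (∥∥-neg (ind (d ℕ.<? D) * g k d))) (scaled (d ℕ.<? D)))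
      where
      G = gen-supp (z ℕ.∸ suc k) (lam k) d g≢0
      scaled : ∀ {P : Set} (p : Dec P) → ∥ ind p * g k d ∥ ≤ 1ℤ
      scaled (yes _) = subst (λ v → ∥ v ∥ ≤ 1ℤ) (sym (*-identityˡ (g k d))) (∥gen∥≤1 (z ℕ.∸ suc k) (lam k) d (∥lam∥≤1 k (ℕₚ.<⇒≤ k<z)))
      scaled (no _)  = 0≤+

    -- Write m = yd′ with d′ < D and all prime factors of d′ above y. Either d′ = 1 and m = y < z ≤
    -- D², or y < d′ < D; hence m < D². Since y is the least prime factor of m, it reveals the step
    -- at which m was passed on.
    cⱼ-supp : ∀ k → k ℕ.< z → ∀ m → ¬ (cⱼ k m ≡ 0ℤ) → D ℕ.≤ m × m ℕ.< D ℕ.* D × lp z m ≡ z ℕ.∸ suc k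
    cⱼ-supp k k<z m h with D ℕ.≤? m | g k m ≟ 0ℤ
    ... | no _ | _ = ⊥-elim (h (cong -_ (*-zeroˡ (g k m))))
    ... | yes _ | yes g≡0 = ⊥-elim (h (cong (λ v → - (1ℤ * v)) g≡0))
    ... | yes D≤m | no g≢0  = D≤m , m< , ℕₚ.≤-antisym (ℕₚ.≮⇒≥ y≮) (rough⇒≤lp z m (ℕₚ.m∸n≤m z (suc k)) rm)
      where
      y = z ℕ.∸ suc k
      G = gen-supp y (lam k) m g≢0
      p = proj₁ G
      d′ = quot m y
      instance nz = prime⇒nonZero p
      m≡ = *-quot y m (proj₁ (proj₂ G))
      supp = lam-supp k (ℕₚ.<⇒≤ k<z) d′ (proj₂ (proj₂ G))
      rd : suc y Rough d′
      rd = subst (_Rough d′) (suc-thr k k<z) (proj₁ supp)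
      rm : y Rough m
      rm = subst (y Rough_) (sym m≡) (rough-prime* p (rough-≤ (ℕₚ.n≤1+n y) rd))
      y≮ : ¬ (y ℕ.< lp z m)
      y≮ y<lp = prime-suc-rough∤ p (rough-≤ y<lp (lp-rough z m)) (proj₁ (proj₂ G))
      y<z : y ℕ.< z
      y<z = ℕₚ.∸-monoʳ-< (ℕ.s≤s ℕ.z≤n) k<z
      small : ∀ e → e ≡ d′ → y ℕ.* e ℕ.< D ℕ.* D
      small 0 eq = ⊥-elim (proj₂ (proj₂ supp) (sym eq))
      small 1 eq = subst (ℕ._< D ℕ.* D) (sym (ℕₚ.*-identityʳ y)) (ℕₚ.<-≤-trans y<z z≤D²)
      small e@(suc (suc _)) eq = ℕₚ.*-mono-< (ℕₚ.<-trans (rough⇒≤ (subst (suc y Rough_) (sym eq) rd)) e<D) e<D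
        where
        e<D : e ℕ.< D
        e<D = subst (ℕ._< D) (sym eq) (proj₁ (proj₂ supp))
      m< : m ℕ.< D ℕ.* D
      m< = subst (ℕ._< D ℕ.* D) (sym m≡) (small d′ refl)

    λ₀ : ℕ → ℤ
    λ₀ = lam z

    -- The step is read off from the least prime factor of m, so the contributions of all steps
    -- merge into one coefficient, and the roughness level of the inner sum becomes a function of m
    -- alone.
    c : ℕ → ℤ
    c m = cⱼ (z ℕ.∸ suc (lp z m)) m

    index : ℕ → ℕ
    index m = z ℕ.∸ suc (lp z m)

    index< : ∀ m → index m ℕ.< z
    index< m = ℕₚ.≤-<-trans (ℕₚ.∸-monoʳ-≤ z (ℕ.s≤s ℕ.z≤n)) (ℕₚ.∸-monoʳ-< {z} {1} {0} (ℕ.s≤s ℕ.z≤n) (ℕ.>-nonZero⁻¹ z))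

    c-supp : ∀ m → ¬ (c m ≡ 0ℤ) → D ℕ.≤ m × m ℕ.< D ℕ.* D
    c-supp m h = proj₁ S , proj₁ (proj₂ S)
      where S = cⱼ-supp (index m) (index< m) m h

    ∥c∥≤1 : ∀ m → ∥ c m ∥ ≤ 1ℤ
    ∥c∥≤1 m = subst (_≤ 1ℤ) (sym (∥∥-neg (ind (D ℕ.≤? m) * g (index m) m))) (scaled (D ℕ.≤? m))
      where
      scaled : ∀ {P : Set} (p : Dec P) → ∥ ind p * g (index m) m ∥ ≤ 1ℤ
      scaled (yes _) = subst (λ v → ∥ v ∥ ≤ 1ℤ) (sym (*-identityˡ (g (index m) m))) (∥gen∥≤1 (z ℕ.∸ suc (index m)) (lam (index m)) m (∥lam∥≤1 (index m) (ℕₚ.<⇒≤ (index< m))))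
      scaled (no _)  = 0≤+

    ∑-cⱼ : ∀ m (f : ℕ → ℤ) → ∑ z (λ j → cⱼ j m * f (z ℕ.∸ suc j)) ≡ c m * f (lp z m)
    ∑-cⱼ m f = trans (∑-only z _ (index< m) others) here
      where
      others : ∀ j → j ℕ.< z → ¬ (j ≡ index m) → cⱼ j m * f (z ℕ.∸ suc j) ≡ 0ℤ
      others j j<z j≢ with cⱼ j m ≟ 0ℤ
      ... | yes eq = trans (cong (_* f (z ℕ.∸ suc j)) eq) (*-zeroˡ (f (z ℕ.∸ suc j)))
      ... | no neq = ⊥-elim (j≢ (sym (trans (cong (λ v → z ℕ.∸ suc v) (proj₂ (proj₂ (cⱼ-supp j j<z m neq)))) (trans (cong (z ℕ.∸_) (sym (suc-thr j j<z))) (ℕₚ.m∸[m∸n]≡n (ℕₚ.<⇒≤ j<z))))))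
      here : cⱼ (index m) m * f (z ℕ.∸ suc (index m)) ≡ c m * f (lp z m)
      here with c m ≟ 0ℤ
      ... | yes eq = trans (cong (_* f (z ℕ.∸ suc (index m))) eq) (trans (*-zeroˡ (f (z ℕ.∸ suc (index m)))) (sym (trans (cong (_* f (lp z m)) eq) (*-zeroˡ (f (lp z m))))))
      ... | no neq = cong (λ v → c m * f v) (sym (proj₂ (proj₂ (cⱼ-supp (index m) (index< m) m neq))))

    module Identity (x : ℕ) (w : ℕ → ℤ) (w₀ : w 0 ≡ 0ℤ) where
      open Buchstab x w w₀

      -- A common range for the products yd < zD before truncation and for the m < D² that are
      -- passed on.
      X : ℕ
      X = D ℕ.* (z ℕ.+ D)

      D≤X : D ℕ.≤ X
      D≤X = ℕₚ.m≤m*n D (z ℕ.+ D) {{ℕ.>-nonZero (ℕₚ.<-≤-trans (ℕ.>-nonZero⁻¹ z) (ℕₚ.m≤m+n z D))}}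

      Main : ℕ → ℤ
      Main k = ∑ D (λ d → lam k d * S d (z ℕ.∸ k))

      lam-out : ∀ k → k ℕ.≤ z → ∀ d → D ℕ.≤ d → lam k d ≡ 0ℤ
      lam-out k k≤z d D≤d with lam k d ≟ 0ℤ
      ... | yes eq = eq
      ... | no neq = ⊥-elim (ℕₚ.<⇒≱ (proj₁ (proj₂ (lam-supp k k≤z d neq))) D≤d)

      step-¬prime : ∀ k → k ℕ.< z → ¬ Prime (z ℕ.∸ suc k) → Main k ≡ Main (suc k) + ∑ X (λ m → cⱼ k m * S m (z ℕ.∸ suc k))
      step-¬prime k k<z ¬p = sym (trans (cong₂ _+_ (∑-cong D (λ d → cong₂ _*_ (lam-same d) (trans (sym (S-¬prime d y ¬p)) (cong (S d) (sym (suc-thr k k<z))))))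
                      (∑-zero< X (λ m _ → trans (cong (λ v → - (ind (D ℕ.≤? m) * v) * S m y) (g≡0 m)) (lem₀ (ind (D ℕ.≤? m)) (S m y))))) (+-identityʳ _))
        where
        y = z ℕ.∸ suc k
        g≡0 : ∀ m → gen y (lam k) m ≡ 0ℤ
        g≡0 m = trans (cong (_* (ind (y ℕᵈ.∣? m) * lam k (quot m y))) (ind-no (prime? y) ¬p)) (*-zeroˡ (ind (y ℕᵈ.∣? m) * lam k (quot m y)))
        lem₀ : ∀ a b → - (a * 0ℤ) * b ≡ 0ℤ
        lem₀ = solve-∀
        lem₁ : ∀ a b → a - b * 0ℤ ≡ a
        lem₁ = solve-∀
        lam-same : ∀ d → lam (suc k) d ≡ lam k d
        lam-same d = trans (cong (λ v → lam k d - ind (d ℕ.<? D) * v) (g≡0 d)) (lem₁ (lam k d) (ind (d ℕ.<? D)))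

      step-prime : ∀ k → k ℕ.< z → Prime (z ℕ.∸ suc k) → Main k ≡ Main (suc k) + ∑ X (λ m → cⱼ k m * S m (z ℕ.∸ suc k))
      step-prime k k<z p = begin
        Main k
          ≡⟨ ∑-cong D (λ d → trans (cong (λ v → lam k d * S d v) (suc-thr k k<z)) (trans (cong (lam k d *_) (S-suc d)) (dist (lam k d) (S d y) (S (d ℕ.* y) y)))) ⟩
        ∑ D (λ d → lam k d * S d y - lam k d * S (d ℕ.* y) y)
          ≡⟨ ∑-- D _ _ ⟩
        ∑ D (λ d → lam k d * S d y) - ∑ D (λ d → lam k d * S (d ℕ.* y) y)
          ≡⟨ cong (_-_ (∑ D (λ d → lam k d * S d y))) (trans passed (trans (∑-cong X (λ m → sym (cut m))) (trans (∑-+ X _ _) (cong (_+ ∑ X (λ m → ind (D ℕ.≤? m) * g k m * S m y)) (∑-extend _ D≤X big))))) ⟩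
        ∑ D (λ d → lam k d * S d y) - (∑ D (λ m → ind (m ℕ.<? D) * g k m * S m y) + ∑ X (λ m → ind (D ℕ.≤? m) * g k m * S m y))
          ≡⟨ regroup (∑ D (λ d → lam k d * S d y)) _ _ ⟩
        (∑ D (λ d → lam k d * S d y) - ∑ D (λ m → ind (m ℕ.<? D) * g k m * S m y)) + - ∑ X (λ m → ind (D ℕ.≤? m) * g k m * S m y)
          ≡⟨ cong₂ _+_ (trans (sym (∑-- D _ _)) (∑-cong D (λ d → undist (lam k d) (ind (d ℕ.<? D) * g k d) (S d y)))) (trans (sym (∑-neg X _)) (∑-cong X (λ m → negˡ (ind (D ℕ.≤? m) * g k m) (S m y)))) ⟩
        Main (suc k) + ∑ X (λ m → cⱼ k m * S m y) ∎
        where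
        open ≡-Reasoning
        y = z ℕ.∸ suc k
        instance nz = prime⇒nonZero p
        dist : ∀ a b c → a * (b - c) ≡ a * b - a * c
        dist = solve-∀
        undist : ∀ a b c → a * c - b * c ≡ (a - b) * c
        undist = solve-∀
        negˡ : ∀ a b → - (a * b) ≡ - a * b
        negˡ = solve-∀
        regroup : ∀ a b c → a - (b + c) ≡ (a - b) + - c
        regroup = solve-∀
        cancel : ∀ a b → a ≡ a + b - b
        cancel = solve-∀
        S-suc : ∀ d → S d (suc y) ≡ S d y - S (d ℕ.* y) y
        S-suc d = trans (cancel (S d (suc y)) (S (d ℕ.* y) y)) (cong (_- S (d ℕ.* y) y) (sym (S-prime d y p)))
        big : ∀ m → D ℕ.≤ m → ind (m ℕ.<? D) * g k m * S m y ≡ 0ℤ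
        big m D≤m = trans (cong (λ v → v * g k m * S m y) (ind-no (m ℕ.<? D) (ℕₚ.≤⇒≯ D≤m))) (zz (g k m) (S m y))
          where
          zz : ∀ a b → 0ℤ * a * b ≡ 0ℤ
          zz = solve-∀
        cut : ∀ m → ind (m ℕ.<? D) * g k m * S m y + ind (D ℕ.≤? m) * g k m * S m y ≡ g k m * S m y
        cut m with m ℕ.<? D | D ℕ.≤? m
        ... | yes a | yes b = ⊥-elim (ℕₚ.<⇒≱ a b)
        ... | yes a | no  b = l₁ (g k m) (S m y)
          where
          l₁ : ∀ a b → 1ℤ * a * b + 0ℤ * a * b ≡ a * b
          l₁ = solve-∀
        ... | no  a | yes b = l₂ (g k m) (S m y)
          where
          l₂ : ∀ a b → 0ℤ * a * b + 1ℤ * a * b ≡ a * b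
          l₂ = solve-∀
        ... | no  a | no  b = ⊥-elim (b (ℕₚ.≮⇒≥ a))
        passed : ∑ D (λ d → lam k d * S (d ℕ.* y) y) ≡ ∑ X (λ m → g k m * S m y)
        passed = sym (begin
          ∑ X (λ m → g k m * S m y) ≡⟨ ∑-cong X (λ m → trans (cong (λ v → v * (ind (y ℕᵈ.∣? m) * lam k (quot m y)) * S m y) (ind-yes (prime? y) p)) (one (ind (y ℕᵈ.∣? m)) (lam k (quot m y)) (S m y))) ⟩
          ∑ X (λ m → ind (y ℕᵈ.∣? m) * (lam k (quot m y) * S m y)) ≡⟨ ∑-multiples X y (λ m → lam k (quot m y) * S m y) ⟩
          ∑ X (λ d → ind (y ℕ.* d ℕ.<? X) * (lam k (quot (y ℕ.* d) y) * S (y ℕ.* d) y)) ≡⟨ ∑-cong X (λ d → cong₂ (λ u v → ind (y ℕ.* d ℕ.<? X) * (lam k u * S v y)) (quot-* y d) (ℕₚ.*-comm y d)) ⟩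
          ∑ X (λ d → ind (y ℕ.* d ℕ.<? X) * (lam k d * S (d ℕ.* y) y)) ≡⟨ ∑-extend _ D≤X (λ d D≤d → trans (cong (λ v → ind (y ℕ.* d ℕ.<? X) * (v * S (d ℕ.* y) y)) (lam-out k (ℕₚ.<⇒≤ k<z) d D≤d)) (zero₂ (ind (y ℕ.* d ℕ.<? X)) (S (d ℕ.* y) y))) ⟩
          ∑ D (λ d → ind (y ℕ.* d ℕ.<? X) * (lam k d * S (d ℕ.* y) y)) ≡⟨ ∑-cong< D (λ d d<D → trans (cong (_* (lam k d * S (d ℕ.* y) y)) (ind-yes (y ℕ.* d ℕ.<? X) (in-range d d<D))) (*-identityˡ _)) ⟩
          ∑ D (λ d → lam k d * S (d ℕ.* y) y) ∎)
          where
          one : ∀ a b c → 1ℤ * (a * b) * c ≡ a * (b * c)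
          one = solve-∀
          zero₂ : ∀ a b → a * (0ℤ * b) ≡ 0ℤ
          zero₂ = solve-∀
          in-range : ∀ d → d ℕ.< D → y ℕ.* d ℕ.< X
          in-range d d<D = ℕₚ.≤-<-trans (ℕₚ.*-monoˡ-≤ d (ℕₚ.m∸n≤m z (suc k))) (ℕₚ.<-≤-trans (ℕₚ.*-monoʳ-< z d<D)
            (ℕₚ.≤-trans (ℕₚ.≤-reflexive (ℕₚ.*-comm z D)) (ℕₚ.*-monoʳ-≤ D (ℕₚ.m≤m+n z D))))

      step : ∀ k → k ℕ.< z → Main k ≡ Main (suc k) + ∑ X (λ m → cⱼ k m * S m (z ℕ.∸ suc k))
      step k k<z = decide (prime? (z ℕ.∸ suc k))
        where
        decide : Dec (Prime (z ℕ.∸ suc k)) → Main k ≡ Main (suc k) + ∑ X (λ m → cⱼ k m * S m (z ℕ.∸ suc k))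
        decide (yes p) = step-prime k k<z p
        decide (no ¬p) = step-¬prime k k<z ¬p

      iterate : ∀ k → k ℕ.≤ z → S 1 z ≡ Main k + ∑ k (λ j → ∑ X (λ m → cⱼ j m * S m (z ℕ.∸ suc j)))
      iterate zero k≤z = sym (trans (+-identityʳ _) (trans (∑-only D _ 1<D (λ d _ d≢1 → trans (cong (_* S d z) (ind-no (d ℕ.≟ 1) d≢1)) (*-zeroˡ (S d z)))) (*-identityˡ (S 1 z))))
      iterate (suc k) k<z = trans (iterate k (ℕₚ.<⇒≤ k<z)) (trans (cong (_+ ∑ k (λ j → ∑ X (λ m → cⱼ j m * S m (z ℕ.∸ suc j)))) (step k k<z)) (lem (Main (suc k)) _ _))
        where
        lem : ∀ a b c → a + b + c ≡ a + (c + b)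
        lem = solve-∀

      -- When the descent reaches y = 0, roughness is no condition any more, so the kept divisors
      -- carry unrestricted inner sums (type I). The m passed on lie between D and D² and keep a
      -- rough inner variable (type II).
      buchstab : S 1 z ≡ ∑ D (λ d → λ₀ d * S d 0) + ∑ (D ℕ.* D) (λ m → c m * S m (lp z m))
      buchstab = trans (iterate z ℕₚ.≤-refl) (cong₂ _+_ (∑-cong D (λ d → cong (λ v → lam z d * S d v) (ℕₚ.n∸n≡0 z)))
        (trans (∑-swap z X _) (trans (∑-cong X (λ m → ∑-cⱼ m (S m))) (∑-extend _ (ℕₚ.*-monoʳ-≤ D (ℕₚ.m≤n+m D z)) out))))
        where
        out : ∀ m → D ℕ.* D ℕ.≤ m → c m * S m (lp z m) ≡ 0ℤ
        out m h with c m ≟ 0ℤ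
        ... | yes eq = trans (cong (_* S m (lp z m)) eq) (*-zeroˡ (S m (lp z m)))
        ... | no neq = ⊥-elim (ℕₚ.<⇒≱ (proj₂ (c-supp m neq)) h)

-- Chebyshev's lower bound for the number of primes

module Chebyshev where

  open import Data.Nat
  open import Data.Nat.Properties
  open import Data.Nat.Divisibility
  open import Data.Nat.Coprimality using (Coprime)
  open import Data.Nat.Combinatorics using (_C_; nCn≡1; nC1≡n; nCk≡nC[n∸k]; nCk+nC[k+1]≡[n+1]C[k+1]; k>n⇒nCk≡0)
  open import Data.Nat.Primality using (Prime; prime?; prime⇒nonZero; prime⇒nonTrivial; ¬prime⇒composite; composite)
  open import Data.Nat.Tactic.RingSolver using (solve-∀)
  open import Data.Integer.Properties using (pos-+)
  open Sums using (∑)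
  open Congruence using (ind; coprime-∣*; coprime-*; coprime-sym; prime∤⇒coprime)

  nC0≡1 : ∀ n → n C 0 ≡ 1
  nC0≡1 n = trans (nCk≡nC[n∸k] {0} {n} z≤n) (nCn≡1 n)

  absorption : ∀ n k → suc k * (suc n C suc k) ≡ suc n * (n C k)
  absorption zero zero = refl
  absorption zero (suc k) = trans (cong (suc (suc k) *_) (k>n⇒nCk≡0 {1} {suc (suc k)} (s≤s (s≤s z≤n)))) (trans (*-zeroʳ (suc (suc k))) (sym (trans (*-identityˡ (0 C suc k)) (k>n⇒nCk≡0 {0} {suc k} (s≤s z≤n)))))
  absorption (suc n) zero = trans (*-identityˡ (suc (suc n) C 1)) (trans (nC1≡n (suc (suc n))) (sym (trans (cong (suc (suc n) *_) (nC0≡1 (suc n))) (*-identityʳ (suc (suc n))))))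
  absorption (suc n) (suc k) = begin
    suc (suc k) * (suc (suc n) C suc (suc k)) ≡⟨ cong (suc (suc k) *_) (sym (nCk+nC[k+1]≡[n+1]C[k+1] (suc n) (suc k))) ⟩
    suc (suc k) * (a + (suc n C suc (suc k))) ≡⟨ dist k a (suc n C suc (suc k)) ⟩
    suc k * a + suc (suc k) * (suc n C suc (suc k)) + a ≡⟨ cong₂ (λ u v → u + v + a) (absorption n k) (absorption n (suc k)) ⟩
    suc n * (n C k) + suc n * (n C suc k) + a ≡⟨ cong (_+ a) (trans (sym (*-distribˡ-+ (suc n) (n C k) (n C suc k))) (cong (suc n *_) (nCk+nC[k+1]≡[n+1]C[k+1] n k))) ⟩
    suc n * a + a ≡⟨ +-comm (suc n * a) a ⟩
    suc (suc n) * a ∎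
    where
    open ≡-Reasoning
    a = suc n C suc k
    dist : ∀ k a b → suc (suc k) * (a + b) ≡ suc k * a + suc (suc k) * b + a
    dist = solve-∀

  central≥ : ∀ n → 2 ^ n ≤ (n + n) C n
  central≥ zero = s≤s z≤n
  central≥ (suc n) = begin
    2 * 2 ^ n ≤⟨ *-monoʳ-≤ 2 (central≥ n) ⟩
    c + (c + 0) ≡⟨ cong (c +_) (+-identityʳ c) ⟩
    c + c ≤⟨ +-mono-≤ (left n) right ⟩
    (suc (n + n) C n) + (suc (n + n) C suc n) ≡⟨ nCk+nC[k+1]≡[n+1]C[k+1] (suc (n + n)) n ⟩
    suc (suc (n + n)) C suc n ≡⟨ cong (λ m → suc m C suc n) (sym (+-suc n n)) ⟩
    suc (n + suc n) C suc n ∎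
    where
    open ≤-Reasoning
    c = (n + n) C n
    right : c ≤ suc (n + n) C suc n
    right = ≤-trans (m≤m+n c ((n + n) C suc n)) (≤-reflexive (nCk+nC[k+1]≡[n+1]C[k+1] (n + n) n))
    left : ∀ n → (n + n) C n ≤ suc (n + n) C n
    left zero = ≤-refl
    left (suc n) = ≤-trans (m≤n+m _ ((suc n + suc n) C n)) (≤-reflexive (nCk+nC[k+1]≡[n+1]C[k+1] (suc n + suc n) n))

  -- Nair: 1/((n+1)C(N+1,n+1)) = 1/(nC(N,n)) - 1/(nC(N+1,n)), so a common multiple of 1..N clears these denominators.
  binomial∣ : ∀ M N → (∀ k → 1 ≤ k → k ≤ N → k ∣ M) → ∀ n N′ → suc n ≤ N′ → N′ ≤ N → suc n * (N′ C suc n) ∣ M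
  binomial∣ M N h zero N′ n≤N′ N′≤N = subst (_∣ M) (sym (trans (*-identityˡ (N′ C 1)) (nC1≡n N′))) (h N′ n≤N′ N′≤N)
  binomial∣ M N h (suc n) (suc N′) (s≤s n<N′) N′≤N with binomial∣ M N h n N′ n<N′ (<⇒≤ N′≤N) | binomial∣ M N h n (suc N′) (m≤n⇒m≤1+n n<N′) N′≤N
  ... | divides c eq | divides c′ eq′ = divides (c ∸ c′) (sym (begin
    (c ∸ c′) * (suc (suc n) * (suc N′ C suc (suc n)))  ≡⟨ cong ((c ∸ c′) *_) (absorption N′ (suc n)) ⟩
    (c ∸ c′) * (suc N′ * A) ≡⟨ move (c ∸ c′) (suc N′) A ⟩
    suc N′ * ((c ∸ c′) * A) ≡⟨ cong (suc N′ *_) gap ⟩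
    suc N′ * (c′ * B) ≡⟨ move (suc N′) c′ B ⟩
    c′ * (suc N′ * B) ≡⟨ cong (c′ *_) (sym (absorption N′ n)) ⟩
    c′ * (suc n * (suc N′ C suc n)) ≡⟨ sym eq′ ⟩
    M ∎))
    where
    open ≡-Reasoning
    A = N′ C suc n
    B = N′ C n
    move : ∀ a b c → a * (b * c) ≡ b * (a * c)
    move = solve-∀
    -- Both divisibilities are equations for M; dividing out `suc n` leaves two binomials related by
    -- Pascal's rule.
    same : c * A ≡ c′ * (B + A)
    same = *-cancelˡ-≡ (c * A) (c′ * (B + A)) (suc n) (trans (move (suc n) c A) (trans (sym eq) (trans eq′ (trans (cong (λ z → c′ * (suc n * z)) (sym (nCk+nC[k+1]≡[n+1]C[k+1] N′ n))) (move c′ (suc n) (B + A))))))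
    gap : (c ∸ c′) * A ≡ c′ * B
    gap = trans (*-distribʳ-∸ A c c′) (trans (cong (_∸ c′ * A) (trans same (*-distribˡ-+ c′ B A))) (m+n∸n≡m (c′ * B) (c′ * A)))

  prime-factor : ∀ b k → k ≤ b → 2 ≤ k → ∃[ p ] (Prime p × p ∣ k)
  prime-factor zero k k≤b 2≤k = ⊥-elim (n≮0 (<-≤-trans 2≤k k≤b))
  prime-factor (suc b) k k≤b 2≤k with prime? k
  ... | yes p = k , p , ∣-refl
  ... | no ¬p with ¬prime⇒composite {{n>1⇒nonTrivial 2≤k}} ¬p
  ... | composite {d} d<k d∣k with prime-factor b d (≤-pred (<-≤-trans d<k k≤b)) (nonTrivial⇒n>1 d)
  ... | p , pr , p∣d = p , pr , ∣-trans p∣d d∣k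

  extract : ∀ b k p → Prime p → k ≤ b → 1 ≤ k → ∃[ v ] ∃[ k′ ] (k ≡ p ^ v * k′ × ¬ (p ∣ k′) × 1 ≤ k′)
  extract zero k p pr k≤b 1≤k = ⊥-elim (n≮0 (<-≤-trans 1≤k k≤b))
  extract (suc b) k p pr k≤b 1≤k with p ∣? k
  ... | no p∤k = 0 , k , sym (*-identityˡ k) , p∤k , 1≤k
  ... | yes (divides q refl) with q
  ... | zero = ⊥-elim (n≮0 1≤k)
  ... | suc q′ with extract b (suc q′) p pr (≤-pred (<-≤-trans (m<m*n (suc q′) p (nonTrivial⇒n>1 p {{prime⇒nonTrivial pr}})) k≤b)) (s≤s z≤n)
  ... | v , k′ , eq , p∤k′ , 1≤k′ = suc v , k′ , trans (*-comm (suc q′) p) (trans (cong (p *_) eq) (sym (*-assoc p (p ^ v) k′))) , p∤k′ , 1≤k′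

  coprime-^ : ∀ {a p} v → Coprime a p → Coprime a (p ^ v)
  coprime-^ zero c (_ , d∣1) = ∣1⇒≡1 d∣1
  coprime-^ (suc v) c = coprime-* c (coprime-^ v c)

  ∣-from-prime-powers : ∀ b M k → k ≤ b → 1 ≤ k → (∀ p v → Prime p → p ^ v ∣ k → p ^ v ∣ M) → k ∣ M
  ∣-from-prime-powers zero M k k≤b 1≤k h = ⊥-elim (n≮0 (<-≤-trans 1≤k k≤b))
  ∣-from-prime-powers (suc b) M k k≤b 1≤k h with k ≟ 1
  ... | yes refl = 1∣ M
  ... | no k≢1 with prime-factor k k ≤-refl (≤∧≢⇒< 1≤k (λ x → k≢1 (sym x)))
  ... | p , pr , p∣k with extract k k p pr ≤-refl 1≤k
  ... | zero  , k′ , eq , p∤k′ , 1≤k′ = ⊥-elim (p∤k′ (subst (p ∣_) (trans eq (*-identityˡ k′)) p∣k))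
  ... | suc v , k′ , eq , p∤k′ , 1≤k′ = subst (_∣ M) (sym eq)
    (coprime-∣* (coprime-sym (coprime-^ (suc v) (prime∤⇒coprime pr p∤k′)))
      (h p (suc v) pr (subst (p ^ suc v ∣_) (sym eq) (m∣m*n k′)))
      (∣-from-prime-powers b M k′ (≤-pred (<-≤-trans k′<k k≤b)) 1≤k′ (λ q u qr q∣ → h q u qr (∣-trans q∣ (subst (k′ ∣_) (sym eq) (n∣m*n (p ^ suc v)))))))
    where
    instance nz = >-nonZero 1≤k′
    k′<k : k′ < k
    k′<k = subst (k′ <_) (trans (*-comm k′ (p ^ suc v)) (sym eq)) (m<m*n k′ (p ^ suc v) (<-≤-trans (nonTrivial⇒n>1 p {{prime⇒nonTrivial pr}}) (m≤m*n p (p ^ v) {{m^n≢0 p v {{prime⇒nonZero pr}}}})))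

  lg : ℕ → ℕ → ℕ → ℕ
  lg p N zero = 0
  lg p N (suc B) with p ^ suc B ≤? N
  ... | yes _ = suc B
  ... | no  _ = lg p N B

  ^-lg≤ : ∀ p N B → 1 ≤ N → p ^ lg p N B ≤ N
  ^-lg≤ p N zero 1≤N = 1≤N
  ^-lg≤ p N (suc B) 1≤N with p ^ suc B ≤? N
  ... | yes h = h
  ... | no  _ = ^-lg≤ p N B 1≤N

  ≤lg : ∀ p N B v → v ≤ B → p ^ v ≤ N → v ≤ lg p N B
  ≤lg p N zero v v≤B h = v≤B
  ≤lg p N (suc B) v v≤B h with p ^ suc B ≤? N
  ... | yes _ = v≤B
  ... | no ¬h = ≤lg p N B v (≤-pred (≤∧≢⇒< v≤B λ { refl → ¬h h })) h

  π : ℕ → ℕ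
  π zero = 0
  π (suc n) with prime? n
  ... | yes _ = suc (π n)
  ... | no  _ = π n

  π-∑ : ∀ n → ∑ n (λ i → ind (prime? i)) ≡ ℤ.+ π n
  π-∑ zero = refl
  π-∑ (suc n) with prime? n
  ... | yes _ = trans (cong (ℤ._+ ℤ.1ℤ) (π-∑ n)) (trans (sym (pos-+ (π n) 1)) (cong ℤ.+_ (+-comm (π n) 1)))
  ... | no  _ = trans (ℤₚ.+-identityʳ _) (π-∑ n)

  -- For n = N + 1 this is the least common multiple of 1, ..., N: each prime below n enters with
  -- its largest power not exceeding N.
  primePowers : ℕ → ℕ → ℕ
  primePowers N zero = 1
  primePowers N (suc n) with prime? n
  ... | yes _ = n ^ lg n N N * primePowers N n
  ... | no  _ = primePowers N n

  primePowers≤ : ∀ N n → 1 ≤ N → primePowers N n ≤ N ^ π n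
  primePowers≤ N zero 1≤N = ≤-refl
  primePowers≤ N (suc n) 1≤N with prime? n
  ... | yes _ = *-mono-≤ (^-lg≤ n N N 1≤N) (primePowers≤ N n 1≤N)
  ... | no  _ = primePowers≤ N n 1≤N

  ∣primePowers : ∀ N n p → Prime p → p < n → p ^ lg p N N ∣ primePowers N n
  ∣primePowers N (suc n) p pr p<n with p ≟ n | prime? n
  ... | yes refl | yes _ = m∣m*n (primePowers N n)
  ... | yes refl | no ¬p = ⊥-elim (¬p pr)
  ... | no p≢n | yes _ = ∣n⇒∣m*n (n ^ lg n N N) (∣primePowers N n p pr (≤∧≢⇒< (≤-pred p<n) p≢n))
  ... | no p≢n | no  _ = ∣primePowers N n p pr (≤∧≢⇒< (≤-pred p<n) p≢n)

  primePowers≢0 : ∀ N n → 1 ≤ primePowers N n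
  primePowers≢0 N zero = ≤-refl
  primePowers≢0 N (suc n) with prime? n
  ... | yes p = *-mono-≤ (>-nonZero⁻¹ (n ^ lg n N N) {{m^n≢0 n (lg n N N) {{prime⇒nonZero p}}}}) (primePowers≢0 N n)
  ... | no  _ = primePowers≢0 N n

  n<2^n : ∀ n → n < 2 ^ n
  n<2^n zero = s≤s z≤n
  n<2^n (suc n) = ≤-trans (+-mono-≤ (>-nonZero⁻¹ (2 ^ n) {{m^n≢0 2 n}}) (n<2^n n)) (≤-reflexive (cong (2 ^ n +_) (sym (+-identityʳ (2 ^ n)))))

  ^-monoʳ-∣ : ∀ p {v u} → v ≤ u → p ^ v ∣ p ^ u
  ^-monoʳ-∣ p {v} {u} v≤u = subst (p ^ v ∣_) (trans (sym (^-distribˡ-+-* p v (u ∸ v))) (cong (p ^_) (m+[n∸m]≡n v≤u))) (m∣m*n (p ^ (u ∸ v)))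

  k∣primePowers : ∀ N k → 1 ≤ k → k ≤ N → k ∣ primePowers N (suc N)
  k∣primePowers N k 1≤k k≤N = ∣-from-prime-powers k _ k ≤-refl 1≤k λ p v pr d → divide p v pr d
    where
    divide : ∀ p v → Prime p → p ^ v ∣ k → p ^ v ∣ primePowers N (suc N)
    divide p zero pr d = 1∣ _
    divide p (suc v) pr d = ∣-trans (^-monoʳ-∣ p (≤lg p N N (suc v) v≤N p^v≤N)) (∣primePowers N (suc N) p pr (s≤s p≤N))
      where
      p^v≤N : p ^ suc v ≤ N
      p^v≤N = ≤-trans (∣⇒≤ {{>-nonZero 1≤k}} d) k≤N
      v≤N : suc v ≤ N
      v≤N = ≤-trans (<⇒≤ (n<2^n (suc v))) (≤-trans (^-monoˡ-≤ (suc v) (nonTrivial⇒n>1 p {{prime⇒nonTrivial pr}})) p^v≤N)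
      p≤N : p ≤ N
      p≤N = ≤-trans (m≤m*n p (p ^ v) {{m^n≢0 p v {{prime⇒nonZero pr}}}}) p^v≤N

  -- With n = 2^j and N = 2n, one has 2^n ≤ C(N, n) ≤ n·C(N, n), and the last number divides lcm(1,
  -- ..., N) ≤ N^π. Since N is a power of 2, the outer terms are compared through their exponents.
  chebyshev : ∀ j → 2 ^ j ≤ suc j * π (suc (2 ^ suc j))
  chebyshev j = ≮⇒≥ λ h → <⇒≱ (^-monoʳ-< 2 (s≤s (s≤s z≤n)) h) 2^≤
    where
    n = 2 ^ j
    N = 2 ^ suc j
    M = primePowers N (suc N)
    n+n≡N : n + n ≡ N
    n+n≡N = cong (n +_) (sym (+-identityʳ n))
    instance
      nz = m^n≢0 2 j
      nzN = m^n≢0 2 (suc j)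
      nzM = >-nonZero (primePowers≢0 N (suc N))
    suc-pred-n : suc (pred n) ≡ n
    suc-pred-n = suc-pred n
    d : n * (N C n) ∣ M
    d = subst (λ z → z * (N C z) ∣ M) suc-pred-n (binomial∣ M N (k∣primePowers N) (pred n) N
      (≤-trans (≤-reflexive suc-pred-n) (≤-trans (m≤m+n n n) (≤-reflexive n+n≡N))) ≤-refl)
    2^≤ : 2 ^ (2 ^ j) ≤ 2 ^ (suc j * π (suc N))
    2^≤ = begin
      2 ^ n ≤⟨ central≥ n ⟩
      (n + n) C n ≡⟨ cong (_C n) n+n≡N ⟩
      N C n ≤⟨ m≤n*m (N C n) n ⟩
      n * (N C n) ≤⟨ ∣⇒≤ d ⟩
      M ≤⟨ primePowers≤ N (suc N) (>-nonZero⁻¹ N) ⟩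
      N ^ π (suc N) ≡⟨ ^-*-assoc 2 (suc j) (π (suc N)) ⟩
      2 ^ (suc j * π (suc N))  ∎
      where open ≤-Reasoning

-- Sums over triples of primes and the type I estimate

module Triples where

  open import Data.Nat.Coprimality using (Coprime)
  open import Data.Nat.Primality using (Prime; prime⇒nonZero)
  open import Data.Integer using (ℤ; +_; -_; _+_; _-_; _*_; _≤_; _<_; 0ℤ; 1ℤ; +≤+)
  open import Data.Integer.Properties using (≤-trans; ≤-reflexive; +-mono-≤; +-monoˡ-≤; +-identityˡ; *-zeroˡ; *-identityˡ; *-comm; *-assoc; pos-*; *-cancelʳ-≤-pos)
  open import Data.Integer.Divisibility.Signed using (_∣_; divides; ∣ᵤ⇒∣; ∣-trans)
  open import Data.Integer.Tactic.RingSolver using (solve-∀)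
  open Sums
  open Congruence
  open Averaging
  open Kernel using (distinct-primes-coprime; weight≤)

  record PrimeSet : Set₁ where
    field
      R : ℕ
      In : ℕ → Set
      in? : ∀ ℓ → Dec (In ℓ)
      prime : ∀ {ℓ} → In ℓ → Prime ℓ

    χ : ℕ → ℤ
    χ ℓ = ind (in? ℓ)

    card : ℤ
    card = ∑ R χ

  open PrimeSet

  0≤card : ∀ A → 0ℤ ≤ card A
  0≤card A = ∑-nonNeg (R A) (λ ℓ → 0≤ind (in? A ℓ))

  ∑∈ : PrimeSet → (ℕ → ℤ) → ℤ
  ∑∈ A f = ∑ (R A) (λ ℓ → χ A ℓ * f ℓ)

  syntax ∑∈ A (λ a → f) = ∑[ a ∈ A ] f

  ∑∈-mono : ∀ A {f g} → (∀ a → In A a → a ℕ.< R A → f a ≤ g a) → ∑∈ A f ≤ ∑∈ A g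
  ∑∈-mono A {f} {g} h = ∑-mono< (R A) term
    where
    term : ∀ a → a ℕ.< R A → χ A a * f a ≤ χ A a * g a
    term a a<R with in? A a
    ... | yes x = *-monoˡ {1ℤ} 0≤+ (h a x a<R)
    ... | no  _ = ≤-reflexive (trans (*-zeroˡ (f a)) (sym (*-zeroˡ (g a))))

  ∑∈-cong : ∀ A {f g} → (∀ a → In A a → a ℕ.< R A → f a ≡ g a) → ∑∈ A f ≡ ∑∈ A g
  ∑∈-cong A {f} {g} h = ∑-cong< (R A) term
    where
    term : ∀ a → a ℕ.< R A → χ A a * f a ≡ χ A a * g a
    term a a<R with in? A a
    ... | yes x = cong (1ℤ *_) (h a x a<R)
    ... | no  _ = trans (*-zeroˡ (f a)) (sym (*-zeroˡ (g a)))

  ∑∈-const : ∀ A v → ∑∈ A (λ _ → v) ≡ card A * v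
  ∑∈-const A v = ∑-*ʳ (R A) v (χ A)

  ∑∈-+ : ∀ A f g → ∑∈ A (λ a → f a + g a) ≡ ∑∈ A f + ∑∈ A g
  ∑∈-+ A f g = trans (∑-cong (R A) (λ a → lem (χ A a) (f a) (g a))) (∑-+ (R A) _ _)
    where
    lem : ∀ a b c → a * (b + c) ≡ a * b + a * c
    lem = solve-∀

  ∑∈-- : ∀ A f g → ∑∈ A (λ a → f a - g a) ≡ ∑∈ A f - ∑∈ A g
  ∑∈-- A f g = trans (∑-cong (R A) (λ a → lem (χ A a) (f a) (g a))) (∑-- (R A) _ _)
    where
    lem : ∀ a b c → a * (b - c) ≡ a * b - a * c
    lem = solve-∀

  ∑∈-*ˡ : ∀ A v f → ∑∈ A (λ a → v * f a) ≡ v * ∑∈ A f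
  ∑∈-*ˡ A v f = trans (∑-cong (R A) (λ a → lem (χ A a) v (f a))) (∑-*ˡ (R A) v _)
    where
    lem : ∀ a b c → a * (b * c) ≡ b * (a * c)
    lem = solve-∀

  ∑∈-∑ : ∀ A n (f : ℕ → ℕ → ℤ) → ∑ n (λ i → ∑∈ A (f i)) ≡ ∑∈ A (λ a → ∑ n (λ i → f i a))
  ∑∈-∑ A n f = trans (∑-swap n (R A) _) (∑-cong (R A) (λ a → ∑-*ˡ n (χ A a) _))

  ∑∈-swap : ∀ A B (f : ℕ → ℕ → ℤ) → ∑∈ A (λ a → ∑∈ B (f a)) ≡ ∑∈ B (λ b → ∑∈ A (λ a → f a b))
  ∑∈-swap A B f = trans (∑-cong (R A) (λ a → sym (∑∈-*ˡ B (χ A a) (f a)))) (∑∈-∑ B (R A) (λ a b → χ A a * f a b))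

  ∑∈-bound : ∀ A {f} Z → (∀ a → In A a → a ℕ.< R A → ∥ f a ∥ ≤ Z) → ∥ ∑∈ A f ∥ ≤ card A * Z
  ∑∈-bound A {f} Z h = ≤-trans (∑-∥∥ (R A) _) (≤-trans (≤-reflexive (∑-cong (R A) (λ a → trans (∥∥-* (χ A a) (f a)) (cong (_* ∥ f a ∥) (∥∥-nonNeg (0≤ind (in? A a)))))))
    (≤-trans (∑∈-mono A h) (≤-reflexive (∑∈-const A Z))))

  ∑∈-nonNeg : ∀ A {f} → (∀ a → 0ℤ ≤ f a) → 0ℤ ≤ ∑∈ A f
  ∑∈-nonNeg A h = ∑-nonNeg (R A) (λ a → 0≤* (0≤ind (in? A a)) (h a))

  ∑∈-pos : ∀ A f → 0ℤ < ∑∈ A f → ∃[ a ] (In A a × a ℕ.< R A × 0ℤ < f a)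
  ∑∈-pos A f h with ∑-pos⇒∃ (R A) _ h
  ... | a , a<R , pos with in? A a
  ... | yes x = a , x , a<R , subst (0ℤ <_) (*-identityˡ (f a)) pos
  ... | no  _ = ⊥-elim (ℤₚ.<-irrefl (sym (*-zeroˡ (f a))) pos)

  Disjoint : PrimeSet → PrimeSet → Set
  Disjoint A B = ∀ {a b} → In A a → In B b → ¬ (a ≡ b)

  eee ooo f₃ : ℕ → ℕ → ℕ → ℤ → ℤ
  eee a b c u = e a u * e b u * e c u
  ooo a b c u = O a u * O b u * O c u
  f₃ a b c u  = eee a b c u - ooo a b c u

  -- The first term has `d c` against both other `e` and so carries the full modulus. In the later
  -- terms factors `e` have given way to factors `O`, which are multiplicative and can move into the
  -- coefficients.
  telescope : ∀ a b c u → f₃ a b c u ≡ e a u * e b u * d c u + O c u * (e a u * d b u) + O b u * O c u * d a u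
  telescope a b c u = lem (e a u) (e b u) (e c u) (O a u) (O b u) (O c u)
    where
    lem : ∀ ea eb ec oa ob oc → ea * eb * ec - oa * ob * oc ≡ ea * eb * (ec - oc) + oc * (ea * (eb - ob)) + ob * oc * (ea - oa)
    lem = solve-∀

  f₃-swap : ∀ a b c u → f₃ a b c u ≡ f₃ a c b u
  f₃-swap a b c u = cong₂ _-_ (lem (e a u) (e b u) (e c u)) (lem (O a u) (O b u) (O c u))
    where
    lem : ∀ x y z → x * y * z ≡ x * z * y
    lem = solve-∀

  𝒲 : PrimeSet → PrimeSet → PrimeSet → ℤ → ℤ
  𝒲 A B C u = ∑[ a ∈ A ] ∑[ b ∈ B ] ∑[ c ∈ C ] f₃ a b c u

  -- Lets the term of full modulus carry `d b` in place of `d c`, as is needed when both variables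
  -- of the bilinear form are near √x.
  𝒲-swap : ∀ A B C u → 𝒲 A B C u ≡ 𝒲 A C B u
  𝒲-swap A B C u = ∑∈-cong A (λ a _ _ → trans (∑∈-swap B C (λ b c → f₃ a b c u)) (∑∈-cong C (λ c _ _ → ∑∈-cong B (λ b _ _ → f₃-swap a b c u))))

  sq : ℕ → ℕ
  sq n = n ℕ.* n

  prime-sq-coprime : ∀ {p q} → Prime p → Prime q → ¬ (p ≡ q) → Coprime (sq p) q
  prime-sq-coprime pp pq p≢q = coprime-sym (coprime-* c c)
    where c = coprime-sym (distinct-primes-coprime pp pq p≢q)

  sq-coprime-sq : ∀ {p q} → Prime p → Prime q → ¬ (p ≡ q) → Coprime (sq p) (sq q)
  sq-coprime-sq pp pq p≢q = coprime-* c c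
    where c = prime-sq-coprime pp pq p≢q

  0≤e : ∀ ℓ u → 0ℤ ≤ e ℓ u
  0≤e ℓ u = 0≤* {+ weight ℓ} 0≤+ (0≤E (sq ℓ) u)

  0≤eee : ∀ a b c u → 0ℤ ≤ eee a b c u
  0≤eee a b c u = 0≤* (0≤* (0≤e a u) (0≤e b u)) (0≤e c u)

  0≤ooo : ∀ a b c u → 0ℤ ≤ ooo a b c u
  0≤ooo a b c u = 0≤* (0≤* (0≤O a u) (0≤O b u)) (0≤O c u)

  ooo≤1 : ∀ a b c u → ooo a b c u ≤ 1ℤ
  ooo≤1 a b c u = *-mono {O a u * O b u} {1ℤ} (0≤* (0≤O a u) (0≤O b u)) 0≤+ (*-mono {O a u} {1ℤ} (0≤O a u) 0≤+ (O≤1 a u) (O≤1 b u)) (O≤1 c u)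

  module Triple {a b c : ℕ} (pa : Prime a) (pb : Prime b) (pc : Prime c) (a≢b : ¬ (a ≡ b)) (a≢c : ¬ (a ≡ c)) (b≢c : ¬ (b ≡ c)) where

    P : ℕ
    P = sq a ℕ.* sq b ℕ.* sq c

    w₃ : ℕ
    w₃ = weight a ℕ.* weight b ℕ.* weight c

    instance
      nza = prime⇒nonZero pa
      nzb = prime⇒nonZero pb
      nzc = prime⇒nonZero pc
      nza² = ℕₚ.m*n≢0 a a
      nzb² = ℕₚ.m*n≢0 b b
      nzc² = ℕₚ.m*n≢0 c c
      nzab = ℕₚ.m*n≢0 (sq a) (sq b)
      nzP = ℕₚ.m*n≢0 (sq a ℕ.* sq b) (sq c)

    w₃≤P : w₃ ℕ.≤ P
    w₃≤P = ℕₚ.*-mono-≤ (ℕₚ.*-mono-≤ (weight≤ a) (weight≤ b)) (weight≤ c)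

    eee≡ : ∀ u → eee a b c u ≡ + w₃ * E P u
    eee≡ u = trans (lem (+ weight a) (E (sq a) u) (+ weight b) (E (sq b) u) (+ weight c) (E (sq c) u))
      (cong₂ _*_ (sym (trans (pos-* (weight a ℕ.* weight b) (weight c)) (cong (_* + weight c) (pos-* (weight a) (weight b)))))
        (trans (cong (_* E (sq c) u) ([∣]-crt (sq-coprime-sq pa pb a≢b) (u - 1ℤ)))
          ([∣]-crt (coprime-sym (coprime-* (sq-coprime-sq pc pa (λ x → a≢c (sym x))) (sq-coprime-sq pc pb (λ x → b≢c (sym x))))) (u - 1ℤ))))
      where
      lem : ∀ p x q y r z → p * x * (q * y) * (r * z) ≡ p * q * r * (x * y * z)
      lem = solve-∀

    ∑-eee : ∀ m n → ∑ P (λ i → eee a b c (m * (n + + i))) ≤ + w₃ * + 2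
    ∑-eee m n = ≤-trans (≤-reflexive (trans (∑-cong P (λ i → eee≡ (m * (n + + i)))) (∑-*ˡ P (+ w₃) _)))
      (*-monoˡ {+ w₃} 0≤+ (*-cancelʳ-≤-pos _ (+ 2) (+ P) {{ℤ.positive (Data.Integer.+<+ (ℕ.>-nonZero⁻¹ P))}}
        (≤-trans (∑-E P P m n) (≤-reflexive (lem (+ P))))))
      where
      lem : ∀ p → p + p ≡ + 2 * p
      lem = solve-∀

    periodic : ∀ (g : ℤ → ℤ) q m → (∀ u v → + q ∣ u - v → g u ≡ g v) → ∀ n → g (m * (n + + q)) ≡ g (m * n)
    periodic g q m per n = per (m * (n + + q)) (m * n) (divides m (lem m n (+ q)))
      where
      lem : ∀ m n a → m * (n + a) - m * n ≡ m * a
      lem = solve-∀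

    ∣-weaken : ∀ {p q u} → p ℕᵈ.∣ q → + q ∣ u → + p ∣ u
    ∣-weaken p∣q q∣u = ∣-trans (∣ᵤ⇒∣ p∣q) q∣u

    e-cong : ∀ ℓ u v → + sq ℓ ∣ u - v → e ℓ u ≡ e ℓ v
    e-cong ℓ u v h = cong (+ weight ℓ *_) (E-cong (sq ℓ) u v h)

    -- In each telescoped term two primes give a periodic factor, and `d` at the third has vanishing
    -- sums along steps of that period.
    vanishes : ∀ m → VanishesOver P (λ v → f₃ a b c (m * v))
    vanishes m n = trans (∑-cong P (λ u → telescope a b c (m * (n + + u)))) (trans (∑-+ P _ _) (trans (cong₂ _+_ (∑-+ P _ _) refl)
      (cong₂ _+_ (cong₂ _+_ (over g₁ P₁≡ t₁) (trans (∑-cong P (λ u → assoc (O c (m * (n + + u))) (e a (m * (n + + u))) (d b (m * (n + + u))))) (over g₂ P₂≡ t₂))) (over g₃ P₃≡ t₃))))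
      where
      g₁ g₂ g₃ : ℤ → ℤ
      g₁ v = e a (m * v) * e b (m * v) * d c (m * v)
      g₂ v = O c (m * v) * e a (m * v) * d b (m * v)
      g₃ v = O b (m * v) * O c (m * v) * d a (m * v)
      over : ∀ {M} (g : ℤ → ℤ) → M ≡ P → VanishesOver M g → ∑ P (λ u → g (n + + u)) ≡ 0ℤ
      over g refl van = van n
      assoc : ∀ x y z → x * (y * z) ≡ x * y * z
      assoc = solve-∀
      P₁≡ : sq c ℕ.* (sq a ℕ.* sq b) ≡ P
      P₁≡ = ℕₚ.*-comm (sq c) (sq a ℕ.* sq b)
      P₂≡ : sq b ℕ.* (sq a ℕ.* sq c) ≡ P
      P₂≡ = lem (sq a) (sq b) (sq c)
        where
        lem : ∀ x y z → y ℕ.* (x ℕ.* z) ≡ x ℕ.* y ℕ.* z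
        lem = ℕˢ.solve-∀
      P₃≡ : sq a ℕ.* (sq b ℕ.* sq c) ≡ P
      P₃≡ = sym (ℕₚ.*-assoc (sq a) (sq b) (sq c))
      t₁ : VanishesOver (sq c ℕ.* (sq a ℕ.* sq b)) g₁
      t₁ = vanishes-* (sq a ℕ.* sq b) (sq c) (λ v → e a (m * v) * e b (m * v)) (λ v → d c (m * v))
        (periodic (λ u → e a u * e b u) (sq a ℕ.* sq b) m (λ u v h → cong₂ _*_ (e-cong a u v (∣-weaken (ℕᵈ.m∣m*n (sq b)) h)) (e-cong b u v (∣-weaken (ℕᵈ.n∣m*n (sq a)) h))))
        (λ n → ∑-d-fibre pc m n (sq a ℕ.* sq b) (coprime-sym (coprime-* (coprime-sym (prime-sq-coprime pa pc a≢c)) (coprime-sym (prime-sq-coprime pb pc b≢c)))))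
      t₂ : VanishesOver (sq b ℕ.* (sq a ℕ.* sq c)) g₂
      t₂ = vanishes-* (sq a ℕ.* sq c) (sq b) (λ v → O c (m * v) * e a (m * v)) (λ v → d b (m * v))
        (periodic (λ u → O c u * e a u) (sq a ℕ.* sq c) m (λ u v h → cong₂ _*_ (O-cong c u v (∣-weaken (ℕᵈ.∣-trans (ℕᵈ.m∣m*n c) (ℕᵈ.n∣m*n (sq a))) h)) (e-cong a u v (∣-weaken (ℕᵈ.m∣m*n (sq c)) h))))
        (λ n → ∑-d-fibre pb m n (sq a ℕ.* sq c) (coprime-sym (coprime-* (coprime-sym (prime-sq-coprime pa pb a≢b)) (coprime-sym (prime-sq-coprime pc pb (λ x → b≢c (sym x)))))))
      t₃ : VanishesOver (sq a ℕ.* (sq b ℕ.* sq c)) g₃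
      t₃ = vanishes-* (sq b ℕ.* sq c) (sq a) (λ v → O b (m * v) * O c (m * v)) (λ v → d a (m * v))
        (periodic (λ u → O b u * O c u) (sq b ℕ.* sq c) m (λ u v h → cong₂ _*_ (O-cong b u v (∣-weaken (ℕᵈ.∣-trans (ℕᵈ.m∣m*n b) (ℕᵈ.m∣m*n (sq c))) h)) (O-cong c u v (∣-weaken (ℕᵈ.∣-trans (ℕᵈ.m∣m*n c) (ℕᵈ.n∣m*n (sq b))) h))))
        (λ n → ∑-d-fibre pa m n (sq b ℕ.* sq c) (coprime-sym (coprime-* (coprime-sym (prime-sq-coprime pb pa (λ x → a≢b (sym x)))) (coprime-sym (prime-sq-coprime pc pa (λ x → a≢c (sym x)))))))

    -- At single points `f₃` can be of the order of P, but over a period `eee + ooo` sums to at most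
    -- 2P + P, and such a period majorises what remains after whole periods are removed.
    typeI : ∀ m N → ∥ ∑ N (λ n → f₃ a b c (m * + n)) ∥ ≤ + (3 ℕ.* P)
    typeI m N = subst (λ v → ∥ v ∥ ≤ + (3 ℕ.* P)) (∑-cong N (λ n → cong (λ v → f₃ a b c (m * v)) (+-identityˡ (+ n))))
      (≤-trans (vanishes-partial P (λ v → f₃ a b c (m * v)) (vanishes m) majorant
                 (λ v → ≤-trans (∥∥-- (eee a b c (m * v)) (ooo a b c (m * v))) (≤-reflexive (cong₂ _+_ (∥∥-nonNeg (0≤eee a b c (m * v))) (∥∥-nonNeg (0≤ooo a b c (m * v))))))
                 (λ v → 0≤+-+ (0≤eee a b c (m * v)) (0≤ooo a b c (m * v))) N 0ℤ)
        (≤-trans (≤-reflexive (∑-+ P _ _)) (≤-trans (+-mono-≤ (∑-eee m (0ℤ + + (N ℕᵐ./ P ℕ.* P))) (∑-≤-const P 1ℤ (λ i → ooo≤1 a b c (m * (0ℤ + + (N ℕᵐ./ P ℕ.* P) + + i)))))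
          (≤-trans (+-monoˡ-≤ (+ P * 1ℤ) (*-monoʳ {+ 2} 0≤+ (+≤+ w₃≤P))) (≤-reflexive (trans (lem (+ P)) (sym (pos-* 3 P))))))))
      where
      majorant : ℤ → ℤ
      majorant v = eee a b c (m * v) + ooo a b c (m * v)
      lem : ∀ p → p * + 2 + p * 1ℤ ≡ + 3 * p
      lem = solve-∀

-- Type II estimates for the telescoped kernel

module TypeII where

  open import Data.Nat.Coprimality using (Coprime; 1-coprimeTo)
  open import Data.Nat.Primality using (Prime; prime⇒nonZero)
  open import Data.Integer using (ℤ; +_; -_; _+_; _-_; _*_; _≤_; _<_; 0ℤ; 1ℤ; +≤+)
  open import Data.Integer.Properties using (≤-refl; ≤-trans; ≤-reflexive; +-mono-≤; +-monoʳ-≤; +-monoˡ-≤; *-identityˡ; *-identityʳ; *-comm; pos-*)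
  open import Data.Integer.Divisibility.Signed using (_∣?_; ∣ᵤ⇒∣)
  open import Data.Integer.Tactic.RingSolver using (solve-∀)
  open Sums
  open Congruence
  open Bilinear
  open Kernel
  open Triples
  open PrimeSet

  record Good (K L : ℕ) (C : ℕ → ℕ → ℤ) (Z : ℤ) : Set where
    constructor mkGood
    field good : ∀ α β → (∀ m → ∥ α m ∥ ≤ 1ℤ) → (∀ n → ∥ β n ∥ ≤ 1ℤ) → ∥ form K L C α β ∥ ≤ Z
  open Good public

  unit-sq≤1 : ∀ i → ∥ i ∥ ≤ 1ℤ → i * i ≤ 1ℤ
  unit-sq≤1 i h = subst (_≤ 1ℤ) (∥∥-sq i) (*-mono {∥ i ∥} {1ℤ} 0≤+ 0≤+ h h)

  unit-norm : ∀ α N → (∀ m → ∥ α m ∥ ≤ 1ℤ) → ‖ α ‖² N ≤ + N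
  unit-norm α N h = subst (‖ α ‖² N ≤_) (*-identityʳ (+ N)) (∑-≤-const N 1ℤ (λ m → unit-sq≤1 (α m) (h m)))

  normBound⇒good : ∀ {K L C B Z} → 0ℤ ≤ B → 0ℤ ≤ Z → B * (+ K * + L) ≤ Z * Z → NormBound K L C B → Good K L C Z
  good (normBound⇒good {K} {L} {C} {B} 0≤B 0≤Z h N) α β α≤ β≤ = sq-≤⇒∥∥≤ {form K L C α β} 0≤Z
    (≤-trans (NormBound.at N α β) (≤-trans (*-monoˡ 0≤B (*-mono (0≤‖‖² α K) 0≤+ (unit-norm α K α≤) (unit-norm β L β≤))) h))

  good-cong : ∀ {K L C C′ Z} → (∀ m n → C m n ≡ C′ m n) → Good K L C Z → Good K L C′ Z
  good (good-cong {K} {L} {Z = Z} eq g) α β a b = subst (λ v → ∥ v ∥ ≤ Z) (form-cong K L α β eq) (good g α β a b)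

  good-+ : ∀ {K L C C′ Z Z′} → Good K L C Z → Good K L C′ Z′ → Good K L (λ m n → C m n + C′ m n) (Z + Z′)
  good (good-+ {K} {L} {C} {C′} {Z} {Z′} g g′) α β a b = subst (λ v → ∥ v ∥ ≤ Z + Z′) (sym (form-+ K L C C′ α β))
    (≤-trans (∥∥-+ (form K L C α β) (form K L C′ α β)) (+-mono-≤ (good g α β a b) (good g′ α β a b)))

  good-∑∈ : ∀ {K L Z} A (C : ℕ → ℕ → ℕ → ℤ) → (∀ a → In A a → a ℕ.< R A → Good K L (C a) Z) → Good K L (λ m n → ∑[ a ∈ A ] C a m n) (card A * Z)
  good (good-∑∈ {K} {L} {Z} A C g) α β u v = subst (λ z → ∥ z ∥ ≤ card A * Z) (sym eq) (∑∈-bound A Z (λ a x a<R → good (g a x a<R) α β u v))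
    where
    eq : form K L (λ m n → ∑[ a ∈ A ] C a m n) α β ≡ ∑[ a ∈ A ] form K L (C a) α β
    eq = trans (∑-cong K (λ m → trans (∑-cong L (λ n → sym (∑∈-*ˡ A (α m * β n) _))) (∑∈-∑ A L _))) (∑∈-∑ A K _)

  -- A factor θ whose insertion multiplies any squared norm bound by at most J; it will carry the
  -- conditions m n < x and roughness.
  record Mask (K L : ℕ) (θ : ℕ → ℕ → ℤ) (J : ℕ) : Set where
    field mask : ∀ {C B} → 0ℤ ≤ B → NormBound K L C B → NormBound K L (λ m n → θ m n * C m n) (+ J * B)
  open Mask public

  -- `bnd` and `tail` are the bound and the hypothesis of `normBound-kernel` with Q as a free
  -- argument, so that one upper bound for Q serves all choices of the fixed primes.
  bnd : ℕ → ℕ → ℕ → ℕ → ℕ → ℕ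
  bnd k R Q Y N = suc k ℕ.^ k ℕ.* (R ℕ.* (2 ℕ.* (Y ℕ.+ Q) ℕ.* (2 ℕ.* (N ℕ.+ Q))) ℕ.+ 1)

  tail : ℕ → ℕ → ℕ → ℕ → ℕ
  tail k R Q N = R ℕ.* R ℕ.* ((Q ℕ.* (R ℕ.* R)) ℕ.^ suc k ℕ.* (N ℕ.* (2 ℕ.* (1 ℕ.+ Q) ℕ.* (2 ℕ.* (1 ℕ.+ Q)))))

  bnd-mono : ∀ k R {Q Q′} Y N → Q ℕ.≤ Q′ → bnd k R Q Y N ℕ.≤ bnd k R Q′ Y N
  bnd-mono k R Y N h = ℕₚ.*-monoʳ-≤ (suc k ℕ.^ k) (ℕₚ.+-monoˡ-≤ 1 (ℕₚ.*-monoʳ-≤ R (ℕₚ.*-mono-≤ (ℕₚ.*-monoʳ-≤ 2 (ℕₚ.+-monoʳ-≤ Y h)) (ℕₚ.*-monoʳ-≤ 2 (ℕₚ.+-monoʳ-≤ N h)))))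

  tail-mono : ∀ k R {Q Q′} N → Q ℕ.≤ Q′ → tail k R Q N ℕ.≤ tail k R Q′ N
  tail-mono k R N h = ℕₚ.*-monoʳ-≤ (R ℕ.* R) (ℕₚ.*-mono-≤ (ℕₚ.^-monoˡ-≤ (suc k) (ℕₚ.*-monoˡ-≤ (R ℕ.* R) h))
    (ℕₚ.*-monoʳ-≤ N (ℕₚ.*-mono-≤ (ℕₚ.*-monoʳ-≤ 2 (ℕₚ.+-monoʳ-≤ 1 h)) (ℕₚ.*-monoʳ-≤ 2 (ℕₚ.+-monoʳ-≤ 1 h)))))

  -- What is needed for Cauchy over the variable of length N′: V bounds that length, `negligible`
  -- disposes of the off-diagonal pairs, and `small` compares the resulting bound, for coefficients
  -- of size at most 1, with Z².
  record Cond (J N N′ Q R : ℕ) (Z : ℤ) : Set where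
    field
      k V : ℕ
      V≢0 : ℕ.NonZero V
      N′≤V : N′ ℕ.≤ V
      negligible : tail k R Q N ℕ.≤ (suc k ℕ.* V) ℕ.^ k
      small : + (J ℕ.* bnd k R Q (suc k ℕ.* V) N ℕ.* (N ℕ.* N′)) ≤ Z * Z

  Cond± : (J K L Q R : ℕ) (Z : ℤ) → Set
  Cond± J K L Q R Z = Cond J K L Q R Z ⊎ Cond J L K Q R Z

  module FamilyGood (G w R : ℕ) .{{_ : ℕ.NonZero G}} (w≤G : w ℕ.≤ G)
    {𝓛 : ℕ → Set} (𝓛? : ∀ ℓ → Dec (𝓛 ℓ)) (𝓛-prime : ∀ {ℓ} → 𝓛 ℓ → Prime ℓ) (𝓛-coprime : ∀ {ℓ} → 𝓛 ℓ → Coprime G ℓ) where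

    open Family G w R w≤G 𝓛? 𝓛-prime 𝓛-coprime

    normBound± : ∀ {J K L Q′ Z} → Q ℕ.≤ Q′ → Cond± J K L Q′ R Z →
      ∃[ B ] (NormBound K L (λ m n → kernel (+ m * + n)) (+ B) × + J * + B * (+ K * + L) ≤ Z * Z)
    normBound± {J} {K} {L} {Q′} {Z} Q≤Q′ (inj₁ cond) = bnd k R Q (suc k ℕ.* V) K ,
      normBound-kernel k V {{V≢0}} K L N′≤V (ℕₚ.≤-trans (tail-mono k R K Q≤Q′) negligible) ,
      ≤-trans (≤-reflexive (trans (cong₂ _*_ (sym (pos-* J _)) (sym (pos-* K L))) (sym (pos-* (J ℕ.* bnd k R Q (suc k ℕ.* V) K) (K ℕ.* L)))))
        (≤-trans (+≤+ (ℕₚ.*-monoˡ-≤ (K ℕ.* L) (ℕₚ.*-monoʳ-≤ J (bnd-mono k R (suc k ℕ.* V) K Q≤Q′)))) small)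
      where open Cond cond
    normBound± {J} {K} {L} {Q′} {Z} Q≤Q′ (inj₂ cond) with normBound± {J} {L} {K} {Q′} {Z} Q≤Q′ (inj₁ cond)
    ... | B , N , h = B , normBound-cong (λ m n → cong kernel (*-comm (+ n) (+ m))) (normBound-transpose N) , subst (λ v → + J * + B * v ≤ Z * Z) (*-comm (+ L) (+ K)) h

    familyGood : ∀ {J K L Q′ Z θ} (s₁ s₂ : ℕ → ℤ) → (∀ m → s₁ m * s₁ m ≤ 1ℤ) → (∀ n → s₂ n * s₂ n ≤ 1ℤ) → 0ℤ ≤ Z → Q ℕ.≤ Q′ →
      Cond± J K L Q′ R Z → Mask K L θ J → Good K L (λ m n → θ m n * (s₁ m * s₂ n * kernel (+ m * + n))) Z
    familyGood {J} {Z = Z} s₁ s₂ h₁ h₂ 0≤Z Q≤Q′ cond M with normBound± {Z = Z} Q≤Q′ cond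
    ... | B , N , small = normBound⇒good (0≤* {+ J} {+ B} 0≤+ 0≤+) 0≤Z small (mask M 0≤+ (normBound-scale s₁ s₂ h₁ h₂ 0≤+ N))

  O-unit : ∀ ℓ u → O ℓ u * O ℓ u ≤ 1ℤ
  O-unit ℓ u = *-mono {O ℓ u} {1ℤ} (0≤O ℓ u) 0≤+ (O≤1 ℓ u) (O≤1 ℓ u)

  -- ζ is the error allowed per triple (a, b, c). In each telescoped term the prime carrying `d` is
  -- summed inside Cauchy's inequality, so its whole sum may reach the cardinality times ζ; the
  -- other two primes are summed trivially.
  module Block (A B C : PrimeSet) (A#B : Disjoint A B) (A#C : Disjoint A C) (B#C : Disjoint B C)
    {J K L : ℕ} {θ : ℕ → ℕ → ℤ} (M : Mask K L θ J) (ζ : ℤ) (0≤ζ : 0ℤ ≤ ζ)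
    (cond₁ : Cond± J K L (sq (R A) ℕ.* sq (R B) ℕ.* sq (R C)) (R C) (card C * ζ))
    (cond₂ : Cond± J K L (sq (R A) ℕ.* sq (R B)) (R B) (card B * ζ))
    (cond₃ : Cond± J K L (1 ℕ.* sq (R A)) (R A) (card A * ζ)) where

    sq-mono : ∀ {m n} → m ℕ.< n → sq m ℕ.≤ sq n
    sq-mono h = ℕₚ.*-mono-≤ (ℕₚ.<⇒≤ h) (ℕₚ.<⇒≤ h)

    W₁ W₂ W₃ : ℤ → ℤ
    W₁ u = ∑[ a ∈ A ] ∑[ b ∈ B ] ∑[ c ∈ C ] (e a u * e b u * d c u)
    W₂ u = ∑[ a ∈ A ] ∑[ c ∈ C ] ∑[ b ∈ B ] (O c u * (e a u * d b u))
    W₃ u = ∑[ b ∈ B ] ∑[ c ∈ C ] ∑[ a ∈ A ] (O b u * O c u * d a u)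

    𝒲≡ : ∀ u → 𝒲 A B C u ≡ W₁ u + W₂ u + W₃ u
    𝒲≡ u = begin
      𝒲 A B C u ≡⟨ ∑∈-cong A (λ a _ _ → trans (∑∈-cong B (λ b _ _ → trans (∑∈-cong C (λ c _ _ → telescope a b c u)) (trans (∑∈-+ C _ _) (cong (_+ (∑[ c ∈ C ] t₃ a b c)) (∑∈-+ C _ _)))))
                      (trans (∑∈-+ B _ _) (cong (_+ (∑[ b ∈ B ] ∑[ c ∈ C ] t₃ a b c)) (∑∈-+ B _ _)))) ⟩
      ∑[ a ∈ A ] (S₁ a + S₂ a + S₃ a) ≡⟨ trans (∑∈-+ A _ _) (cong (_+ ∑∈ A S₃) (∑∈-+ A S₁ S₂)) ⟩
      ∑∈ A S₁ + ∑∈ A S₂ + ∑∈ A S₃ ≡⟨ cong₂ _+_ (cong (_+_ (∑∈ A S₁)) (∑∈-cong A (λ a _ _ → ∑∈-swap B C (t₂ a)))) (trans (∑∈-swap A B _) (∑∈-cong B (λ b _ _ → ∑∈-swap A C (λ a c → t₃ a b c)))) ⟩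
      W₁ u + W₂ u + W₃ u ∎
      where
      open ≡-Reasoning
      t₁ t₂ t₃ : ℕ → ℕ → ℕ → ℤ
      t₁ a b c = e a u * e b u * d c u
      t₂ a b c = O c u * (e a u * d b u)
      t₃ a b c = O b u * O c u * d a u
      S₁ S₂ S₃ : ℕ → ℤ
      S₁ a = ∑[ b ∈ B ] ∑[ c ∈ C ] t₁ a b c
      S₂ a = ∑[ b ∈ B ] ∑[ c ∈ C ] t₂ a b c
      S₃ a = ∑[ b ∈ B ] ∑[ c ∈ C ] t₃ a b c

    0≤cardζ : ∀ D → 0ℤ ≤ card D * ζ
    0≤cardζ D = 0≤* (0≤card D) 0≤ζ

    masked-∑∈ : ∀ D {Z} (U : ℕ → ℤ → ℤ) → (∀ a → In D a → a ℕ.< R D → Good K L (λ m n → θ m n * U a (+ m * + n)) Z) →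
      Good K L (λ m n → θ m n * (∑[ a ∈ D ] U a (+ m * + n))) (card D * Z)
    masked-∑∈ D U h = good-cong (λ m n → ∑∈-*ˡ D (θ m n) (λ a → U a (+ m * + n))) (good-∑∈ D (λ a m n → θ m n * U a (+ m * + n)) h)

    good₁ : Good K L (λ m n → θ m n * W₁ (+ m * + n)) (card A * (card B * (card C * ζ)))
    good₁ = masked-∑∈ A (λ a u → ∑[ b ∈ B ] ∑[ c ∈ C ] (e a u * e b u * d c u)) (λ a xa a<R → masked-∑∈ B (λ b u → ∑[ c ∈ C ] (e a u * e b u * d c u)) (λ b xb b<R → inner a b xa xb a<R b<R))
      where
      inner : ∀ a b → In A a → In B b → a ℕ.< R A → b ℕ.< R B → Good K L (λ m n → θ m n * (∑[ c ∈ C ] (e a (+ m * + n) * e b (+ m * + n) * d c (+ m * + n)))) (card C * ζ)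
      inner a b xa xb a<R b<R = good-cong same (familyGood (λ _ → 1ℤ) (λ _ → 1ℤ) (λ _ → ≤-refl) (λ _ → ≤-refl) (0≤cardζ C)
          (ℕₚ.*-mono-≤ (ℕₚ.*-mono-≤ (sq-mono a<R) (sq-mono b<R)) (ℕₚ.≤-refl {sq (R C)})) cond₁ M)
        where
        pa = prime A xa
        pb = prime B xb
        instance
          nza = prime⇒nonZero pa
          nzb = prime⇒nonZero pb
          nza² = ℕₚ.m*n≢0 a a
          nzb² = ℕₚ.m*n≢0 b b
          nzab = ℕₚ.m*n≢0 (sq a) (sq b)
        open FamilyGood (sq a ℕ.* sq b) (weight a ℕ.* weight b) (R C) (ℕₚ.*-mono-≤ (weight≤ a) (weight≤ b)) (in? C) (prime C)
          (λ xc → coprime-sym (coprime-* (coprime-sym (prime-sq-coprime pa (prime C xc) (A#C xa xc))) (coprime-sym (prime-sq-coprime pb (prime C xc) (B#C xb xc)))))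
        lem : ∀ wa wb x y z → wa * x * (wb * y) * z ≡ wa * wb * (x * y) * z
        lem = solve-∀
        eq : ∀ u c → e a u * e b u * d c u ≡ + (weight a ℕ.* weight b) * E (sq a ℕ.* sq b) u * d c u
        eq u c = trans (lem (+ weight a) (+ weight b) (E (sq a) u) (E (sq b) u) (d c u))
          (cong₂ (λ x y → x * y * d c u) (sym (pos-* (weight a) (weight b))) ([∣]-crt (sq-coprime-sq pa pb (A#B xa xb)) (u - 1ℤ)))
        same : ∀ m n → θ m n * (1ℤ * 1ℤ * ∑ (R C) (λ c → χ C c * (+ (weight a ℕ.* weight b) * E (sq a ℕ.* sq b) (+ m * + n) * d c (+ m * + n)))) ≡ θ m n * (∑[ c ∈ C ] (e a (+ m * + n) * e b (+ m * + n) * d c (+ m * + n)))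
        same m n = cong (θ m n *_) (trans (*-identityˡ _) (∑∈-cong C (λ c _ _ → sym (eq (+ m * + n) c))))

    good₂ : Good K L (λ m n → θ m n * W₂ (+ m * + n)) (card A * (card C * (card B * ζ)))
    good₂ = masked-∑∈ A (λ a u → ∑[ c ∈ C ] ∑[ b ∈ B ] (O c u * (e a u * d b u))) (λ a xa a<R → masked-∑∈ C (λ c u → ∑[ b ∈ B ] (O c u * (e a u * d b u))) (λ c xc c<R → inner a c xa xc a<R))
      where
      inner : ∀ a c → In A a → In C c → a ℕ.< R A → Good K L (λ m n → θ m n * (∑[ b ∈ B ] (O c (+ m * + n) * (e a (+ m * + n) * d b (+ m * + n))))) (card B * ζ)
      inner a c xa xc a<R = good-cong same (familyGood (λ m → O c (+ m)) (λ n → O c (+ n)) (λ m → O-unit c (+ m)) (λ n → O-unit c (+ n)) (0≤cardζ B)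
          (ℕₚ.*-mono-≤ (sq-mono a<R) (ℕₚ.≤-refl {sq (R B)})) cond₂ M)
        where
        pa = prime A xa
        instance
          nza = prime⇒nonZero pa
          nza² = ℕₚ.m*n≢0 a a
        open FamilyGood (sq a) (weight a) (R B) (weight≤ a) (in? B) (prime B) (λ xb → prime-sq-coprime pa (prime B xb) (A#B xa xb))
        same : ∀ m n → θ m n * (O c (+ m) * O c (+ n) * ∑ (R B) (λ b → χ B b * (+ weight a * E (sq a) (+ m * + n) * d b (+ m * + n)))) ≡ θ m n * (∑[ b ∈ B ] (O c (+ m * + n) * (e a (+ m * + n) * d b (+ m * + n))))
        same m n = cong (θ m n *_) (trans (cong (_* ∑ (R B) (λ b → χ B b * (+ weight a * E (sq a) (+ m * + n) * d b (+ m * + n)))) (sym (O-* (prime C xc) (+ m) (+ n)))) (sym (∑∈-*ˡ B (O c (+ m * + n)) _)))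

    good₃ : Good K L (λ m n → θ m n * W₃ (+ m * + n)) (card B * (card C * (card A * ζ)))
    good₃ = masked-∑∈ B (λ b u → ∑[ c ∈ C ] ∑[ a ∈ A ] (O b u * O c u * d a u)) (λ b xb b<R → masked-∑∈ C (λ c u → ∑[ a ∈ A ] (O b u * O c u * d a u)) (λ c xc c<R → inner b c xb xc))
      where
      inner : ∀ b c → In B b → In C c → Good K L (λ m n → θ m n * (∑[ a ∈ A ] (O b (+ m * + n) * O c (+ m * + n) * d a (+ m * + n)))) (card A * ζ)
      inner b c xb xc = good-cong same (familyGood (λ m → O b (+ m) * O c (+ m)) (λ n → O b (+ n) * O c (+ n)) (λ m → unit (+ m)) (λ n → unit (+ n)) (0≤cardζ A) (ℕₚ.≤-refl {1 ℕ.* sq (R A)}) cond₃ M)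
        where
        -- No factor `e` is left here, so the fixed spike is taken modulo 1, where it is constantly
        -- 1.
        open FamilyGood 1 1 (R A) ℕₚ.≤-refl (in? A) (prime A) (λ {ℓ} _ → 1-coprimeTo ℓ)
        re : ∀ x y → x * y * (x * y) ≡ x * x * (y * y)
        re = solve-∀
        unit : ∀ u → O b u * O c u * (O b u * O c u) ≤ 1ℤ
        unit u = subst (_≤ 1ℤ) (sym (re (O b u) (O c u))) (*-mono {O b u * O b u} {1ℤ} (0≤i² (O b u)) 0≤+ (O-unit b u) (O-unit c u))
        mix : ∀ x y x′ y′ → x * y * (x′ * y′) ≡ x * x′ * (y * y′)
        mix = solve-∀
        E1 : ∀ u → E 1 u ≡ 1ℤ
        E1 u = ind-yes (+ 1 ∣? u - 1ℤ) (∣ᵤ⇒∣ (ℕᵈ.1∣ _))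
        same : ∀ m n → θ m n * (O b (+ m) * O c (+ m) * (O b (+ n) * O c (+ n)) * ∑ (R A) (λ a → χ A a * (+ 1 * E 1 (+ m * + n) * d a (+ m * + n)))) ≡ θ m n * (∑[ a ∈ A ] (O b (+ m * + n) * O c (+ m * + n) * d a (+ m * + n)))
        same m n = cong (θ m n *_) (trans (cong₂ _*_ (trans (mix (O b (+ m)) (O c (+ m)) (O b (+ n)) (O c (+ n))) (sym (cong₂ _*_ (O-* (prime B xb) (+ m) (+ n)) (O-* (prime C xc) (+ m) (+ n)))))
            (∑∈-cong A (λ a _ _ → trans (cong (λ v → 1ℤ * v * d a (+ m * + n)) (E1 (+ m * + n))) (*-identityˡ (d a (+ m * + n)))))) (sym (∑∈-*ˡ A (O b (+ m * + n) * O c (+ m * + n)) (λ a → d a (+ m * + n)))))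

    blockGood : Good K L (λ m n → θ m n * 𝒲 A B C (+ m * + n)) (+ 3 * (card A * card B * card C * ζ))
    blockGood = subst (Good K L _) (total (card A) (card B) (card C) ζ)
      (good-cong (λ m n → trans (dist (θ m n) (W₁ (+ m * + n)) (W₂ (+ m * + n)) (W₃ (+ m * + n))) (cong (θ m n *_) (sym (𝒲≡ (+ m * + n))))) (good-+ (good-+ good₁ good₂) good₃))
      where
      dist : ∀ t x y z → t * x + t * y + t * z ≡ t * (x + y + z)
      dist = solve-∀
      total : ∀ a b c z → a * (b * (c * z)) + a * (c * (b * z)) + b * (c * (a * z)) ≡ + 3 * (a * b * c * z)
      total = solve-∀

-- Detection of a prime: from the sieve identity to a positive sum

module Distribution where

  open import Data.Nat.Primality using (Prime; prime?; prime⇒irreducible; prime⇒rough; _Rough_; rough⇒≤; rough∧square>⇒prime; ¬prime[1])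
  open import Data.Integer using (ℤ; +_; -_; _+_; _-_; _*_; _≤_; _<_; 0ℤ; 1ℤ; +≤+; +<+)
  open import Data.Integer.Properties using (≤-refl; ≤-trans; ≤-reflexive; +-mono-≤; +-monoʳ-≤; +-monoˡ-≤; +-identityʳ; +-identityˡ; *-zeroʳ; *-zeroˡ; *-identityˡ; *-identityʳ; *-comm; *-assoc; +-comm; +-assoc; pos-+; pos-*; _≟_; <-irrefl)
  open import Data.Integer.Divisibility.Signed using (_∣_; _∣?_; ∣ᵤ⇒∣; ∣⇒∣ᵤ)
  open import Data.Integer.Tactic.RingSolver using (solve-∀)
  open Sums
  open Congruence
  open Bilinear
  open Kernel
  open Sieve
  open Chebyshev using (π; π-∑)
  open Triples
  open TypeII
  open PrimeSet

  BlockConds : PrimeSet → PrimeSet → PrimeSet → ℕ → ℕ → ℕ → ℤ → Set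
  BlockConds A B C J K L ζ =
    Cond± J K L (sq (R A) ℕ.* sq (R B) ℕ.* sq (R C)) (R C) (card C * ζ) ×
    Cond± J K L (sq (R A) ℕ.* sq (R B)) (R B) (card B * ζ) ×
    Cond± J K L (1 ℕ.* sq (R A)) (R A) (card A * ζ)

  -- one of the two orders of averaging works for the dyadic block 2^(δ+i) ≤ m < 2^(δ+i+1), where n < 2^(3δ) / 2^(δ+i)
  BlockHypothesis : PrimeSet → PrimeSet → PrimeSet → ℕ → ℤ → ℕ → Set
  BlockHypothesis A B C δ ζ i = BlockConds A B C J K L ζ ⊎ BlockConds A C B J K L ζ
    where
    J = sq (suc (3 ℕ.* δ)) ℕ.* sq (suc (3 ℕ.* δ))
    K = 2 ℕ.^ suc (δ ℕ.+ i)
    L = 2 ℕ.^ (3 ℕ.* δ ℕ.∸ (δ ℕ.+ i))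

  -- the least f with m f ≥ x (and 0 for m = 0)
  ceil : ℕ → ℕ → ℕ
  ceil x zero = 0
  ceil x (suc m) = suc (ℕ.pred x ℕᵐ./ suc m)

  ceil≤ : ∀ x .{{_ : ℕ.NonZero x}} m → ceil x m ℕ.≤ x
  ceil≤ x zero = ℕ.z≤n
  ceil≤ x (suc m) = subst (suc (ℕ.pred x ℕᵐ./ suc m) ℕ.≤_) (ℕₚ.suc-pred x) (ℕ.s≤s (ℕᵐ.m/n≤m (ℕ.pred x) (suc m)))

  <⇒<ceil : ∀ x .{{_ : ℕ.NonZero x}} m .{{_ : ℕ.NonZero m}} n → m ℕ.* n ℕ.< x → n ℕ.< ceil x m
  <⇒<ceil x (suc m) n h = ℕ.s≤s (subst (ℕ._≤ ℕ.pred x ℕᵐ./ suc m) (ℕᵐ.m*n/n≡m n (suc m)) (ℕᵐ./-monoˡ-≤ (suc m)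
    (subst (ℕ._≤ ℕ.pred x) (ℕₚ.*-comm (suc m) n) (ℕₚ.≤-pred (subst (suc m ℕ.* n ℕ.<_) (sym (ℕₚ.suc-pred x)) h)))))

  <ceil⇒< : ∀ x .{{_ : ℕ.NonZero x}} m .{{_ : ℕ.NonZero m}} n → n ℕ.< ceil x m → m ℕ.* n ℕ.< x
  <ceil⇒< x (suc m) n h = subst (suc m ℕ.* n ℕ.<_) (ℕₚ.suc-pred x) (ℕ.s≤s (subst (ℕ._≤ ℕ.pred x) (ℕₚ.*-comm n (suc m))
    (ℕₚ.≤-trans (ℕₚ.*-monoˡ-≤ (suc m) (ℕₚ.≤-pred h)) (ℕᵐ.m/n*n≤m (ℕ.pred x) (suc m)))))

  dyadic-step : ∀ {a b} T → a ℕ.≤ b → ∑ b T ≡ ∑ a T + ∑ b (λ m → ind (a ℕ.≤? m) * T m)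
  dyadic-step {a} {b} T a≤b = trans (∑-cong b part) (trans (∑-+ b _ _) (cong (_+ ∑ b (λ m → ind (a ℕ.≤? m) * T m))
    (trans (∑-extend _ a≤b (λ m a≤m → trans (cong (_* T m) (ind-no (m ℕ.<? a) (ℕₚ.≤⇒≯ a≤m))) (*-zeroˡ (T m))))
      (∑-cong< a (λ m m<a → trans (cong (_* T m) (ind-yes (m ℕ.<? a) m<a)) (*-identityˡ (T m)))))))
    where
    l : ∀ t → t ≡ 1ℤ * t + 0ℤ * t
    l = solve-∀
    l′ : ∀ t → t ≡ 0ℤ * t + 1ℤ * t
    l′ = solve-∀
    part : ∀ m → T m ≡ ind (m ℕ.<? a) * T m + ind (a ℕ.≤? m) * T m
    part m with m ℕ.<? a | a ℕ.≤? m
    ... | yes p | yes q = ⊥-elim (ℕₚ.<⇒≱ p q)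
    ... | yes p | no  q = l (T m)
    ... | no  p | yes q = l′ (T m)
    ... | no  p | no  q = ⊥-elim (q (ℕₚ.≮⇒≥ p))

  dyadic-bound : ∀ (T : ℕ → ℤ) Z δ k → (∀ m → m ℕ.< 2 ℕ.^ δ → T m ≡ 0ℤ) →
    (∀ i → i ℕ.< k → ∥ ∑ (2 ℕ.^ suc (δ ℕ.+ i)) (λ m → ind (2 ℕ.^ (δ ℕ.+ i) ℕ.≤? m) * T m) ∥ ≤ Z) →
    ∥ ∑ (2 ℕ.^ (δ ℕ.+ k)) T ∥ ≤ + k * Z
  dyadic-bound T Z δ zero small block = subst (_≤ + 0 * Z) (sym (cong ∥_∥ vanish)) (≤-reflexive (sym (*-zeroˡ Z)))
    where
    vanish : ∑ (2 ℕ.^ (δ ℕ.+ 0)) T ≡ 0ℤ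
    vanish = ∑-zero< (2 ℕ.^ (δ ℕ.+ 0)) (λ m h → small m (subst (m ℕ.<_) (cong (2 ℕ.^_) (ℕₚ.+-identityʳ δ)) h))
  dyadic-bound T Z δ (suc k) small block = subst (_≤ + suc k * Z) (cong ∥_∥ (sym split))
    (≤-trans (∥∥-+ (∑ a T) tail-sum) (≤-trans (+-mono-≤ (dyadic-bound T Z δ k small (λ i i<k → block i (ℕₚ.m<n⇒m<1+n i<k))) (block k ℕₚ.≤-refl)) (≤-reflexive (lem (+ k) Z))))
    where
    a = 2 ℕ.^ (δ ℕ.+ k)
    b = 2 ℕ.^ suc (δ ℕ.+ k)
    tail-sum = ∑ b (λ m → ind (a ℕ.≤? m) * T m)
    lem : ∀ k Z → k * Z + Z ≡ (1ℤ + k) * Z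
    lem = solve-∀
    split : ∑ (2 ℕ.^ (δ ℕ.+ suc k)) T ≡ ∑ a T + tail-sum
    split = trans (cong (λ v → ∑ (2 ℕ.^ v) T) (ℕₚ.+-suc δ k)) (dyadic-step T (ℕₚ.^-monoʳ-≤ 2 (ℕₚ.n≤1+n (δ ℕ.+ k))))

  -- Here x = 2^(3δ). The level D = x^(1/3) places the type II variable m between x^(1/3) and
  -- x^(2/3), and z = √x makes roughness below x the same as primality.
  module Detection (A B C : PrimeSet) (A#B : Disjoint A B) (A#C : Disjoint A C) (B#C : Disjoint B C)
    (δ z ζ : ℕ) (1≤δ : 1 ℕ.≤ δ) (z²≡x : z ℕ.* z ≡ 2 ℕ.^ (3 ℕ.* δ)) (z≤D² : z ℕ.≤ 2 ℕ.^ δ ℕ.* 2 ℕ.^ δ)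
    (RA≤z : R A ℕ.≤ z) (RB≤z : R B ℕ.≤ z) (RC≤z : R C ℕ.≤ z)
    (blocks : ∀ i → i ℕ.< δ → BlockHypothesis A B C δ (+ ζ) i)
    (0<A : 0ℤ < card A) (0<B : 0ℤ < card B) (0<C : 0ℤ < card C)
    where

    x D P̂ : ℕ
    x = 2 ℕ.^ (3 ℕ.* δ)
    D = 2 ℕ.^ δ
    P̂ = sq (R A) ℕ.* sq (R B) ℕ.* sq (R C)

    J₁ : ℕ
    J₁ = suc (3 ℕ.* δ)

    instance
      x≢0 : ℕ.NonZero x
      x≢0 = ℕₚ.m^n≢0 2 (3 ℕ.* δ)
      z≢0 : ℕ.NonZero z
      z≢0 = ℕ.≢-nonZero λ { refl → ℕ.≢-nonZero⁻¹ x (sym z²≡x) }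

    1<D : 1 ℕ.< D
    1<D = ℕₚ.^-monoʳ-< 2 (ℕ.s≤s (ℕ.s≤s ℕ.z≤n)) 1≤δ

    z≤x : z ℕ.≤ x
    z≤x = subst (z ℕ.≤_) z²≡x (ℕₚ.m≤m*n z z)

    H : ℤ
    H = card A * card B * card C

    0≤H : 0ℤ ≤ H
    0≤H = 0≤* (0≤* (0≤card A) (0≤card B)) (0≤card C)

    𝓦 : ℤ → ℤ
    𝓦 = 𝒲 A B C

    tri : (ℕ → ℕ → ℕ → ℤ) → ℤ
    tri f = ∑[ a ∈ A ] ∑[ b ∈ B ] ∑[ c ∈ C ] f a b c

    tri-const : ∀ v → tri (λ _ _ _ → v) ≡ H * v
    tri-const v = trans (∑∈-cong A (λ a _ _ → trans (∑∈-cong B (λ b _ _ → ∑∈-const C v)) (∑∈-const B (card C * v)))) (trans (∑∈-const A (card B * (card C * v))) (lem (card A) (card B) (card C) v))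
      where
      lem : ∀ a b c v → a * (b * (c * v)) ≡ a * b * c * v
      lem = solve-∀

    tri-mono : ∀ f g → (∀ a b c → In A a → In B b → In C c → a ℕ.< R A → b ℕ.< R B → c ℕ.< R C → f a b c ≤ g a b c) → tri f ≤ tri g
    tri-mono f g h = ∑∈-mono A (λ a xa a< → ∑∈-mono B (λ b xb b< → ∑∈-mono C (λ c xc c< → h a b c xa xb xc a< b< c<)))

    tri-bound : ∀ f Z → (∀ a b c → In A a → In B b → In C c → a ℕ.< R A → b ℕ.< R B → c ℕ.< R C → ∥ f a b c ∥ ≤ Z) → ∥ tri f ∥ ≤ H * Z
    tri-bound f Z h = ≤-trans (∑∈-bound A (card B * (card C * Z)) (λ a xa a< → ∑∈-bound B (card C * Z) (λ b xb b< → ∑∈-bound C Z (λ c xc c< → h a b c xa xb xc a< b< c<))))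
      (≤-reflexive (lem (card A) (card B) (card C) Z))
      where
      lem : ∀ a b c v → a * (b * (c * v)) ≡ a * b * c * v
      lem = solve-∀

    tri-∑ : ∀ n (f : ℕ → ℕ → ℕ → ℕ → ℤ) → ∑ n (λ i → tri (f i)) ≡ tri (λ a b c → ∑ n (λ i → f i a b c))
    tri-∑ n f = trans (∑∈-∑ A n _) (∑∈-cong A (λ a _ _ → trans (∑∈-∑ B n _) (∑∈-cong B (λ b _ _ → ∑∈-∑ C n _))))

    w : ℕ → ℤ
    w u = 𝓦 (+ u)

    tri-zero : ∀ f → (∀ a b c → In A a → In B b → In C c → f a b c ≡ 0ℤ) → tri f ≡ 0ℤ
    tri-zero f h = trans (∑∈-cong A (λ a xa _ → ∑∈-cong B (λ b xb _ → ∑∈-cong C (λ c xc _ → h a b c xa xb xc)))) (trans (tri-const 0ℤ) (*-zeroʳ H))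

    O₀ : ∀ ℓ → O ℓ 0ℤ ≡ 0ℤ
    O₀ ℓ = cong (_-_ 1ℤ) (ind-yes (+ ℓ ∣? 0ℤ) (∣ᵤ⇒∣ (ℓ ℕᵈ.∣0)))

    e₀ : ∀ {ℓ} → Prime ℓ → e ℓ 0ℤ ≡ 0ℤ
    e₀ {ℓ} p = trans (cong (+ weight ℓ *_) (E-∣ p (sq ℓ) 0ℤ (ℕᵈ.m∣m*n ℓ) (∣ᵤ⇒∣ (ℓ ℕᵈ.∣0)))) (*-zeroʳ (+ weight ℓ))

    eee₀ : ∀ a b c → In A a → eee a b c 0ℤ ≡ 0ℤ
    eee₀ a b c xa = trans (cong (λ v → v * e b 0ℤ * e c 0ℤ) (e₀ (prime A xa))) (lem (e b 0ℤ) (e c 0ℤ))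
      where
      lem : ∀ x y → 0ℤ * x * y ≡ 0ℤ
      lem = solve-∀

    w₀ : w 0 ≡ 0ℤ
    w₀ = tri-zero (λ a b c → f₃ a b c 0ℤ) (λ a b c xa xb xc → cong₂ _-_ (eee₀ a b c xa) (trans (cong (λ v → v * O b 0ℤ * O c 0ℤ) (O₀ a)) (lem (O b 0ℤ) (O c 0ℤ))))
      where
      lem : ∀ x y → 0ℤ * x * y ≡ 0ℤ
      lem = solve-∀

    open Coefficients z D 1<D z≤D²
    open Identity x w w₀
    open Buchstab x w w₀

    sq-mono : ∀ {m n} → m ℕ.< n → sq m ℕ.≤ sq n
    sq-mono h = ℕₚ.*-mono-≤ (ℕₚ.<⇒≤ h) (ℕₚ.<⇒≤ h)

    P≤P̂ : ∀ {a b c} → a ℕ.< R A → b ℕ.< R B → c ℕ.< R C → sq a ℕ.* sq b ℕ.* sq c ℕ.≤ P̂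
    P≤P̂ p q r = ℕₚ.*-mono-≤ (ℕₚ.*-mono-≤ (sq-mono p) (sq-mono q)) (sq-mono r)

    S₀-bound : ∀ d → ∥ S d 0 ∥ ≤ H * + (3 ℕ.* P̂)
    S₀-bound zero = subst (λ v → ∥ v ∥ ≤ H * + (3 ℕ.* P̂)) (sym (S-zero 0)) (0≤* 0≤H 0≤+)
    S₀-bound d@(suc _) = subst (λ v → ∥ v ∥ ≤ H * + (3 ℕ.* P̂)) (sym eq)
      (tri-bound _ (+ (3 ℕ.* P̂)) (λ a b c xa xb xc a< b< c< → ≤-trans (Triple.typeI (prime A xa) (prime B xb) (prime C xc) (A#B xa xb) (A#C xa xc) (B#C xb xc) (+ d) N)
        (+≤+ (ℕₚ.*-monoʳ-≤ 3 (P≤P̂ a< b< c<)))))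
      where
      N = ceil x d
      eq : S d 0 ≡ tri (λ a b c → ∑ N (λ n → f₃ a b c (+ d * + n)))
      eq = trans (∑-extend _ (ceil≤ x d) (λ n N≤n → trans (cong (_* (1ℤ * w (d ℕ.* n))) (ind-no (d ℕ.* n ℕ.<? x) (λ h → ℕₚ.<⇒≱ (<⇒<ceil x d n h) N≤n))) (*-zeroˡ (1ℤ * w (d ℕ.* n)))))
        (trans (∑-cong< N (λ n n<N → trans (cong (_* (1ℤ * w (d ℕ.* n))) (ind-yes (d ℕ.* n ℕ.<? x) (<ceil⇒< x d n n<N))) (trans (*-identityˡ (1ℤ * w (d ℕ.* n))) (trans (*-identityˡ (w (d ℕ.* n))) (cong 𝓦 (pos-* d n))))))
          (tri-∑ N (λ n a b c → f₃ a b c (+ d * + n))))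

    typeI-bound : ∥ ∑ D (λ d → λ₀ d * S d 0) ∥ ≤ + D * (H * + (3 ℕ.* P̂))
    typeI-bound = ≤-trans (∑-∥∥ D _) (∑-≤-const D _ (λ d → ≤-trans (≤-reflexive (∥∥-* (λ₀ d) (S d 0)))
      (subst (∥ λ₀ d ∥ * ∥ S d 0 ∥ ≤_) (*-identityˡ _) (*-mono {∥ λ₀ d ∥} {1ℤ} 0≤+ (0≤* 0≤H 0≤+) (∥lam∥≤1 z ℕₚ.≤-refl d) (S₀-bound d)))))

    -- Both conditions on (m, n) are comparisons of labels: m n < x through `ceil`, roughness
    -- through `lp`. The cap `n ⊓ x` keeps the label within `J₁` binary digits for every n. Each
    -- comparison costs J₁² in the squared norm.
    θ : ℕ → ℕ → ℤ
    θ m n = ind (n ℕ.⊓ x ℕ.<? ceil x m) * ind (lp z m ℕ.<? suc (lp z n))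

    x<2^J₁ : suc x ℕ.< 2 ℕ.^ J₁
    x<2^J₁ = ℕₚ.≤-trans (ℕₚ.+-monoˡ-≤ x (ℕₚ.^-monoʳ-≤ 2 {1} {3 ℕ.* δ} (ℕₚ.≤-trans 1≤δ (ℕₚ.m≤n*m δ 3)))) (ℕₚ.≤-reflexive (cong (x ℕ.+_) (sym (ℕₚ.+-identityʳ x))))

    θ-mask : ∀ K L → Mask K L θ (sq J₁ ℕ.* sq J₁)
    Mask.mask (θ-mask K L) {Cₖ} {N} 0≤N h = subst (NormBound K L (λ m n → θ m n * Cₖ m n)) factor
      (normBound-cong (λ m n → sym (*-assoc (ind (n ℕ.⊓ x ℕ.<? ceil x m)) (ind (lp z m ℕ.<? suc (lp z n))) (Cₖ m n)))
        (normBound-transpose (normBound-< J₁ (λ n → n ℕ.⊓ x) (ceil x)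
          (λ n → ℕₚ.≤-<-trans (ℕₚ.m⊓n≤n n x) (ℕₚ.<-trans (ℕₚ.n<1+n x) x<2^J₁)) (λ m → ℕₚ.≤-<-trans (ceil≤ x m) (ℕₚ.<-trans (ℕₚ.n<1+n x) x<2^J₁))
          (0≤* {+ (J₁ ℕ.* J₁)} 0≤+ 0≤N)
          (normBound-transpose (normBound-< J₁ (lp z) (λ n → suc (lp z n))
            (λ m → ℕₚ.≤-<-trans (ℕₚ.≤-trans (lp≤ z m) z≤x) (ℕₚ.<-trans (ℕₚ.n<1+n x) x<2^J₁)) (λ n → ℕₚ.≤-<-trans (ℕ.s≤s (ℕₚ.≤-trans (lp≤ z n) z≤x)) x<2^J₁) 0≤N h)))))
      where
      factor : + (J₁ ℕ.* J₁) * (+ (J₁ ℕ.* J₁) * N) ≡ + (sq J₁ ℕ.* sq J₁) * N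
      factor = trans (sym (*-assoc (+ (J₁ ℕ.* J₁)) (+ (J₁ ℕ.* J₁)) N)) (cong (_* N) (sym (pos-* (J₁ ℕ.* J₁) (J₁ ℕ.* J₁))))

    Zζ : ℤ
    Zζ = + 3 * (H * + ζ)

    0≤ζ : 0ℤ ≤ + ζ
    0≤ζ = 0≤+

    block-good : ∀ i → i ℕ.< δ → Good (2 ℕ.^ suc (δ ℕ.+ i)) (2 ℕ.^ (3 ℕ.* δ ℕ.∸ (δ ℕ.+ i))) (λ m n → θ m n * 𝓦 (+ m * + n)) Zζ
    block-good i i<δ with blocks i i<δ
    ... | inj₁ (c₁ , c₂ , c₃) = Block.blockGood A B C A#B A#C B#C (θ-mask _ _) (+ ζ) 0≤ζ c₁ c₂ c₃
    ... | inj₂ (c₁ , c₂ , c₃) = subst (Good _ _ _) (lem (card A) (card B) (card C) (+ ζ))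
          (good-cong (λ m n → cong (θ m n *_) (𝒲-swap A C B (+ m * + n)))
            (Block.blockGood A C B A#C A#B (λ x y eq → B#C y x (sym eq)) (θ-mask _ _) (+ ζ) 0≤ζ c₁ c₂ c₃))
      where
      lem : ∀ a b c s → + 3 * (a * c * b * s) ≡ + 3 * (a * b * c * s)
      lem = solve-∀

    T : ℕ → ℤ
    T m = c m * S m (lp z m)

    -- On the block m ≥ 2^k, so m n < x forces n < L = x/2^k. The inner sum thus becomes a row of a
    -- form of fixed size 2^(k+1) by L, with the lower end of the block put into the coefficient of
    -- m.
    block-bound : ∀ i → i ℕ.< δ → ∥ ∑ (2 ℕ.^ suc (δ ℕ.+ i)) (λ m → ind (2 ℕ.^ (δ ℕ.+ i) ℕ.≤? m) * T m) ∥ ≤ Zζ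
    block-bound i i<δ = subst (λ v → ∥ v ∥ ≤ Zζ) (sym (∑-cong K row)) (good (block-good i i<δ) α (λ _ → 1ℤ) α≤1 (λ _ → ≤-refl))
      where
      k = δ ℕ.+ i
      K = 2 ℕ.^ suc k
      L = 2 ℕ.^ (3 ℕ.* δ ℕ.∸ k)
      k≤3δ : k ℕ.≤ 3 ℕ.* δ
      k≤3δ = ℕₚ.+-monoʳ-≤ δ (ℕₚ.≤-trans (ℕₚ.<⇒≤ i<δ) (ℕₚ.m≤m+n δ (δ ℕ.+ 0)))
      x≡ : 2 ℕ.^ k ℕ.* L ≡ x
      x≡ = trans (sym (ℕₚ.^-distribˡ-+-* 2 k (3 ℕ.* δ ℕ.∸ k))) (cong (2 ℕ.^_) (ℕₚ.m+[n∸m]≡n k≤3δ))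
      L≤x : L ℕ.≤ x
      L≤x = ℕₚ.^-monoʳ-≤ 2 (ℕₚ.m∸n≤m (3 ℕ.* δ) k)
      α : ℕ → ℤ
      α m = ind (2 ℕ.^ k ℕ.≤? m) * c m
      α≤1 : ∀ m → ∥ α m ∥ ≤ 1ℤ
      α≤1 m with 2 ℕ.^ k ℕ.≤? m
      ... | yes _ = subst (λ v → ∥ v ∥ ≤ 1ℤ) (sym (*-identityˡ (c m))) (∥c∥≤1 m)
      ... | no  _ = 0≤+
      row : ∀ m → ind (2 ℕ.^ k ℕ.≤? m) * T m ≡ ∑ L (λ n → α m * 1ℤ * (θ m n * 𝓦 (+ m * + n)))
      row m = trans (sym (*-assoc (ind (2 ℕ.^ k ℕ.≤? m)) (c m) (S m (lp z m)))) (trans (inside (2 ℕ.^ k ℕ.≤? m)) (trans (cong (_* ∑ L (λ n → θ m n * 𝓦 (+ m * + n))) (sym (*-identityʳ (α m)))) (sym (∑-*ˡ L (α m * 1ℤ) (λ n → θ m n * 𝓦 (+ m * + n))))))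
        where
        inside : (p : Dec (2 ℕ.^ k ℕ.≤ m)) → ind p * c m * S m (lp z m) ≡ ind p * c m * ∑ L (λ n → θ m n * 𝓦 (+ m * + n))
        inside (no _)  = trans (cong (_* S m (lp z m)) (*-zeroˡ (c m))) (trans (*-zeroˡ (S m (lp z m))) (sym (trans (cong (_* ∑ L (λ n → θ m n * 𝓦 (+ m * + n))) (*-zeroˡ (c m))) (*-zeroˡ (∑ L (λ n → θ m n * 𝓦 (+ m * + n)))))))
        inside (yes h) = cong (1ℤ * c m *_) (trans (∑-extend _ L≤x out) (∑-cong< L entry))
          where
          instance nzm = ℕ.>-nonZero (ℕₚ.<-≤-trans (ℕ.>-nonZero⁻¹ (2 ℕ.^ k) {{ℕₚ.m^n≢0 2 k}}) h)
          out : ∀ n → L ℕ.≤ n → ind (m ℕ.* n ℕ.<? x) * (ρ (lp z m) n * w (m ℕ.* n)) ≡ 0ℤ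
          out n L≤n = trans (cong (_* (ρ (lp z m) n * w (m ℕ.* n))) (ind-no (m ℕ.* n ℕ.<? x) (ℕₚ.≤⇒≯ (subst (ℕ._≤ m ℕ.* n) x≡ (ℕₚ.*-mono-≤ h L≤n))))) (*-zeroˡ (ρ (lp z m) n * w (m ℕ.* n)))
          entry : ∀ n → n ℕ.< L → ind (m ℕ.* n ℕ.<? x) * (ρ (lp z m) n * w (m ℕ.* n)) ≡ θ m n * 𝓦 (+ m * + n)
          entry n n<L = trans (cong₂ _*_ (ind-cong (m ℕ.* n ℕ.<? x) (n ℕ.⊓ x ℕ.<? ceil x m) (λ h → subst (ℕ._< ceil x m) (sym n⊓x) (<⇒<ceil x m n h)) (λ h → <ceil⇒< x m n (subst (ℕ._< ceil x m) n⊓x h)))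
              (cong₂ _*_ (ρ-lp z m n) (cong 𝓦 (pos-* m n)))) (sym (*-assoc (ind (n ℕ.⊓ x ℕ.<? ceil x m)) (ind (lp z m ℕ.<? suc (lp z n))) (𝓦 (+ m * + n))))
            where
            n⊓x : n ℕ.⊓ x ≡ n
            n⊓x = ℕₚ.m≤n⇒m⊓n≡m (ℕₚ.≤-trans (ℕₚ.<⇒≤ n<L) L≤x)

    T-small : ∀ m → m ℕ.< D → T m ≡ 0ℤ
    T-small m m<D = decide (c m ≟ 0ℤ)
      where
      decide : Dec (c m ≡ 0ℤ) → T m ≡ 0ℤ
      decide (yes eq) = trans (cong (_* S m (lp z m)) eq) (*-zeroˡ (S m (lp z m)))
      decide (no neq) = ⊥-elim (ℕₚ.<⇒≱ m<D (proj₁ (c-supp m neq)))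

    D²≡ : 2 ℕ.^ (δ ℕ.+ δ) ≡ D ℕ.* D
    D²≡ = ℕₚ.^-distribˡ-+-* 2 δ δ

    typeII-bound : ∥ ∑ (D ℕ.* D) T ∥ ≤ + δ * Zζ
    typeII-bound = subst (λ v → ∥ ∑ v T ∥ ≤ + δ * Zζ) D²≡ (dyadic-bound T Zζ δ δ T-small block-bound)

    error : ℤ
    error = + D * (H * + (3 ℕ.* P̂)) + + δ * Zζ

    S-bound : ∥ S 1 z ∥ ≤ error
    S-bound = subst (λ v → ∥ v ∥ ≤ error) (sym buchstab) (≤-trans (∥∥-+ (∑ D (λ d → λ₀ d * S d 0)) _) (+-mono-≤ typeI-bound typeII-bound))

    𝓔 𝓞 : ℤ → ℤ
    𝓔 u = tri (λ a b c → eee a b c u)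
    𝓞 u = tri (λ a b c → ooo a b c u)

    𝓦≡ : ∀ u → 𝓦 u ≡ 𝓔 u - 𝓞 u
    𝓦≡ u = trans (∑∈-cong A (λ a _ _ → trans (∑∈-cong B (λ b _ _ → ∑∈-- C _ _)) (∑∈-- B _ _))) (∑∈-- A _ _)

    0≤𝓔 : ∀ u → 0ℤ ≤ 𝓔 u
    0≤𝓔 u = ∑∈-nonNeg A (λ a → ∑∈-nonNeg B (λ b → ∑∈-nonNeg C (λ c → 0≤eee a b c u)))

    0≤𝓞 : ∀ u → 0ℤ ≤ 𝓞 u
    0≤𝓞 u = ∑∈-nonNeg A (λ a → ∑∈-nonNeg B (λ b → ∑∈-nonNeg C (λ c → 0≤ooo a b c u)))

    e≤sq : ∀ ℓ u → e ℓ u ≤ + sq ℓ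
    e≤sq ℓ u = ≤-trans (*-monoˡ {+ weight ℓ} 0≤+ (E≤1 (sq ℓ) u)) (≤-trans (≤-reflexive (*-identityʳ (+ weight ℓ))) (+≤+ (weight≤ ℓ)))

    𝓔≤ : ∀ u → 𝓔 u ≤ H * + P̂
    𝓔≤ u = ≤-trans (tri-mono (λ a b c → eee a b c u) (λ _ _ _ → + P̂) (λ a b c _ _ _ a< b< c< →
        ≤-trans (*-mono (0≤* (0≤e a u) (0≤e b u)) 0≤+ (*-mono (0≤e a u) 0≤+ (e≤sq a u) (e≤sq b u)) (e≤sq c u))
          (≤-trans (≤-reflexive (trans (cong (_* + sq c) (sym (pos-* (sq a) (sq b)))) (sym (pos-* (sq a ℕ.* sq b) (sq c))))) (+≤+ (P≤P̂ a< b< c<)))))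
      (≤-reflexive (tri-const (+ P̂)))

    O-prime : ∀ {ℓ p} → Prime ℓ → Prime p → ℓ ℕ.< p → O ℓ (+ p) ≡ 1ℤ
    O-prime {ℓ} {p} pℓ pp ℓ<p = cong (_-_ 1ℤ) (ind-no (+ ℓ ∣? + p) λ h → case (prime⇒irreducible pp (∣⇒∣ᵤ h)))
      where
      case : ℓ ≡ 1 ⊎ ℓ ≡ p → ⊥
      case (inj₁ refl) = ¬prime[1] pℓ
      case (inj₂ refl) = ℕₚ.<-irrefl refl ℓ<p

    𝓞-prime : ∀ p → Prime p → z ℕ.≤ p → H ≤ 𝓞 (+ p)
    𝓞-prime p pp z≤p = ≤-trans (≤-reflexive (sym (trans (tri-const 1ℤ) (*-identityʳ H))))
      (tri-mono (λ _ _ _ → 1ℤ) (λ a b c → ooo a b c (+ p)) (λ a b c xa xb xc a< b< c< → ≤-reflexive (sym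
        (cong₂ _*_ (cong₂ _*_ (O-prime (prime A xa) pp (below a< RA≤z)) (O-prime (prime B xb) pp (below b< RB≤z))) (O-prime (prime C xc) pp (below c< RC≤z))))))
      where
      below : ∀ {ℓ r} → ℓ ℕ.< r → r ℕ.≤ z → ℓ ℕ.< p
      below ℓ<r r≤z = ℕₚ.<-≤-trans ℓ<r (ℕₚ.≤-trans r≤z z≤p)

    -- A prime n ≥ z is z-rough and larger than every a, b and c, so it is prime to all of them and
    -- every triple counts. Primes below z are paid for by the last term.
    𝓞-lower : ∀ n → ind (prime? n) * H ≤ ρ z n * 𝓞 (+ n) + ind (n ℕ.<? z) * H
    𝓞-lower n with prime? n | n ℕ.<? z
    ... | no _  | q = subst (_≤ ρ z n * 𝓞 (+ n) + ind q * H) (sym (*-zeroˡ H)) (0≤+-+ (0≤* (0≤ind (rough? z n)) (0≤𝓞 (+ n))) (0≤* (0≤ind q) 0≤H))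
    ... | yes p | yes _ = ≤-by (ρ z n * 𝓞 (+ n)) (0≤* (0≤ind (rough? z n)) (0≤𝓞 (+ n))) (+-comm (ρ z n * 𝓞 (+ n)) (1ℤ * H))
    ... | yes p | no ¬h = subst₂ _≤_ (sym (*-identityˡ H)) (sym (trans (cong (_+ 0ℤ * H) (trans (cong (_* 𝓞 (+ n)) (ind-yes (rough? z n) (rough-≤ (ℕₚ.≮⇒≥ ¬h) (prime⇒rough p)))) (*-identityˡ (𝓞 (+ n))))) (trans (cong (_+_ (𝓞 (+ n))) (*-zeroˡ H)) (+-identityʳ (𝓞 (+ n))))))
        (𝓞-prime n p (ℕₚ.≮⇒≥ ¬h))

    ∑𝓞-lower : + π x * H ≤ ∑ x (λ n → ρ z n * 𝓞 (+ n)) + + z * H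
    ∑𝓞-lower = ≤-trans (≤-reflexive (trans (cong (_* H) (sym (π-∑ x))) (sym (∑-*ʳ x H _))))
      (≤-trans (∑-mono x 𝓞-lower) (≤-reflexive (trans (∑-+ x _ _) (cong (_+_ (∑ x (λ n → ρ z n * 𝓞 (+ n)))) (trans (∑-*ʳ x H _) (cong (_* H) small))))))
      where
      small : ∑ x (λ n → ind (n ℕ.<? z)) ≡ + z
      small = trans (∑-extend _ z≤x (λ n z≤n → ind-no (n ℕ.<? z) (ℕₚ.≤⇒≯ z≤n))) (trans (∑-cong< z (λ n n<z → ind-yes (n ℕ.<? z) n<z)) (trans (∑-const z 1ℤ) (*-identityʳ (+ z))))

    F : ℕ → ℤ
    F n = ρ z n * 𝓔 (+ n)

    S≡ : S 1 z ≡ ∑ x F - ∑ x (λ n → ρ z n * 𝓞 (+ n))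
    S≡ = trans (∑-cong< x (λ n n<x → trans (cong₂ _*_ (ind-yes (1 ℕ.* n ℕ.<? x) (subst (ℕ._< x) (sym (ℕₚ.*-identityˡ n)) n<x)) (cong (ρ z n *_) (trans (cong w (ℕₚ.*-identityˡ n)) (𝓦≡ (+ n)))))
        (lem (ρ z n) (𝓔 (+ n)) (𝓞 (+ n))))) (∑-- x _ _)
      where
      lem : ∀ r a b → 1ℤ * (r * (a - b)) ≡ r * a - r * b
      lem = solve-∀

    ∑F-lower : + π x * H ≤ ∑ x F + (error + + z * H)
    ∑F-lower = ≤-trans ∑𝓞-lower (≤-trans (+-monoˡ-≤ (+ z * H) (≤-trans (≤-reflexive (trans (lem (∑ x F) (∑ x (λ n → ρ z n * 𝓞 (+ n)))) (cong (λ v → ∑ x F + - v) (sym S≡))))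
        (+-monoʳ-≤ (∑ x F) (≤-trans (i≤∥i∥ (- S 1 z)) (≤-trans (≤-reflexive (∥∥-neg (S 1 z))) S-bound))))) (≤-reflexive (+-assoc (∑ x F) error (+ z * H))))
      where
      lem : ∀ f o → o ≡ f + - (f - o)
      lem = solve-∀

    2≤x : 2 ℕ.≤ x
    2≤x = ℕₚ.^-monoʳ-≤ 2 {1} {3 ℕ.* δ} (ℕₚ.≤-trans 1≤δ (ℕₚ.m≤n*m δ 3))

    F₂ : ℕ → ℤ
    F₂ n = F (2 ℕ.+ n)

    -- The point 1 must be removed: it is rough at every level and congruent to 1 modulo everything,
    -- so it has large weight but gives no prime. At 0 the weight is zero.
    ∑F≤ : ∑ x F ≤ H * + P̂ + ∑ (x ℕ.∸ 2) F₂
    ∑F≤ = ≤-trans (≤-reflexive (trans (cong (λ v → ∑ v F) (sym (ℕₚ.m+[n∸m]≡n 2≤x))) (∑-split 2 (x ℕ.∸ 2) F))) (+-monoˡ-≤ (∑ (x ℕ.∸ 2) F₂)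
      (subst (_≤ H * + P̂) (sym first) (≤-trans (*-monoʳ (0≤𝓔 (+ 1)) (ind≤1 (rough? z 1))) (≤-trans (≤-reflexive (*-identityˡ (𝓔 (+ 1)))) (𝓔≤ (+ 1))))))
      where
      first : ∑ 2 F ≡ F 1
      first = trans (cong (λ v → 0ℤ + v + F 1) (trans (cong (ρ z 0 *_) (tri-zero (λ a b c → eee a b c 0ℤ) (λ a b c xa _ _ → eee₀ a b c xa))) (*-zeroʳ (ρ z 0)))) (trans (cong (_+ F 1) (+-identityʳ 0ℤ)) (+-identityˡ (F 1)))

    0<H : 0ℤ < H
    0<H = 0<* (0<* 0<A 0<B) 0<C
      where
      0<* : ∀ {i j} → 0ℤ < i → 0ℤ < j → 0ℤ < i * j
      0<* {i} {j} p q = subst (_< i * j) (*-zeroʳ i) (ℤₚ.*-monoˡ-<-pos i {{ℤ.positive p}} q)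

    -- The four terms are the primes below z, the type I error, the type II error and the weight of
    -- the point 1, each divided by the number H of triples.
    module _ (count : z ℕ.+ D ℕ.* (3 ℕ.* P̂) ℕ.+ δ ℕ.* (3 ℕ.* ζ) ℕ.+ P̂ ℕ.< π x) where

      ∑F₂-pos : 0ℤ < ∑ (x ℕ.∸ 2) F₂
      ∑F₂-pos = ℤₚ.≰⇒> λ ∑≤0 → ℤₚ.<⇒≱ strict
        (≤-trans ∑F-lower (≤-trans (+-monoˡ-≤ (error + + z * H) (≤-trans ∑F≤ (≤-trans (+-monoʳ-≤ (H * + P̂) ∑≤0) (≤-reflexive (+-identityʳ (H * + P̂))))))
          (≤-reflexive total)))
        where
        M : ℕ
        M = z ℕ.+ D ℕ.* (3 ℕ.* P̂) ℕ.+ δ ℕ.* (3 ℕ.* ζ) ℕ.+ P̂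
        lem : ∀ h p d s δ ζ z → h * p + (d * (h * s) + δ * (+ 3 * (h * ζ)) + z * h) ≡ (z + d * s + δ * (+ 3 * ζ) + p) * h
        lem = solve-∀
        total : H * + P̂ + (error + + z * H) ≡ + M * H
        total = trans (lem H (+ P̂) (+ D) (+ (3 ℕ.* P̂)) (+ δ) (+ ζ) (+ z)) (cong (_* H) (sym
          (trans (pos-+ (z ℕ.+ D ℕ.* (3 ℕ.* P̂) ℕ.+ δ ℕ.* (3 ℕ.* ζ)) P̂) (cong (_+ + P̂) (trans (pos-+ (z ℕ.+ D ℕ.* (3 ℕ.* P̂)) (δ ℕ.* (3 ℕ.* ζ)))
            (cong₂ _+_ (trans (pos-+ z (D ℕ.* (3 ℕ.* P̂))) (cong (_+_ (+ z)) (pos-* D (3 ℕ.* P̂)))) (trans (pos-* δ (3 ℕ.* ζ)) (cong (+ δ *_) (pos-* 3 ζ)))))))))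
        strict : + M * H < + π x * H
        strict = ℤₚ.*-monoʳ-<-pos H {{ℤ.positive 0<H}} (+<+ count)

      pos-factors : ∀ {i j} → 0ℤ ≤ i → 0ℤ ≤ j → 0ℤ < i * j → ¬ (i ≡ 0ℤ) × ¬ (j ≡ 0ℤ)
      pos-factors {i} {j} _ _ h = (λ eq → <-irrefl (sym (trans (cong (_* j) eq) (*-zeroˡ j))) h) , (λ eq → <-irrefl (sym (trans (cong (i *_) eq) (*-zeroʳ i))) h)

      ≢0⇒0< : ∀ {i} → 0ℤ ≤ i → ¬ (i ≡ 0ℤ) → 0ℤ < i
      ≢0⇒0< 0≤i i≢0 = ℤₚ.≤∧≢⇒< 0≤i (λ eq → i≢0 (sym eq))

      e-pos : ∀ ℓ u → ¬ (e ℓ u ≡ 0ℤ) → + sq ℓ ∣ u - 1ℤ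
      e-pos ℓ u h = ind≢0 (+ sq ℓ ∣? u - 1ℤ) (λ eq → h (trans (cong (+ weight ℓ *_) eq) (*-zeroʳ (+ weight ℓ))))

      extract-factors : ∀ u → 0ℤ < 𝓔 u → ∃[ a ] ∃[ b ] ∃[ c ] (In A a × In B b × In C c × 0ℤ < eee a b c u)
      extract-factors u h = fromA (∑∈-pos A _ h)
        where
        fromC : ∀ {a b} → In A a → In B b → ∃[ c ] (In C c × c ℕ.< R C × 0ℤ < eee a b c u) → ∃[ a ] ∃[ b ] ∃[ c ] (In A a × In B b × In C c × 0ℤ < eee a b c u)
        fromC {a} {b} xa xb (c , xc , _ , pos) = a , b , c , xa , xb , xc , pos
        fromB : ∀ {a} → In A a → ∃[ b ] (In B b × b ℕ.< R B × 0ℤ < (∑[ c ∈ C ] eee a b c u)) → ∃[ a ] ∃[ b ] ∃[ c ] (In A a × In B b × In C c × 0ℤ < eee a b c u)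
        fromB {a} xa (b , xb , _ , pos) = fromC xa xb (∑∈-pos C (λ c → eee a b c u) pos)
        fromA : ∃[ a ] (In A a × a ℕ.< R A × 0ℤ < (∑[ b ∈ B ] ∑[ c ∈ C ] eee a b c u)) → ∃[ a ] ∃[ b ] ∃[ c ] (In A a × In B b × In C c × 0ℤ < eee a b c u)
        fromA (a , xa , _ , pos) = fromB xa (∑∈-pos B (λ b → ∑[ c ∈ C ] eee a b c u) pos)

      squares∣ : ∀ {a b c} u → In A a → In B b → In C c → 0ℤ < eee a b c (+ suc u) → sq a ℕ.* sq b ℕ.* sq c ℕᵈ.∣ u
      squares∣ {a} {b} {c} u xa xb xc pos =
        coprime-∣* (coprime-sym (coprime-* (sq-coprime-sq pc pa (λ eq → A#C xa xc (sym eq))) (sq-coprime-sq pc pb (λ eq → B#C xb xc (sym eq)))))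
          (coprime-∣* (sq-coprime-sq pa pb (A#B xa xb)) (div a ea) (div b eb)) (div c ec)
        where
        v = + suc u
        pa = prime A xa
        pb = prime B xb
        pc = prime C xc
        ab≢0 = pos-factors (0≤* (0≤e a v) (0≤e b v)) (0≤e c v) pos
        ec = proj₂ ab≢0
        ab = pos-factors (0≤e a v) (0≤e b v) (≢0⇒0< (0≤* (0≤e a v) (0≤e b v)) (proj₁ ab≢0))
        ea = proj₁ ab
        eb = proj₂ ab
        div : ∀ ℓ → ¬ (e ℓ v ≡ 0ℤ) → sq ℓ ℕᵈ.∣ u
        div ℓ h = ∣⇒∣ᵤ (e-pos ℓ v h)

      Goal : Set
      Goal = ∃[ p ] ∃[ a ] ∃[ b ] ∃[ c ] (Prime p × z ℕ.≤ p × p ℕ.< x × In A a × In B b × In C c × sq a ℕ.* sq b ℕ.* sq c ℕᵈ.∣ p ℕ.∸ 1)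

      prime-in-progression : Goal
      prime-in-progression = found (∑-pos⇒∃ (x ℕ.∸ 2) F₂ ∑F₂-pos)
        where
        found : ∃[ i ] (i ℕ.< x ℕ.∸ 2 × 0ℤ < F₂ i) → Goal
        found (i , i< , F>0) = assemble (extract-factors (+ u) (≢0⇒0< (0≤𝓔 (+ u)) (proj₂ nonzero)))
          where
          u = 2 ℕ.+ i
          nonzero = pos-factors (0≤ind (rough? z u)) (0≤𝓔 (+ u)) F>0
          rough : z Rough u
          rough = ind≢0 (rough? z u) (proj₁ nonzero)
          u<x : u ℕ.< x
          u<x = subst (u ℕ.<_) (ℕₚ.m+[n∸m]≡n 2≤x) (ℕₚ.+-monoʳ-< 2 i<)
          assemble : ∃[ a ] ∃[ b ] ∃[ c ] (In A a × In B b × In C c × 0ℤ < eee a b c (+ u)) → Goal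
          -- A z-rough number below z² = x is prime.
          assemble (a , b , c , xa , xb , xc , pos) = u , a , b , c , rough∧square>⇒prime rough (subst (u ℕ.<_) (sym z²≡x) u<x) , rough⇒≤ rough , u<x , xa , xb , xc , squares∣ (suc i) xa xb xc pos

-- The type II conditions as inequalities between exponents

module Exponents where

  open import Data.Nat
  open import Data.Nat.Properties
  open import Data.Nat.Tactic.RingSolver using (solve-∀)
  open Sums using (*-mono; 0≤+; 0≤*)
  open Chebyshev using (n<2^n)
  open Triples using (sq)
  open TypeII using (Cond; bnd; tail)

  lin : ∀ {m n} d → m + d ≡ n → m ≤ n
  lin {m} d refl = m≤m+n m d

  2^+ : ∀ a b → 2 ^ a * 2 ^ b ≡ 2 ^ (a + b)
  2^+ a b = sym (^-distribˡ-+-* 2 a b)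

  2^≤ : ∀ {a b} → a ≤ b → 2 ^ a ≤ 2 ^ b
  2^≤ = ^-monoʳ-≤ 2

  1≤2^ : ∀ a → 1 ≤ 2 ^ a
  1≤2^ a = >-nonZero⁻¹ (2 ^ a) {{m^n≢0 2 a}}

  ⊔-+-lub : ∀ a b c {M} → a + c ≤ M → b + c ≤ M → (a ⊔ b) + c ≤ M
  ⊔-+-lub a b c p q with ⊔-sel a b
  ... | inj₁ eq = subst (λ z → z + c ≤ _) (sym eq) p
  ... | inj₂ eq = subst (λ z → z + c ≤ _) (sym eq) q

  module Scale (t k τ : ℕ) (1≤τ : 1 ≤ τ) where

    -- The unit is T = 2^τ: x = 2^(3δ) = T^(18t+54), the sieve level is 2^δ, and the error allowed
    -- per triple and block is 2^ζ̂ = x/T³.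
    δ J₁ ζ̂ : ℕ
    δ = τ * (6 * t + 18)
    J₁ = suc (3 * δ)
    ζ̂ = τ * (18 * t + 51)

    3δ≡ : 3 * δ ≡ ζ̂ + 3 * τ
    3δ≡ = lem τ t
      where
      lem : ∀ τ t → 3 * (τ * (6 * t + 18)) ≡ τ * (18 * t + 51) + 3 * τ
      lem = solve-∀

    module _ (large : 36 * (suc k ^ suc k) * (sq J₁ * sq J₁) ≤ 2 ^ τ) where

      -- Everything is a power of 2 up to constants; the hypotheses compare exponents in units of τ.
      cond : ∀ q r lo hi n n′ card → ℤ.+ (2 ^ (τ * r)) ℤ.≤ card → n + n′ ≡ suc (3 * δ) → τ * lo + 1 ≤ n → n ≤ τ * hi →
        9 ≤ r → q + 8 ≤ r + lo → q + r + 8 + hi ≤ 18 * t + 51 → 2 * q + r + 8 ≤ 18 * t + 51 → 4 * suc r + 3 * q + hi + 4 ≤ k →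
        Cond (sq J₁ * sq J₁) (2 ^ n) (2 ^ n′) (2 ^ (τ * q)) (2 ^ (τ * suc r)) (card ℤ.* ℤ.+ (2 ^ ζ̂))
      cond q r lo hi n n′ card card≥ n+n′ lo≤n n≤hi c₀ c₂ c₃ c₄ c₅ = record
        { k = k; V = V; V≢0 = m^n≢0 2 v; N′≤V = 2^≤ (m≤m⊔n n′ (θ + 2 * ρ + τ)); negligible = negl; small = small }
        where
        θ ρ v X V : ℕ
        θ = τ * q
        ρ = τ * suc r
        -- The first entry ensures N′ ≤ V. The second makes V exceed the bound QR² for the
        -- off-diagonal period by a factor T, so each average gains T and k of them outweigh the
        -- fixed losses.
        v = n′ ⊔ (θ + 2 * ρ + τ)
        X = n ⊔ θ
        V = 2 ^ v
        N = 2 ^ n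
        N′ = 2 ^ n′
        Q = 2 ^ θ
        R = 2 ^ ρ
        J₄ = sq J₁ * sq J₁
        2[1+Q]≤ : 2 * (1 + Q) ≤ 2 ^ (θ + 2)
        2[1+Q]≤ = ≤-trans (*-monoʳ-≤ 2 (+-monoˡ-≤ Q (1≤2^ θ))) (≤-reflexive (trans (lem Q) (2^+ θ 2)))
          where
          lem : ∀ Q → 2 * (Q + Q) ≡ Q * 4
          lem = solve-∀
        exponents : ρ + ρ + ((θ + (ρ + ρ)) * suc k + (n + ((θ + 2) + (θ + 2)))) ≤ v * k
        exponents = ≤-trans (≤-reflexive (split θ ρ k n)) (≤-trans (+-monoʳ-≤ ((θ + 2 * ρ) * k) rest)
          (≤-trans (≤-reflexive (sym (*-distribʳ-+ k (θ + 2 * ρ) τ))) (*-monoˡ-≤ k (m≤n⊔m n′ (θ + 2 * ρ + τ)))))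
          where
          split : ∀ θ ρ k n → ρ + ρ + ((θ + (ρ + ρ)) * suc k + (n + ((θ + 2) + (θ + 2)))) ≡ (θ + 2 * ρ) * k + (4 * ρ + 3 * θ + n + 4)
          split = solve-∀
          factor : ∀ τ r q hi → 4 * (τ * suc r) + 3 * (τ * q) + τ * hi + 4 * τ ≡ τ * (4 * suc r + 3 * q + hi + 4)
          factor = solve-∀
          rest : 4 * ρ + 3 * θ + n + 4 ≤ τ * k
          rest = ≤-trans (+-mono-≤ (+-monoʳ-≤ (4 * ρ + 3 * θ) n≤hi) (*-monoʳ-≤ 4 1≤τ)) (≤-trans (≤-reflexive (factor τ r q hi)) (*-monoʳ-≤ τ c₅))
        negl : tail k R Q N ≤ (suc k * V) ^ k
        negl = ≤-trans (*-monoʳ-≤ (R * R) (*-monoʳ-≤ ((Q * (R * R)) ^ suc k) (*-monoʳ-≤ N (*-mono-≤ 2[1+Q]≤ 2[1+Q]≤))))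
          (≤-trans (≤-reflexive powers) (≤-trans (2^≤ exponents) (≤-trans (≤-reflexive (sym (^-*-assoc 2 v k))) (^-monoˡ-≤ k (m≤n*m V (suc k))))))
          where
          powers : R * R * ((Q * (R * R)) ^ suc k * (N * (2 ^ (θ + 2) * 2 ^ (θ + 2)))) ≡ 2 ^ (ρ + ρ + ((θ + (ρ + ρ)) * suc k + (n + ((θ + 2) + (θ + 2)))))
          powers = trans (cong₂ _*_ (2^+ ρ ρ) (trans (cong₂ _*_ (trans (cong (_^ suc k) (trans (cong (Q *_) (2^+ ρ ρ)) (2^+ θ (ρ + ρ)))) (^-*-assoc 2 (θ + (ρ + ρ)) (suc k)))
              (trans (cong (N *_) (2^+ (θ + 2) (θ + 2))) (2^+ n ((θ + 2) + (θ + 2))))) (2^+ ((θ + (ρ + ρ)) * suc k) (n + ((θ + 2) + (θ + 2))))))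
            (2^+ (ρ + ρ) ((θ + (ρ + ρ)) * suc k + (n + ((θ + 2) + (θ + 2)))))
        Y = suc k * V
        1≤RYX : 1 ≤ R * Y * 2 ^ X
        1≤RYX = *-mono-≤ (*-mono-≤ (1≤2^ ρ) (*-mono-≤ {1} {suc k} (s≤s z≤n) (1≤2^ v))) (1≤2^ X)
        Q≤Y : Q ≤ Y
        Q≤Y = ≤-trans (2^≤ (≤-trans (≤-trans (m≤m+n θ (2 * ρ)) (m≤m+n (θ + 2 * ρ) τ)) (m≤n⊔m n′ (θ + 2 * ρ + τ)))) (m≤n*m V (suc k))
        N+Q≤ : N + Q ≤ 2 ^ X + 2 ^ X
        N+Q≤ = +-mono-≤ (2^≤ (m≤m⊔n n θ)) (2^≤ (m≤n⊔m n θ))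
        bnd≤ : bnd k R Q Y N ≤ suc k ^ k * (17 * (R * Y * 2 ^ X))
        bnd≤ = *-monoʳ-≤ (suc k ^ k) (≤-trans (+-mono-≤ (*-monoʳ-≤ R (*-mono-≤ (*-monoʳ-≤ 2 (+-monoʳ-≤ Y Q≤Y)) (*-monoʳ-≤ 2 N+Q≤))) 1≤RYX) (≤-reflexive (lem R Y (2 ^ X))))
          where
          lem : ∀ R Y X → R * (2 * (Y + Y) * (2 * (X + X))) + R * Y * X ≡ 17 * (R * Y * X)
          lem = solve-∀
        -- Two maxima give four cases, settled in turn by `c₀`, `c₂`, `c₃` and `c₄`. Of the 5τ, one
        -- is for constants and logarithms, one for R = T^(r+1), and three for x being T³·2^ζ̂.
        vX : v + (X + 5 * τ) ≤ τ * r + ζ̂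
        vX = ⊔-+-lub n′ (θ + 2 * ρ + τ) (X + 5 * τ)
            (≤-trans (≤-reflexive (+-comm n′ (X + 5 * τ))) (≤-trans (≤-reflexive (+-assoc X (5 * τ) n′)) (⊔-+-lub n θ (5 * τ + n′) i₁ i₂)))
            (≤-trans (≤-reflexive (+-comm (θ + 2 * ρ + τ) (X + 5 * τ))) (≤-trans (≤-reflexive (+-assoc X (5 * τ) (θ + 2 * ρ + τ))) (⊔-+-lub n θ (5 * τ + (θ + 2 * ρ + τ)) i₃ i₄)))
          where
          total : n + n′ ≡ suc (ζ̂ + 3 * τ)
          total = trans n+n′ (cong suc 3δ≡)
          i₁ : n + (5 * τ + n′) ≤ τ * r + ζ̂
          i₁ = ≤-trans (≤-reflexive (trans (l₁ n n′ τ) (trans (cong (_+ 5 * τ) total) (l₁′ ζ̂ τ)))) (+-monoˡ-≤ ζ̂ (≤-trans (+-monoˡ-≤ (8 * τ) 1≤τ) (≤-trans (≤-reflexive (*-comm 9 τ)) (*-monoʳ-≤ τ c₀))))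
            where
            l₁ : ∀ n n′ τ → n + (5 * τ + n′) ≡ n + n′ + 5 * τ
            l₁ = solve-∀
            l₁′ : ∀ z τ → suc (z + 3 * τ) + 5 * τ ≡ 1 + 8 * τ + z
            l₁′ = solve-∀
          i₂ : θ + (5 * τ + n′) ≤ τ * r + ζ̂
          i₂ = +-cancelʳ-≤ (τ * lo + 1) _ _ (≤-trans (+-monoʳ-≤ (θ + (5 * τ + n′)) lo≤n)
            (≤-trans (≤-reflexive (trans (l₂ θ τ n′ n) (trans (cong (_+ (θ + 5 * τ)) total) (l₂′ τ q ζ̂)))) (≤-trans (+-monoˡ-≤ (ζ̂ + 1) (*-monoʳ-≤ τ c₂)) (≤-reflexive (l₂″ τ r lo ζ̂)))))
            where
            l₂ : ∀ θ τ n′ n → θ + (5 * τ + n′) + n ≡ n + n′ + (θ + 5 * τ)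
            l₂ = solve-∀
            l₂′ : ∀ τ q z → suc (z + 3 * τ) + (τ * q + 5 * τ) ≡ τ * (q + 8) + (z + 1)
            l₂′ = solve-∀
            l₂″ : ∀ τ r lo z → τ * (r + lo) + (z + 1) ≡ τ * r + z + (τ * lo + 1)
            l₂″ = solve-∀
          i₃ : n + (5 * τ + (θ + 2 * ρ + τ)) ≤ τ * r + ζ̂
          i₃ = ≤-trans (+-monoˡ-≤ (5 * τ + (θ + 2 * ρ + τ)) n≤hi) (≤-trans (≤-reflexive (l₃ τ q r hi)) (+-monoʳ-≤ (τ * r) (*-monoʳ-≤ τ c₃)))
            where
            l₃ : ∀ τ q r hi → τ * hi + (5 * τ + (τ * q + 2 * (τ * suc r) + τ)) ≡ τ * r + τ * (q + r + 8 + hi)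
            l₃ = solve-∀
          i₄ : θ + (5 * τ + (θ + 2 * ρ + τ)) ≤ τ * r + ζ̂
          i₄ = ≤-trans (≤-reflexive (l₄ τ q r)) (+-monoʳ-≤ (τ * r) (*-monoʳ-≤ τ c₄))
            where
            l₄ : ∀ τ q r → τ * q + (5 * τ + (τ * q + 2 * (τ * suc r) + τ)) ≡ τ * r + τ * (2 * q + r + 8)
            l₄ = solve-∀
        smallℕ : J₄ * bnd k R Q Y N * (N * N′) ≤ (2 ^ (τ * r) * 2 ^ ζ̂) * (2 ^ (τ * r) * 2 ^ ζ̂)
        smallℕ = begin
          J₄ * bnd k R Q Y N * (N * N′) ≤⟨ *-monoˡ-≤ (N * N′) (*-monoʳ-≤ J₄ bnd≤) ⟩
          J₄ * (suc k ^ k * (17 * (R * Y * 2 ^ X))) * (N * N′) ≡⟨ cong (J₄ * (suc k ^ k * (17 * (R * Y * 2 ^ X))) *_) (trans (2^+ n n′) (cong (2 ^_) n+n′)) ⟩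
          J₄ * (suc k ^ k * (17 * (R * Y * 2 ^ X))) * (2 * 2 ^ (3 * δ)) ≡⟨ regroup J₄ (suc k ^ k) R (suc k) V (2 ^ X) (2 ^ (3 * δ)) ⟩
          34 * (suc k ^ suc k) * J₄ * (R * V * 2 ^ X * 2 ^ (3 * δ)) ≤⟨ *-monoˡ-≤ _ (≤-trans (*-monoˡ-≤ J₄ (*-monoˡ-≤ (suc k ^ suc k) (m≤m+n 34 2))) large) ⟩
          2 ^ τ * (R * V * 2 ^ X * 2 ^ (3 * δ)) ≡⟨ powers ⟩
          2 ^ (τ + (ρ + v + X + 3 * δ)) ≤⟨ 2^≤ exps ⟩
          2 ^ ((τ * r + ζ̂) + (τ * r + ζ̂)) ≡⟨ sym (trans (cong₂ _*_ (2^+ (τ * r) ζ̂) (2^+ (τ * r) ζ̂)) (2^+ (τ * r + ζ̂) (τ * r + ζ̂))) ⟩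
          (2 ^ (τ * r) * 2 ^ ζ̂) * (2 ^ (τ * r) * 2 ^ ζ̂) ∎
          where
          open ≤-Reasoning
          regroup : ∀ J p R k V X D → J * (p * (17 * (R * (k * V) * X))) * (2 * D) ≡ 34 * (k * p) * J * (R * V * X * D)
          regroup = solve-∀
          powers : 2 ^ τ * (R * V * 2 ^ X * 2 ^ (3 * δ)) ≡ 2 ^ (τ + (ρ + v + X + 3 * δ))
          powers = trans (cong (2 ^ τ *_) (trans (cong (_* 2 ^ (3 * δ)) (trans (cong (_* 2 ^ X) (2^+ ρ v)) (2^+ (ρ + v) X))) (2^+ (ρ + v + X) (3 * δ)))) (2^+ τ (ρ + v + X + 3 * δ))
          exps : τ + (ρ + v + X + 3 * δ) ≤ (τ * r + ζ̂) + (τ * r + ζ̂)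
          exps = ≤-trans (≤-reflexive (trans (cong (λ w → τ + (ρ + v + X + w)) 3δ≡) (l τ r v X ζ̂))) (+-monoʳ-≤ (τ * r + ζ̂) vX)
            where
            l : ∀ τ r v X z → τ + (τ * suc r + v + X + (z + 3 * τ)) ≡ τ * r + z + (v + (X + 5 * τ))
            l = solve-∀
        small : ℤ.+ (J₄ * bnd k R Q Y N * (N * N′)) ℤ.≤ card ℤ.* ℤ.+ (2 ^ ζ̂) ℤ.* (card ℤ.* ℤ.+ (2 ^ ζ̂))
        small = ℤₚ.≤-trans (ℤ.+≤+ smallℕ) (subst (ℤ._≤ card ℤ.* ℤ.+ (2 ^ ζ̂) ℤ.* (card ℤ.* ℤ.+ (2 ^ ζ̂))) (sym (ℤₚ.pos-* (2 ^ (τ * r) * 2 ^ ζ̂) (2 ^ (τ * r) * 2 ^ ζ̂)))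
          (*-mono {ℤ.+ (2 ^ (τ * r) * 2 ^ ζ̂)} {card ℤ.* ℤ.+ (2 ^ ζ̂)} 0≤+ 0≤cζ le le))
          where
          0≤cζ : ℤ.0ℤ ℤ.≤ card ℤ.* ℤ.+ (2 ^ ζ̂)
          0≤cζ = 0≤* {card} {ℤ.+ (2 ^ ζ̂)} (ℤₚ.≤-trans 0≤+ card≥) 0≤+
          le : ℤ.+ (2 ^ (τ * r) * 2 ^ ζ̂) ℤ.≤ card ℤ.* ℤ.+ (2 ^ ζ̂)
          le = subst (ℤ._≤ card ℤ.* ℤ.+ (2 ^ ζ̂)) (sym (ℤₚ.pos-* (2 ^ (τ * r)) (2 ^ ζ̂))) (ℤₚ.*-monoʳ-≤-nonNeg (ℤ.+ (2 ^ ζ̂)) card≥)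

  -- For τ = 2^(2v) the left side is at most 2^(C + 8v), and C + 8v ≤ (C + 8)(v + 1) ≤ 2^v·2^v = τ.
  -- Taking τ to be a power of 2 reduces everything to this comparison of exponents.
  2^-dominates : ∀ C N → ∃[ τ ] (1 ≤ τ × N ≤ τ × C * (τ * τ * (τ * τ)) ≤ 2 ^ τ)
  2^-dominates C N = τ , 1≤2^ (v + v) , ≤-trans (m≤n+m N (C + 8)) (≤-trans (<⇒≤ (n<2^n v)) (2^≤ (m≤m+n v v))) , bound
    where
    v τ : ℕ
    v = C + 8 + N
    τ = 2 ^ (v + v)
    exponents : C + (v + v + (v + v) + (v + v + (v + v))) ≤ τ
    exponents = ≤-trans (lin (v * C + 8) (l C v)) (≤-trans (*-mono-≤ (≤-trans (m≤m+n (C + 8) N) (<⇒≤ (n<2^n v))) (n<2^n v)) (≤-reflexive (2^+ v v)))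
      where
      l : ∀ C v → C + (v + v + (v + v) + (v + v + (v + v))) + (v * C + 8) ≡ (C + 8) * suc v
      l = solve-∀
    bound : C * (τ * τ * (τ * τ)) ≤ 2 ^ τ
    bound = ≤-trans (*-monoˡ-≤ (τ * τ * (τ * τ)) (<⇒≤ (n<2^n C))) (≤-trans (≤-reflexive powers) (2^≤ exponents))
      where
      powers : 2 ^ C * (τ * τ * (τ * τ)) ≡ 2 ^ (C + (v + v + (v + v) + (v + v + (v + v))))
      powers = trans (cong (2 ^ C *_) (trans (cong₂ _*_ (2^+ (v + v) (v + v)) (2^+ (v + v) (v + v))) (2^+ (v + v + (v + v)) (v + v + (v + v))))) (2^+ C _)

-- Choice of the prime sets and verification of the conditions

module Parameters where

  open import Data.Nat
  open import Data.Nat.Properties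
  open import Data.Nat.Divisibility
  open import Data.Nat.Primality using (Prime; prime?)
  open import Data.Nat.Tactic.RingSolver using (solve-∀)
  import Data.Integer.Tactic.RingSolver as ℤˢ
  open import Relation.Nullary.Decidable using (_×-dec_)
  open Sums using (∑; ∑-+; ∑-extend; ∑-cong<; ∑-const)
  open Congruence using (ind; ind-yes; ind-no; 0≤ind)
  open Chebyshev using (π; π-∑; chebyshev)
  open Triples using (PrimeSet; Disjoint; sq)
  open TypeII using (Cond)
  open Distribution using (BlockConds; BlockHypothesis; module Detection)
  open Exponents
  open PrimeSet

  interval : ℕ → ℕ → PrimeSet
  interval lo hi = record
    { R = hi
    ; In = λ ℓ → Prime ℓ × lo ≤ ℓ × ℓ < hi
    ; in? = λ ℓ → prime? ℓ ×-dec (lo ≤? ℓ ×-dec ℓ <? hi)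
    ; prime = proj₁ }

  -- The primes below `lo` are bounded trivially by `lo`, so a lower bound for π suffices. In the
  -- application `hi` is T times `lo`, far more than the logarithm lost in Chebyshev's bound.
  interval-card : ∀ {lo hi} → lo ≤ hi → lo + lo ≤ π hi → ℤ.+ lo ℤ.≤ card (interval lo hi)
  interval-card {lo} {hi} lo≤hi h = cancel (ℤ.+ lo) (ℤ.+ lo) c (ℤₚ.≤-trans (ℤ.+≤+ h) (ℤₚ.≤-trans (ℤₚ.≤-reflexive (sym (π-∑ hi)))
    (ℤₚ.≤-trans (∑-mono< hi pointwise) (ℤₚ.≤-reflexive (trans (∑-+ hi _ _) (cong (ℤ._+_ c) small))))))
    where
    open Sums using (∑-mono<)
    cancel : ∀ a b c → a ℤ.+ b ℤ.≤ c ℤ.+ b → a ℤ.≤ c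
    cancel a b c h = subst₂ ℤ._≤_ (l a b) (l c b) (ℤₚ.+-monoˡ-≤ (ℤ.- b) h)
      where
      l : ∀ a b → a ℤ.+ b ℤ.+ ℤ.- b ≡ a
      l = ℤˢ.solve-∀
    A = interval lo hi
    c = card A
    pointwise : ∀ n → n < hi → ind (prime? n) ℤ.≤ χ A n ℤ.+ ind (n <? lo)
    pointwise n n<hi = go (prime? n) (n <? lo)
      where
      go : (p : Dec (Prime n)) (q : Dec (n < lo)) → ind p ℤ.≤ χ A n ℤ.+ ind q
      go (no _)  q = ℤₚ.+-mono-≤ (0≤ind (in? A n)) (0≤ind q)
      go (yes p) (yes _) = ℤₚ.+-monoˡ-≤ ℤ.1ℤ (0≤ind (in? A n))
      go (yes p) (no ¬q) = ℤₚ.≤-reflexive (sym (cong (ℤ._+ ℤ.0ℤ) (ind-yes (in? A n) (p , ≮⇒≥ ¬q , n<hi))))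
    small : ∑ hi (λ n → ind (n <? lo)) ≡ ℤ.+ lo
    small = trans (∑-extend _ lo≤hi (λ n lo≤n → ind-no (n <? lo) (≤⇒≯ lo≤n))) (trans (∑-cong< lo (λ n n<lo → ind-yes (n <? lo) n<lo)) (trans (∑-const lo ℤ.1ℤ) (ℤₚ.*-identityʳ (ℤ.+ lo))))

  interval-disjoint : ∀ {lo hi lo′ hi′} → hi ≤ lo′ → Disjoint (interval lo hi) (interval lo′ hi′)
  interval-disjoint hi≤lo′ (_ , _ , a<hi) (_ , lo′≤b , _) refl = <-irrefl refl (<-≤-trans a<hi (≤-trans hi≤lo′ lo′≤b))

  π-suc : ∀ n → π (suc n) ≤ suc (π n)
  π-suc n with prime? n
  ... | yes _ = ≤-refl
  ... | no  _ = n≤1+n (π n)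

  π-large : ∀ n M → 1 ≤ n → 2 * (n * suc M) < 2 ^ n → M < π (2 ^ n)
  π-large (suc j) M _ h = ≰⇒> λ π≤M → <⇒≱ h (*-monoʳ-≤ 2 (≤-trans (chebyshev j) (*-monoʳ-≤ (suc j) (≤-trans (π-suc (2 ^ suc j)) (s≤s π≤M)))))

  -- These identities prove the inequalities between exponents for t = 20 + s, with the slack
  -- written as a polynomial in s with nonnegative coefficients. Where it contains no s (`affine2`,
  -- `affine3`, `affine4`, `affine17`), the proportions 1 : 1 : 2 are exhausted and only additive
  -- constants leave room. In `affine16` the slack is t - 15, the strongest demand on the size of t.
  affine1 : ∀ s → 9 + (31 + 2 * s) ≡ 2 * (20 + s)
  affine1 = solve-∀

  affine2 : ∀ s → (suc (20 + s) + suc (20 + s) + (suc (suc (20 + s)) + suc (suc (20 + s))) + (suc (2 * (20 + s)) + suc (2 * (20 + s)))) + 8 + (2) ≡ 2 * (20 + s) + (6 * (20 + s) + 18)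
  affine2 = solve-∀

  affine3 : ∀ s → (suc (20 + s) + suc (20 + s) + (suc (suc (20 + s)) + suc (suc (20 + s))) + (suc (2 * (20 + s)) + suc (2 * (20 + s)))) + 2 * (20 + s) + 8 + 8 * (20 + s) + (35) ≡ 18 * (20 + s) + 51
  affine3 = solve-∀

  affine4 : ∀ s → 2 * (suc (20 + s) + suc (20 + s) + (suc (suc (20 + s)) + suc (suc (20 + s))) + (suc (2 * (20 + s)) + suc (2 * (20 + s)))) + 2 * (20 + s) + 8 + (27) ≡ 18 * (20 + s) + 51
  affine4 = solve-∀

  affine5 : ∀ s → 4 * suc (2 * (20 + s)) + 3 * (suc (20 + s) + suc (20 + s) + (suc (suc (20 + s)) + suc (suc (20 + s))) + (suc (2 * (20 + s)) + suc (2 * (20 + s)))) + 8 * (20 + s) + 4 + (255 + 10 * s) ≡ 50 * (20 + s) + 87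
  affine5 = solve-∀

  affine6 : ∀ s → 9 + (12 + s) ≡ suc (20 + s)
  affine6 = solve-∀

  affine7 : ∀ s → (suc (20 + s) + suc (20 + s) + (suc (suc (20 + s)) + suc (suc (20 + s)))) + 8 + (65 + 3 * s) ≡ suc (20 + s) + (6 * (20 + s) + 18)
  affine7 = solve-∀

  affine8 : ∀ s → (suc (20 + s) + suc (20 + s) + (suc (suc (20 + s)) + suc (suc (20 + s)))) + suc (20 + s) + 8 + 8 * (20 + s) + (136 + 5 * s) ≡ 18 * (20 + s) + 51
  affine8 = solve-∀

  affine9 : ∀ s → 2 * (suc (20 + s) + suc (20 + s) + (suc (suc (20 + s)) + suc (suc (20 + s)))) + suc (20 + s) + 8 + (210 + 9 * s) ≡ 18 * (20 + s) + 51
  affine9 = solve-∀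

  affine10 : ∀ s → 4 * suc (suc (20 + s)) + 3 * (suc (20 + s) + suc (20 + s) + (suc (suc (20 + s)) + suc (suc (20 + s)))) + 8 * (20 + s) + 4 + (577 + 26 * s) ≡ 50 * (20 + s) + 87
  affine10 = solve-∀

  affine11 : ∀ s → 9 + (11 + s) ≡ (20 + s)
  affine11 = solve-∀

  affine12 : ∀ s → (suc (20 + s) + suc (20 + s)) + 8 + (108 + 5 * s) ≡ (20 + s) + (6 * (20 + s) + 18)
  affine12 = solve-∀

  affine13 : ∀ s → (suc (20 + s) + suc (20 + s)) + (20 + s) + 8 + 8 * (20 + s) + (181 + 7 * s) ≡ 18 * (20 + s) + 51
  affine13 = solve-∀

  affine14 : ∀ s → 2 * (suc (20 + s) + suc (20 + s)) + (20 + s) + 8 + (299 + 13 * s) ≡ 18 * (20 + s) + 51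
  affine14 = solve-∀

  affine15 : ∀ s → 4 * suc (20 + s) + 3 * (suc (20 + s) + suc (20 + s)) + 8 * (20 + s) + 4 + (713 + 32 * s) ≡ 50 * (20 + s) + 87
  affine15 = solve-∀

  affine16 : ∀ s → (suc (20 + s) + suc (20 + s) + (suc (2 * (20 + s)) + suc (2 * (20 + s))) + (suc (suc (20 + s)) + suc (suc (20 + s)))) + 8 + (5 + s) ≡ suc (20 + s) + 8 * (20 + s)
  affine16 = solve-∀

  affine17 : ∀ s → (suc (20 + s) + suc (20 + s) + (suc (2 * (20 + s)) + suc (2 * (20 + s))) + (suc (suc (20 + s)) + suc (suc (20 + s)))) + suc (20 + s) + 8 + (9 * (20 + s) + 28) + (6) ≡ 18 * (20 + s) + 51
  affine17 = solve-∀

  affine18 : ∀ s → 2 * (suc (20 + s) + suc (20 + s) + (suc (2 * (20 + s)) + suc (2 * (20 + s))) + (suc (suc (20 + s)) + suc (suc (20 + s)))) + suc (20 + s) + 8 + (46 + s) ≡ 18 * (20 + s) + 51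
  affine18 = solve-∀

  affine19 : ∀ s → 4 * suc (suc (20 + s)) + 3 * (suc (20 + s) + suc (20 + s) + (suc (2 * (20 + s)) + suc (2 * (20 + s))) + (suc (suc (20 + s)) + suc (suc (20 + s)))) + (9 * (20 + s) + 28) + 4 + (283 + 13 * s) ≡ 50 * (20 + s) + 87
  affine19 = solve-∀

  affine20 : ∀ s → (suc (20 + s) + suc (20 + s) + (suc (2 * (20 + s)) + suc (2 * (20 + s)))) + 8 + (68 + 4 * s) ≡ 2 * (20 + s) + 8 * (20 + s)
  affine20 = solve-∀

  affine21 : ∀ s → (suc (20 + s) + suc (20 + s) + (suc (2 * (20 + s)) + suc (2 * (20 + s)))) + 2 * (20 + s) + 8 + (9 * (20 + s) + 28) + (31 + s) ≡ 18 * (20 + s) + 51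
  affine21 = solve-∀

  affine22 : ∀ s → 2 * (suc (20 + s) + suc (20 + s) + (suc (2 * (20 + s)) + suc (2 * (20 + s)))) + 2 * (20 + s) + 8 + (115 + 4 * s) ≡ 18 * (20 + s) + 51
  affine22 = solve-∀

  affine23 : ∀ s → 4 * suc (2 * (20 + s)) + 3 * (suc (20 + s) + suc (20 + s) + (suc (2 * (20 + s)) + suc (2 * (20 + s)))) + (9 * (20 + s) + 28) + 4 + (339 + 15 * s) ≡ 50 * (20 + s) + 87
  affine23 = solve-∀

  affine24 : ∀ s → (suc (20 + s) + suc (20 + s)) + 8 + (130 + 7 * s) ≡ (20 + s) + 8 * (20 + s)
  affine24 = solve-∀

  affine25 : ∀ s → (suc (20 + s) + suc (20 + s)) + (20 + s) + 8 + (9 * (20 + s) + 28) + (133 + 6 * s) ≡ 18 * (20 + s) + 51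
  affine25 = solve-∀

  affine26 : ∀ s → 4 * suc (20 + s) + 3 * (suc (20 + s) + suc (20 + s)) + (9 * (20 + s) + 28) + 4 + (665 + 31 * s) ≡ 50 * (20 + s) + 87
  affine26 = solve-∀

  affine27 : ∀ s → suc (20 + s) + (19 + s) ≡ 2 * (20 + s)
  affine27 = solve-∀

  affine28 : ∀ s → suc (suc (20 + s)) + (18 + s) ≡ 2 * (20 + s)
  affine28 = solve-∀

  affine29 : ∀ s → suc (20 + s) + (186 + 8 * s) ≡ 9 * (20 + s) + 27
  affine29 = solve-∀

  affine30 : ∀ s → suc (suc (20 + s)) + (185 + 8 * s) ≡ 9 * (20 + s) + 27
  affine30 = solve-∀

  affine31 : ∀ s → suc (2 * (20 + s)) + (166 + 7 * s) ≡ 9 * (20 + s) + 27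
  affine31 = solve-∀

  module Choice (s t k : ℕ) (t≡ : t ≡ 20 + s) (k≡ : k ≡ 50 * t + 87) (τ : ℕ) (1≤τ : 1 ≤ τ) where
    open Scale t k τ 1≤τ

    2^τ : ℕ → ℕ
    2^τ i = 2 ^ (τ * i)

    module _ (large : 36 * (suc k ^ suc k) * (sq J₁ * sq J₁) ≤ 2 ^ τ) where

      J₁≤ : 36 * (J₁ * J₁) ≤ 2 ^ τ
      J₁≤ = ≤-trans (≤-trans (*-monoʳ-≤ 36 (m≤m*n (J₁ * J₁) (J₁ * J₁))) (*-monoˡ-≤ (sq J₁ * sq J₁) (m≤m*n 36 (suc k ^ suc k) {{m^n≢0 (suc k) (suc k)}}))) large

      level : ℕ → PrimeSet
      level r = interval (2^τ r) (2^τ (suc r))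

      level-card : ∀ r → suc r ≤ 18 * t + 54 → ℤ.+ 2^τ r ℤ.≤ card (level r)
      level-card r r≤ = interval-card (2^≤ (*-monoʳ-≤ τ (n≤1+n r))) (<⇒≤ (π-large n (2^τ r + 2^τ r) (*-mono-≤ 1≤τ (s≤s (z≤n {r}))) bound))
        where
        n = τ * suc r
        n≤J₁ : n < J₁
        n≤J₁ = s≤s (≤-trans (*-monoʳ-≤ τ r≤) (≤-reflexive (lem τ t)))
          where
          lem : ∀ τ t → τ * (18 * t + 54) ≡ 3 * (τ * (6 * t + 18))
          lem = solve-∀
        bound : 2 * (n * suc (2^τ r + 2^τ r)) < 2 ^ n
        bound = <-≤-trans (≤-<-trans (*-monoʳ-≤ 2 (*-monoʳ-≤ n (+-monoˡ-≤ (2^τ r + 2^τ r) (1≤2^ (τ * r))))) (≤-<-trans (≤-reflexive (lem n (2^τ r))) (*-monoˡ-< (2^τ r) {{m^n≢0 2 (τ * r)}} (<-≤-trans (*-monoʳ-< 6 n≤J₁) 6J₁≤))))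
          (≤-reflexive (trans (2^+ τ (τ * r)) (cong (2 ^_) (sym (*-suc τ r)))))
          where
          lem : ∀ n u → 2 * (n * (u + (u + u))) ≡ 6 * n * u
          lem = solve-∀
          6J₁≤ : 6 * J₁ ≤ 2 ^ τ
          6J₁≤ = ≤-trans (*-mono-≤ (m≤m+n 6 30) (m≤m*n J₁ J₁)) J₁≤

      A B C : PrimeSet
      A = level t
      B = level (suc t)
      C = level (2 * t)

      linear : ∀ (f g : ℕ → ℕ) (h : ℕ → ℕ) → (∀ s → f (20 + s) + h s ≡ g (20 + s)) → f t ≤ g t
      linear f g h eq = subst (λ t → f t ≤ g t) (sym t≡) (lin (h s) (eq s))

      A-card : ℤ.+ 2^τ t ℤ.≤ card A
      A-card = level-card t (lin (17 * t + 53) (e t))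
        where
        e : ∀ t → suc t + (17 * t + 53) ≡ 18 * t + 54
        e = solve-∀

      B-card : ℤ.+ 2^τ (suc t) ℤ.≤ card B
      B-card = level-card (suc t) (lin (17 * t + 52) (e t))
        where
        e : ∀ t → suc (suc t) + (17 * t + 52) ≡ 18 * t + 54
        e = solve-∀

      C-card : ℤ.+ 2^τ (2 * t) ℤ.≤ card C
      C-card = level-card (2 * t) (lin (16 * t + 53) (e t))
        where
        e : ∀ t → suc (2 * t) + (16 * t + 53) ≡ 18 * t + 54
        e = solve-∀

      sq-2^ : ∀ i → sq (2^τ i) ≡ 2^τ (i + i)
      sq-2^ i = trans (2^+ (τ * i) (τ * i)) (cong (2 ^_) (sym (*-distribˡ-+ τ i i)))

      mul-2^ : ∀ i j → 2^τ i * 2^τ j ≡ 2^τ (i + j)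
      mul-2^ i j = trans (2^+ (τ * i) (τ * j)) (cong (2 ^_) (sym (*-distribˡ-+ τ i j)))

      Q₂≡ : ∀ i j → sq (2^τ i) * sq (2^τ j) ≡ 2^τ (i + i + (j + j))
      Q₂≡ i j = trans (cong₂ _*_ (sq-2^ i) (sq-2^ j)) (mul-2^ (i + i) (j + j))

      Q₃≡ : ∀ i j l → sq (2^τ i) * sq (2^τ j) * sq (2^τ l) ≡ 2^τ (i + i + (j + j) + (l + l))
      Q₃≡ i j l = trans (cong₂ _*_ (Q₂≡ i j) (sq-2^ l)) (mul-2^ (i + i + (j + j)) (l + l))

      Q₁≡ : ∀ i → 1 * sq (2^τ i) ≡ 2^τ (i + i)
      Q₁≡ i = trans (*-identityˡ (sq (2^τ i))) (sq-2^ i)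

      z D P̂ ζ : ℕ
      z = 2^τ (9 * t + 27)
      D = 2 ^ δ
      P̂ = sq (R A) * sq (R B) * sq (R C)
      ζ = 2 ^ ζ̂

      J₄ : ℕ
      J₄ = sq J₁ * sq J₁

      Conds : PrimeSet → PrimeSet → PrimeSet → ℕ → ℕ → Set
      Conds A B C N N′ =
        Cond J₄ N N′ (sq (R A) * sq (R B) * sq (R C)) (R C) (card C ℤ.* ℤ.+ ζ) ×
        Cond J₄ N N′ (sq (R A) * sq (R B)) (R B) (card B ℤ.* ℤ.+ ζ) ×
        Cond J₄ N N′ (1 * sq (R A)) (R A) (card A ℤ.* ℤ.+ ζ)

      module BlockLengths (n n′ : ℕ) (n+n′ : n + n′ ≡ suc (3 * δ)) where

        via : ∀ q r {lo hi} X Qₑ → Qₑ ≡ 2^τ q → ℤ.+ 2^τ r ℤ.≤ X → τ * lo + 1 ≤ n → n ≤ τ * hi →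
          9 ≤ r → q + 8 ≤ r + lo → q + r + 8 + hi ≤ 18 * t + 51 → 2 * q + r + 8 ≤ 18 * t + 51 → 4 * suc r + 3 * q + hi + 4 ≤ k →
          Cond J₄ (2 ^ n) (2 ^ n′) Qₑ (2^τ (suc r)) (X ℤ.* ℤ.+ ζ)
        via q r {lo} {hi} X Qₑ eq h lo≤ ≤hi c₀ c₂ c₃ c₄ c₅ =
          subst (λ Q → Cond J₄ (2 ^ n) (2 ^ n′) Q (2^τ (suc r)) (X ℤ.* ℤ.+ ζ)) (sym eq) (cond large q r lo hi n n′ X h n+n′ lo≤ ≤hi c₀ c₂ c₃ c₄ c₅)

        -- Every average gains one factor T, so k must reach the exponent of the fixed off-diagonal
        -- losses. The largest of them is 40t + 32, and 50t + 87 is a comfortable choice.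
        ≤k : ∀ (f : ℕ → ℕ) (h : ℕ → ℕ) → (∀ s → f (20 + s) + h s ≡ 50 * (20 + s) + 87) → f t ≤ k
        ≤k f h eq = ≤-trans (linear f (λ t → 50 * t + 87) h eq) (≤-reflexive (sym k≡))

        -- short variable of size at most T^{8t}: the gain comes from averaging over C
        edge : τ * (6 * t + 18) + 1 ≤ n → n ≤ τ * (8 * t) → Conds A B C (2 ^ n) (2 ^ n′)
        edge lo≤ ≤hi =
            via _ (2 * t) (card C) _ (Q₃≡ (suc t) (suc (suc t)) (suc (2 * t))) C-card lo≤ ≤hi
              (linear (λ _ → 9) (λ t → 2 * t) (λ s → 31 + 2 * s) affine1)
              (linear (λ t → q₃ t + 8) (λ t → 2 * t + (6 * t + 18)) (λ s → 2) affine2)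
              (linear (λ t → q₃ t + 2 * t + 8 + 8 * t) (λ t → 18 * t + 51) (λ s → 35) affine3)
              (linear (λ t → 2 * q₃ t + 2 * t + 8) (λ t → 18 * t + 51) (λ s → 27) affine4)
              (≤k (λ t → 4 * suc (2 * t) + 3 * q₃ t + 8 * t + 4) (λ s → 255 + 10 * s) affine5)
          , via _ (suc t) (card B) _ (Q₂≡ (suc t) (suc (suc t))) B-card lo≤ ≤hi
              (linear (λ _ → 9) (λ t → suc t) (λ s → 12 + s) affine6)
              (linear (λ t → q₂ t + 8) (λ t → suc t + (6 * t + 18)) (λ s → 65 + 3 * s) affine7)
              (linear (λ t → q₂ t + suc t + 8 + 8 * t) (λ t → 18 * t + 51) (λ s → 136 + 5 * s) affine8)
              (linear (λ t → 2 * q₂ t + suc t + 8) (λ t → 18 * t + 51) (λ s → 210 + 9 * s) affine9)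
              (≤k (λ t → 4 * suc (suc t) + 3 * q₂ t + 8 * t + 4) (λ s → 577 + 26 * s) affine10)
          , via _ t (card A) _ (Q₁≡ (suc t)) A-card lo≤ ≤hi
              (linear (λ _ → 9) (λ t → t) (λ s → 11 + s) affine11)
              (linear (λ t → q₁ t + 8) (λ t → t + (6 * t + 18)) (λ s → 108 + 5 * s) affine12)
              (linear (λ t → q₁ t + t + 8 + 8 * t) (λ t → 18 * t + 51) (λ s → 181 + 7 * s) affine13)
              (linear (λ t → 2 * q₁ t + t + 8) (λ t → 18 * t + 51) (λ s → 299 + 13 * s) affine14)
              (≤k (λ t → 4 * suc t + 3 * q₁ t + 8 * t + 4) (λ s → 713 + 32 * s) affine15)
          where
          q₁ q₂ q₃ : ℕ → ℕ
          q₁ t = suc t + suc t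
          q₂ t = suc t + suc t + (suc (suc t) + suc (suc t))
          q₃ t = suc t + suc t + (suc (suc t) + suc (suc t)) + (suc (2 * t) + suc (2 * t))

        -- both variables of size about √x: the gain comes from averaging over B
        middle : τ * (8 * t) + 1 ≤ n → n ≤ τ * (9 * t + 28) → Conds A C B (2 ^ n) (2 ^ n′)
        middle lo≤ ≤hi =
            via _ (suc t) (card B) _ (Q₃≡ (suc t) (suc (2 * t)) (suc (suc t))) B-card lo≤ ≤hi
              (linear (λ _ → 9) (λ t → suc t) (λ s → 12 + s) affine6)
              (linear (λ t → q₃ t + 8) (λ t → suc t + 8 * t) (λ s → 5 + s) affine16)
              (linear (λ t → q₃ t + suc t + 8 + (9 * t + 28)) (λ t → 18 * t + 51) (λ s → 6) affine17)
              (linear (λ t → 2 * q₃ t + suc t + 8) (λ t → 18 * t + 51) (λ s → 46 + s) affine18)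
              (≤k (λ t → 4 * suc (suc t) + 3 * q₃ t + (9 * t + 28) + 4) (λ s → 283 + 13 * s) affine19)
          , via _ (2 * t) (card C) _ (Q₂≡ (suc t) (suc (2 * t))) C-card lo≤ ≤hi
              (linear (λ _ → 9) (λ t → 2 * t) (λ s → 31 + 2 * s) affine1)
              (linear (λ t → q₂ t + 8) (λ t → 2 * t + 8 * t) (λ s → 68 + 4 * s) affine20)
              (linear (λ t → q₂ t + 2 * t + 8 + (9 * t + 28)) (λ t → 18 * t + 51) (λ s → 31 + s) affine21)
              (linear (λ t → 2 * q₂ t + 2 * t + 8) (λ t → 18 * t + 51) (λ s → 115 + 4 * s) affine22)
              (≤k (λ t → 4 * suc (2 * t) + 3 * q₂ t + (9 * t + 28) + 4) (λ s → 339 + 15 * s) affine23)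
          , via _ t (card A) _ (Q₁≡ (suc t)) A-card lo≤ ≤hi
              (linear (λ _ → 9) (λ t → t) (λ s → 11 + s) affine11)
              (linear (λ t → q₁ t + 8) (λ t → t + 8 * t) (λ s → 130 + 7 * s) affine24)
              (linear (λ t → q₁ t + t + 8 + (9 * t + 28)) (λ t → 18 * t + 51) (λ s → 133 + 6 * s) affine25)
              (linear (λ t → 2 * q₁ t + t + 8) (λ t → 18 * t + 51) (λ s → 299 + 13 * s) affine14)
              (≤k (λ t → 4 * suc t + 3 * q₁ t + (9 * t + 28) + 4) (λ s → 665 + 31 * s) affine26)
          where
          q₁ q₂ q₃ : ℕ → ℕ
          q₁ t = suc t + suc t
          q₂ t = suc t + suc t + (suc (2 * t) + suc (2 * t))
          q₃ t = suc t + suc t + (suc (2 * t) + suc (2 * t)) + (suc (suc t) + suc (suc t))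

        short : suc δ ≤ n → n ≤ n′ → Conds A B C (2 ^ n) (2 ^ n′) ⊎ Conds A C B (2 ^ n) (2 ^ n′)
        short δ<n n≤n′ = go (n ≤? τ * (8 * t))
          where
          go : Dec (n ≤ τ * (8 * t)) → Conds A B C (2 ^ n) (2 ^ n′) ⊎ Conds A C B (2 ^ n) (2 ^ n′)
          go (yes h) = inj₁ (edge (≤-trans (≤-reflexive (+-comm (τ * (6 * t + 18)) 1)) δ<n) h)
          -- From 2n ≤ n + n′ = 3δ + 1 follows n ≤ τ(9t + 28); the step from 27 to 28 absorbs the 1.
          go (no ¬h) = inj₂ (middle (≤-trans (≤-reflexive (+-comm (τ * (8 * t)) 1)) (≰⇒> ¬h))
            (*-cancelˡ-≤ 2 (≤-trans (≤-trans (≤-reflexive (cong (n +_) (+-identityʳ n))) (≤-trans (+-monoʳ-≤ n n≤n′) (≤-reflexive n+n′))) (≤-trans (+-monoˡ-≤ (3 * δ) 1≤τ) (lin τ (e τ t))))))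
            where
            e : ∀ τ t → τ + 3 * (τ * (6 * t + 18)) + τ ≡ 2 * (τ * (9 * t + 28))
            e = solve-∀

      -- Both exponents exceed δ because the block lies between D and D². The shorter variable plays
      -- the role of N, and `Cond±` admits either assignment.
      blocks : ∀ i → i < δ → BlockHypothesis A B C δ (ℤ.+ ζ) i
      blocks i i<δ = go (≤-total n n′)
        where
        n n′ : ℕ
        n = suc (δ + i)
        n′ = 3 * δ ∸ (δ + i)
        sum : n + n′ ≡ suc (3 * δ)
        sum = cong suc (m+[n∸m]≡n (+-monoʳ-≤ δ (≤-trans (<⇒≤ i<δ) (m≤m+n δ (δ + 0)))))
        δ<n′ : suc δ ≤ n′
        δ<n′ = ≤-trans (≤-reflexive (sym (m+n∸n≡m (suc δ) (δ + i)))) (∸-monoˡ-≤ (δ + i) (≤-trans (≤-reflexive (e δ i)) (≤-trans (+-monoʳ-≤ (δ + δ) i<δ) (≤-reflexive (e′ δ)))))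
          where
          e : ∀ δ i → suc δ + (δ + i) ≡ δ + δ + suc i
          e = solve-∀
          e′ : ∀ δ → δ + δ + δ ≡ 3 * δ
          e′ = solve-∀
        go : n ≤ n′ ⊎ n′ ≤ n → BlockConds A B C J₄ (2 ^ n) (2 ^ n′) (ℤ.+ ζ) ⊎ BlockConds A C B J₄ (2 ^ n) (2 ^ n′) (ℤ.+ ζ)
        go (inj₁ h) = Data.Sum.map (λ (x , y , w) → inj₁ x , inj₁ y , inj₁ w) (λ (x , y , w) → inj₁ x , inj₁ y , inj₁ w) (BlockLengths.short n n′ sum (s≤s (m≤m+n δ i)) h)
        go (inj₂ h) = Data.Sum.map (λ (x , y , w) → inj₂ x , inj₂ y , inj₂ w) (λ (x , y , w) → inj₂ x , inj₂ y , inj₂ w) (BlockLengths.short n′ n (trans (+-comm n′ n) sum) δ<n′ h)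

      3δ≡τ : τ * (18 * t + 54) ≡ 3 * δ
      3δ≡τ = e τ t
        where
        e : ∀ τ t → τ * (18 * t + 54) ≡ 3 * (τ * (6 * t + 18))
        e = solve-∀

      z²≡x : z * z ≡ 2 ^ (3 * δ)
      z²≡x = trans (mul-2^ (9 * t + 27) (9 * t + 27)) (cong (2 ^_) (trans (cong (τ *_) (e t)) 3δ≡τ))
        where
        e : ∀ t → 9 * t + 27 + (9 * t + 27) ≡ 18 * t + 54
        e = solve-∀

      z≤D² : z ≤ D * D
      z≤D² = ≤-trans (2^≤ (≤-trans (*-monoʳ-≤ τ (lin (3 * t + 9) (e t))) (≤-reflexive (*-distribˡ-+ τ (6 * t + 18) (6 * t + 18))))) (≤-reflexive (sym (2^+ δ δ)))
        where
        e : ∀ t → 9 * t + 27 + (3 * t + 9) ≡ 6 * t + 18 + (6 * t + 18)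
        e = solve-∀

      2^τ-mono : ∀ {i j} → i ≤ j → 2^τ i ≤ 2^τ j
      2^τ-mono h = 2^≤ (*-monoʳ-≤ τ h)

      1≤δ : 1 ≤ δ
      1≤δ = *-mono-≤ 1≤τ (≤-trans (s≤s z≤n) (m≤n+m 18 (6 * t)))

      positive : ∀ r {X} → ℤ.+ 2^τ r ℤ.≤ X → ℤ.0ℤ ℤ.< X
      positive r h = ℤₚ.<-≤-trans (ℤ.+<+ (1≤2^ (τ * r))) h

      -- The exponents of z, P̂ and DP̂ are about 9t, 8t and 14t in units of τ, all below that of ζ
      -- = x/T³, so the errors total at most ζ(5 + 3δ). Chebyshev's bound loses only a factor of
      -- about 6δ against x, and both logarithmic factors together fit into T.
      count : z + D * (3 * P̂) + δ * (3 * ζ) + P̂ < π (2 ^ (3 * δ))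
      count = ≤-<-trans (≤-trans (+-mono-≤ (+-monoˡ-≤ (δ * (3 * ζ)) (+-mono-≤ z≤ζ DP̂≤)) P̂≤ζ) (≤-reflexive (collect ζ δ))) (π-large (3 * δ) (ζ * (5 + 3 * δ)) (≤-trans 1≤δ (m≤n*m δ 3)) bound)
        where
        z≤ζ : z ≤ ζ
        z≤ζ = 2^τ-mono (lin (9 * t + 24) (e t))
          where
          e : ∀ t → 9 * t + 27 + (9 * t + 24) ≡ 18 * t + 51
          e = solve-∀
        P̂≡ : P̂ ≡ 2^τ (8 * t + 8)
        P̂≡ = trans (Q₃≡ (suc t) (suc (suc t)) (suc (2 * t))) (cong 2^τ (e t))
          where
          e : ∀ t → suc t + suc t + (suc (suc t) + suc (suc t)) + (suc (2 * t) + suc (2 * t)) ≡ 8 * t + 8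
          e = solve-∀
        P̂≤ζ : P̂ ≤ ζ
        P̂≤ζ = ≤-trans (≤-reflexive P̂≡) (2^τ-mono (lin (10 * t + 43) (e t)))
          where
          e : ∀ t → 8 * t + 8 + (10 * t + 43) ≡ 18 * t + 51
          e = solve-∀
        DP̂≤ : D * (3 * P̂) ≤ 3 * ζ
        DP̂≤ = ≤-trans (≤-reflexive (trans (cong (λ v → D * (3 * v)) P̂≡) (swap D (2^τ (8 * t + 8))))) (*-monoʳ-≤ 3 (≤-trans (≤-reflexive (mul-2^ (6 * t + 18) (8 * t + 8))) (2^τ-mono (lin (4 * t + 25) (e t)))))
          where
          swap : ∀ a b → a * (3 * b) ≡ 3 * (a * b)
          swap = solve-∀
          e : ∀ t → 6 * t + 18 + (8 * t + 8) + (4 * t + 25) ≡ 18 * t + 51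
          e = solve-∀
        collect : ∀ ζ δ → ζ + 3 * ζ + δ * (3 * ζ) + ζ ≡ ζ * (5 + 3 * δ)
        collect = solve-∀
        bound : 2 * (3 * δ * suc (ζ * (5 + 3 * δ))) < 2 ^ (3 * δ)
        bound = begin-strict
          2 * (3 * δ * suc (ζ * (5 + 3 * δ))) ≤⟨ *-monoʳ-≤ 2 (*-monoʳ-≤ (3 * δ) (+-monoˡ-≤ (ζ * (5 + 3 * δ)) (1≤2^ ζ̂))) ⟩
          2 * (3 * δ * (ζ + ζ * (5 + 3 * δ))) <⟨ *-monoʳ-< 2 (*-monoˡ-< (ζ + ζ * (5 + 3 * δ)) {{>-nonZero (≤-trans (1≤2^ ζ̂) (m≤m+n ζ _))}} (n<1+n (3 * δ))) ⟩
          2 * (J₁ * (ζ + ζ * (5 + 3 * δ))) ≤⟨ lin _ (e δ ζ) ⟩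
          36 * (J₁ * J₁) * ζ ≤⟨ *-monoˡ-≤ ζ J₁≤ ⟩
          2 ^ τ * ζ ≡⟨ 2^+ τ ζ̂ ⟩
          2 ^ (τ + ζ̂) ≤⟨ 2^≤ (≤-trans (lin {τ + ζ̂} (2 * τ) (e′ τ ζ̂)) (≤-reflexive (sym 3δ≡))) ⟩
          2 ^ (3 * δ) ∎
          where
          open ≤-Reasoning
          e : ∀ δ ζ → 2 * (suc (3 * δ) * (ζ + ζ * (5 + 3 * δ))) + (24 + 174 * δ + 306 * δ * δ) * ζ ≡ 36 * (suc (3 * δ) * suc (3 * δ)) * ζ
          e = solve-∀
          e′ : ∀ τ z → τ + z + 2 * τ ≡ z + 3 * τ
          e′ = solve-∀

      open Detection A B C
        (interval-disjoint ≤-refl)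
        (interval-disjoint (2^τ-mono (linear (λ t → suc t) (λ t → 2 * t) (λ s → 19 + s) affine27)))
        (interval-disjoint (2^τ-mono (linear (λ t → suc (suc t)) (λ t → 2 * t) (λ s → 18 + s) affine28)))
        δ z ζ 1≤δ z²≡x z≤D²
        (2^τ-mono (linear (λ t → suc t) (λ t → 9 * t + 27) (λ s → 186 + 8 * s) affine29))
        (2^τ-mono (linear (λ t → suc (suc t)) (λ t → 9 * t + 27) (λ s → 185 + 8 * s) affine30))
        (2^τ-mono (linear (λ t → suc (2 * t)) (λ t → 9 * t + 27) (λ s → 166 + 7 * s) affine31))
        blocks (positive t A-card) (positive (suc t) B-card) (positive (2 * t) C-card)
        using (prime-in-progression)

      prime-with-square : ∃[ p ] ∃[ m ] (Prime p × z ≤ p × p < 2 ^ (3 * δ) × 2^τ (4 * t + 1) ≤ m × m * m ∣ p ∸ 1)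
      prime-with-square = repack (prime-in-progression count)
        where
        repack : ∃[ p ] ∃[ a ] ∃[ b ] ∃[ c ] (Prime p × z ≤ p × p < 2 ^ (3 * δ) × In A a × In B b × In C c × sq a * sq b * sq c ∣ p ∸ 1) →
          ∃[ p ] ∃[ m ] (Prime p × z ≤ p × p < 2 ^ (3 * δ) × 2^τ (4 * t + 1) ≤ m × m * m ∣ p ∸ 1)
        repack (p , a , b , c , pr , z≤p , p<x , (_ , a≥ , _) , (_ , b≥ , _) , (_ , c≥ , _) , h) =
          p , a * b * c , pr , z≤p , p<x ,
          ≤-trans (≤-reflexive (sym (trans (cong (_* 2^τ (2 * t)) (mul-2^ t (suc t))) (trans (mul-2^ (t + suc t) (2 * t)) (cong 2^τ (e t)))))) (*-mono-≤ (*-mono-≤ a≥ b≥) c≥) ,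
          subst (_∣ p ∸ 1) (squares a b c) h
          where
          e : ∀ t → t + suc t + 2 * t ≡ 4 * t + 1
          e = solve-∀
          squares : ∀ a b c → a * a * (b * b) * (c * c) ≡ a * b * c * (a * b * c)
          squares = solve-∀

-- From a large square factor of p - 1 to the bound for `s`

module Conclusion where

  open import Defs using (s; lsq)
  open import Data.Nat
  open import Data.Nat.Properties
  open import Data.Nat.Divisibility
  open import Data.Nat.DivMod using (m/n*n≤m)
  open import Data.Nat.Primality using (Prime; prime⇒nonTrivial)
  open import Data.Nat.Tactic.RingSolver using (solve-∀)
  open Kernel using (^-distribʳ-*)
  open Chebyshev using (n<2^n)
  open Triples using (sq)
  open Exponents
  open Parameters using (module Choice)

  ≤lsq : ∀ n k m → m ≤ k → suc m * suc m ∣ n → m ≤ lsq n k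
  ≤lsq n zero m m≤k h = m≤k
  ≤lsq n (suc k) m m≤k h with (suc (suc k) * suc (suc k)) ∣? n
  ... | yes _ = m≤k
  ... | no ¬h = ≤lsq n k m (≤-pred (≤∧≢⇒< m≤k λ { refl → ¬h h })) h

  -- The square divided out in `s n` has a root at least m. As `lsq` stores the root minus one, m
  -- enters as a successor.
  s-≤ : ∀ n m → 1 ≤ n → m * m ∣ n → s n * (m * m) ≤ n
  s-≤ n zero 1≤n h = ≤-trans (≤-reflexive (*-zeroʳ (s n))) z≤n
  s-≤ n (suc m) 1≤n h = ≤-trans (*-monoʳ-≤ (s n) (*-mono-≤ m≤ m≤)) (m/n*n≤m n (suc (lsq n n) * suc (lsq n n)))
    where
    m≤ : suc m ≤ suc (lsq n n)
    m≤ = s≤s (≤lsq n n m (≤-trans (n≤1+n m) (≤-trans (m≤m*n (suc m) (suc m)) (∣⇒≤ {{>-nonZero 1≤n}} h))) h)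

  module _ (a b N t k : ℕ) (1≤a : 1 ≤ a) (t≡ : t ≡ 20 + 3 * b) (k≡ : k ≡ 50 * t + 87) where

    c₁ C₀ : ℕ
    c₁ = 1 + 3 * (6 * t + 18)
    C₀ = 36 * (suc k ^ suc k) * (c₁ * c₁ * (c₁ * c₁))

    -- Write σ for `s` at p - 1. From σm² ≤ p follows σ^(9b)·m^(18b) ≤ p^(5b)·p^(4b). Since m is
    -- nearly p^(2/9) or more, p^(4b) is at most p^(9a)·m^(18b), and m^(18b) cancels.
    large-prime : ∃[ p ] (N < p × Prime p × s (p ∸ 1) ^ (9 * b) ≤ p ^ (5 * b + 9 * a))
    large-prime = choose (2^-dominates C₀ (suc N))
      where
      choose : ∃[ τ ] (1 ≤ τ × suc N ≤ τ × C₀ * (τ * τ * (τ * τ)) ≤ 2 ^ τ) → ∃[ p ] (N < p × Prime p × s (p ∸ 1) ^ (9 * b) ≤ p ^ (5 * b + 9 * a))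
      choose (τ , 1≤τ , N<τ , dom) = conclude (Choice.prime-with-square (3 * b) t k t≡ k≡ τ 1≤τ large)
        where
        open Scale t k τ 1≤τ using (J₁; δ)
        J₁≤ : J₁ ≤ τ * c₁
        J₁≤ = ≤-trans (+-monoˡ-≤ (3 * δ) 1≤τ) (≤-reflexive (l τ t))
          where
          l : ∀ τ t → τ + 3 * (τ * (6 * t + 18)) ≡ τ * (1 + 3 * (6 * t + 18))
          l = solve-∀
        J₁²≤ : J₁ * J₁ ≤ (τ * c₁) * (τ * c₁)
        J₁²≤ = *-mono-≤ J₁≤ J₁≤
        large : 36 * (suc k ^ suc k) * (sq J₁ * sq J₁) ≤ 2 ^ τ
        large = ≤-trans (*-monoʳ-≤ (36 * (suc k ^ suc k)) (*-mono-≤ J₁²≤ J₁²≤)) (≤-trans (≤-reflexive (l (36 * (suc k ^ suc k)) τ c₁)) dom)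
          where
          l : ∀ x τ c → x * ((τ * c) * (τ * c) * ((τ * c) * (τ * c))) ≡ x * (c * c * (c * c)) * (τ * τ * (τ * τ))
          l = solve-∀
        conclude : ∃[ p ] ∃[ m ] (Prime p × 2 ^ (τ * (9 * t + 27)) ≤ p × p < 2 ^ (3 * δ) × 2 ^ (τ * (4 * t + 1)) ≤ m × m * m ∣ p ∸ 1) →
          ∃[ p ] (N < p × Prime p × s (p ∸ 1) ^ (9 * b) ≤ p ^ (5 * b + 9 * a))
        conclude (p , m , pr , z≤p , p<x , m≥ , m²∣) = p , N<p , pr ,
          *-cancelʳ-≤ (σ ^ (9 * b)) (p ^ (5 * b + 9 * a)) (m ^ (18 * b)) {{m^n≢0 m (18 * b) {{>-nonZero (≤-trans (1≤2^ (τ * (4 * t + 1))) m≥)}}}} main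
          where
          σ = s (p ∸ 1)
          1<p : 1 < p
          1<p = nonTrivial⇒n>1 p {{prime⇒nonTrivial pr}}
          N<p : N < p
          N<p = ≤-trans N<τ (≤-trans (<⇒≤ (n<2^n τ)) (≤-trans (2^≤ (≤-trans (m≤m*n τ (9 * t + 27) {{>-nonZero (≤-trans (s≤s z≤n) (m≤n+m 27 (9 * t)))}}) ≤-refl)) z≤p))
          σm²≤p : σ * (m * m) ≤ p
          σm²≤p = ≤-trans (s-≤ (p ∸ 1) m (∸-monoˡ-≤ 1 1<p) m²∣) (m∸n≤m p 1)
          m-power : (m * m) ^ (9 * b) ≡ m ^ (18 * b)
          m-power = trans (cong (λ v → (m * v) ^ (9 * b)) (sym (*-identityʳ m))) (trans (^-*-assoc m 2 (9 * b)) (cong (m ^_) (sym (*-assoc 2 9 b))))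
          exponents : 3 * δ * (4 * b) ≤ τ * (9 * t + 27) * 9 + τ * (4 * t + 1) * (18 * b)
          exponents = ≤-trans (≤-reflexive (l₁ τ t b)) (≤-trans (*-monoʳ-≤ τ inner) (≤-reflexive (l₂ τ t b)))
            where
            l₁ : ∀ τ t b → 3 * (τ * (6 * t + 18)) * (4 * b) ≡ τ * (72 * t * b + 216 * b)
            l₁ = solve-∀
            l₂ : ∀ τ t b → τ * (72 * t * b + (18 * b + 81 * t + 243)) ≡ τ * (9 * t + 27) * 9 + τ * (4 * t + 1) * (18 * b)
            l₂ = solve-∀
            l₃ : ∀ b → 216 * b + (45 * b + 1863) ≡ 18 * b + 81 * (20 + 3 * b) + 243
            l₃ = solve-∀
            -- The terms 72tb agree because (abc)² is x^(4/9) to leading order. The rest requires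
            -- 198b ≤ 81t + 243, where the right side comes from p^9 ≥ z^9; hence the choice t = 20
            -- + 3b.
            inner : 72 * t * b + 216 * b ≤ 72 * t * b + (18 * b + 81 * t + 243)
            inner = +-monoʳ-≤ (72 * t * b) (subst (λ t → 216 * b ≤ 18 * b + 81 * t + 243) (sym t≡) (lin (45 * b + 1863) (l₃ b)))
          p^4b≤ : p ^ (4 * b) ≤ p ^ (9 * a) * m ^ (18 * b)
          p^4b≤ = begin
            p ^ (4 * b) ≤⟨ ^-monoˡ-≤ (4 * b) (<⇒≤ p<x) ⟩
            (2 ^ (3 * δ)) ^ (4 * b) ≡⟨ ^-*-assoc 2 (3 * δ) (4 * b) ⟩
            2 ^ (3 * δ * (4 * b)) ≤⟨ 2^≤ exponents ⟩
            2 ^ (τ * (9 * t + 27) * 9 + τ * (4 * t + 1) * (18 * b)) ≡⟨ sym (trans (cong₂ _*_ (^-*-assoc 2 (τ * (9 * t + 27)) 9) (^-*-assoc 2 (τ * (4 * t + 1)) (18 * b))) (2^+ (τ * (9 * t + 27) * 9) (τ * (4 * t + 1) * (18 * b)))) ⟩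
            (2 ^ (τ * (9 * t + 27))) ^ 9 * (2 ^ (τ * (4 * t + 1))) ^ (18 * b) ≤⟨ *-mono-≤ (^-monoˡ-≤ 9 z≤p) (^-monoˡ-≤ (18 * b) m≥) ⟩
            p ^ 9 * m ^ (18 * b) ≤⟨ *-monoˡ-≤ (m ^ (18 * b)) (^-monoʳ-≤ p {{>-nonZero (<⇒≤ 1<p)}} (*-monoʳ-≤ 9 1≤a)) ⟩
            p ^ (9 * a) * m ^ (18 * b) ∎
            where open ≤-Reasoning
          main : σ ^ (9 * b) * m ^ (18 * b) ≤ p ^ (5 * b + 9 * a) * m ^ (18 * b)
          main = begin
            σ ^ (9 * b) * m ^ (18 * b) ≡⟨ trans (cong (σ ^ (9 * b) *_) (sym m-power)) (sym (^-distribʳ-* (9 * b) σ (m * m))) ⟩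
            (σ * (m * m)) ^ (9 * b) ≤⟨ ^-monoˡ-≤ (9 * b) σm²≤p ⟩
            p ^ (9 * b) ≡⟨ trans (cong (p ^_) (*-distribʳ-+ b 5 4)) (^-distribˡ-+-* p (5 * b) (4 * b)) ⟩
            p ^ (5 * b) * p ^ (4 * b) ≤⟨ *-monoʳ-≤ (p ^ (5 * b)) p^4b≤ ⟩
            p ^ (5 * b) * (p ^ (9 * a) * m ^ (18 * b)) ≡⟨ trans (sym (*-assoc (p ^ (5 * b)) (p ^ (9 * a)) (m ^ (18 * b)))) (cong (_* m ^ (18 * b)) (sym (^-distribˡ-+-* p (5 * b) (9 * a)))) ⟩
            p ^ (5 * b + 9 * a) * m ^ (18 * b) ∎
            where open ≤-Reasoning

open import Defs
open import Data.Nat using (ℕ; _*_; _+_; _∸_; _^_; _≤_; _<_)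
open import Data.Nat.Primality using (Prime)
open import Data.Product using (∃-syntax; _×_)

-- Here ε = a/b, and the bound p^(5/9 + ε) is raised to the power 9b. Positive rationals suffice
-- because the bound weakens as ε grows, and a prime beyond every N means infinitely many.
theorem5 : (a b : ℕ) → 1 ≤ a → 1 ≤ b → (N : ℕ) →
    ∃[ p ] (N < p × Prime p × s (p ∸ 1) ^ (9 * b) ≤ p ^ (5 * b + 9 * a))
theorem5 a b 1≤a 1≤b N = Conclusion.large-prime a b N (20 + 3 * b) (50 * (20 + 3 * b) + 87) 1≤a refl refl
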